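{- Let $H$ be any fixed hypergraph. For every $\varepsilon\ge 1$, there is an $\varepsilon$-DP implicit representation scheme $(\mathcal{E},\mathcal{D})$ for $H$-Packing, with a polynomial-time decoder $\mathcal{D}$, that is a $$\left(1-O\!\left(\frac{\log k+\frac{\log\log(1+\varepsilon)}{k}}{\varepsilon}\right)\right)\text{ -FPT-approximation algorithm},$$ where the encoder $\mathcal{E}(G;k)$ runs in time $k^{O(k)}\cdot n^{O(1)}\cdot\ln(1+\varepsilon)$.
   Context: $H$-Packing: given a hypergraph $G=(V,E)$, find a maximum-size collection of vertex-disjoint sub(hyper)graphs of $G$, each isomorphic to $H$. The value $\mathrm{val}(G,S)$ of a solution $S$ is the number of copies in the collection, and $\mathrm{opt}(G)$ is the optimum. Here $n=|V|$. The hypergraph $H$ is fixed, so constants hidden in $O(\cdot)$ may depend on $H$. $\log$ is to base 2. Neighbors: two hypergraphs $G=(V,E)$, $G'=(V,E')$ on the same vertex set are neighbors if $|E\triangle E'|\le 1$. A randomized algorithm $\mathcal{M}$ is $\varepsilon$-DP if for all neighboring $G\sim G'$ and all sets $\mathcal{S}$ of outcomes, $\Pr[\mathcal{M}(G)\in\mathcal{S}]\le e^{\varepsilon}\Pr[\mathcal{M}(G')\in\mathcal{S}]$. Implicit representation scheme: a pair consisting of an encoder $\mathcal{E}$, a randomized $\varepsilon$-DP algorithm (for each fixed value of the additional parameter $k$) that takes the input $G$ and $k$ and outputs an object $C$ in some representation space $\mathcal{C}$, and a decoder $\mathcal{D}$ that takes $G$ and $C\in\mathcal{C}$ and outputs a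 valid solution for $G$. The decoder runs in time polynomial in the size of the input $G$; its output need not be private. Approximation: for a maximization problem and $\alpha\le1$ (possibly depending on $k,\varepsilon$), $(\mathcal{E},\mathcal{D})$ is an $\alpha$-approximation algorithm if for every input $G$ and every positive integer $k\le\mathrm{opt}(G)$, $\mathbb{E}_{S\sim\mathcal{D}(G,\mathcal{E}(G;k))}[\mathrm{val}(G,S)]\ge\alpha k$. It is an $\alpha$-FPT-approximation algorithm if additionally $\mathcal{E}(G;k)$ runs in time $f(k)\cdot N^{O(1)}$ for some function $f$, where $N$ is the size of the input. -}

module Defs where

open import Data.Bool.Base using (Bool; true; false; if_then_else_; _xor_)
open import Data.Bool.ListAction using (any)
open import Data.Fin.Base using (Fin; toℕ)
open import Data.Fin.Properties using (any?) renaming (_≟_ to _≟ᶠ_)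
open import Data.Fin.Subset using (Subset; inside; outside; ⊤; _⊆_; _∩_; Empty; ∣_∣)
open import Data.Fin.Subset.Properties using (_∈?_)
import Data.Integer.Base as ℤ
open import Data.List.Base
  using (List; []; _∷_; _++_; map; length; filterᵇ; concatMap; applyUpTo; tabulate)
open import Data.List.Relation.Unary.AllPairs using (AllPairs)
open import Data.Nat.Base as ℕ using (ℕ; zero; suc; _≡ᵇ_)
open import Data.Nat.ListAction using (sum)
open import Data.Product.Base using (Σ; ∃; _×_; _,_; proj₁; proj₂)
open import Data.Rational.Base as ℚ using (ℚ; 0ℚ; 1ℚ; ½)
open import Data.Rational.Properties using (_≟_)
open import Data.Vec.Base as Vec using ([]; _∷_)
open import Function.Base using (_∘_)
open import Function.Definitions using (Injective)
open import Relation.Binary.PropositionalEquality using (_≡_)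
open import Relation.Nullary.Decidable using (yes; no; does; _×-dec_)

------------------------------------------------------------------------
-- Real numbers

record ℝ : Set where
  field
    seq    : ℕ → ℚ
    cauchy : ∀ δ → 0ℚ ℚ.< δ → ∃ λ N → ∀ i j → N ℕ.≤ i → N ℕ.≤ j →
             ℚ.∣ seq i ℚ.- seq j ∣ ℚ.≤ δ

-- A real expression is evaluated to a sequence of rationals converging to
-- its value.  The operations are pointwise (by continuity they commute with
-- limits wherever they are applied below), and _≤ʳ_ compares the limits.

Approx : Set
Approx = ℕ → ℚ

real : ℝ → Approx
real = ℝ.seq

fromℚ : ℚ → Approx
fromℚ q _ = q

fromℕ : ℕ → Approx
fromℕ n = fromℚ (ℤ.+ n ℚ./ 1)

-- Total division, x / 0 = 0.  The limits of all divisors below are nonzero,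
-- so the junk value can only affect an initial segment of a sequence.

infixl 7 _÷₀_

_÷₀_ : ℚ → ℚ → ℚ
p ÷₀ q with q ≟ 0ℚ
... | yes _  = 0ℚ
... | no q≢0 = ℚ._÷_ p q {{ℚ.≢-nonZero q≢0}}

infixl 7 _*ʳ_ _/ʳ_
infixl 6 _+ʳ_ _-ʳ_
infix  4 _≤ʳ_

_+ʳ_ _-ʳ_ _*ʳ_ _/ʳ_ : Approx → Approx → Approx
(x +ʳ y) m = x m ℚ.+ y m
(x -ʳ y) m = x m ℚ.- y m
(x *ʳ y) m = x m ℚ.* y m
(x /ʳ y) m = x m ÷₀ y m

_≤ʳ_ : Approx → Approx → Set
x ≤ʳ y = ∀ δ → 0ℚ ℚ.< δ → ∃ λ N → ∀ m → N ℕ.≤ m → x m ℚ.≤ y m ℚ.+ δ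

sumBelow : ℕ → (ℕ → ℚ) → ℚ
sumBelow zero    f = 0ℚ
sumBelow (suc m) f = sumBelow m f ℚ.+ f m

-- expTerm x i = xⁱ / i!
expTerm : ℚ → ℕ → ℚ
expTerm x zero    = 1ℚ
expTerm x (suc i) = expTerm x i ℚ.* x ℚ.* (ℤ.+ 1 ℚ./ suc i)

exp : Approx → Approx
exp x m = sumBelow m (expTerm (x m))

-- Left Riemann sum with m pieces for ∫ dt/t from 1 to y, which is ln y.
lnSum : ℕ → ℚ → ℚ
lnSum m y = sumBelow m λ i → w ÷₀ (1ℚ ℚ.+ (ℤ.+ i ℚ./ 1) ℚ.* w)
  where w = (y ℚ.- 1ℚ) ÷₀ (ℤ.+ m ℚ./ 1)

ln : Approx → Approx
ln y m = lnSum m (y m)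

log₂ : Approx → Approx
log₂ y = ln y /ʳ ln (fromℕ 2)

------------------------------------------------------------------------
-- Finite probability: computations tossing independent fair coins

data Rand (A : Set) : Set where
  ret  : A → Rand A
  toss : Rand A → Rand A → Rand A

infixl 1 _>>=_

_>>=_ : {A B : Set} → Rand A → (A → Rand B) → Rand B
ret a    >>= f = f a
toss l r >>= f = toss (l >>= f) (r >>= f)

mapR : {A B : Set} → (A → B) → Rand A → Rand B
mapR f r = r >>= (ret ∘ f)

𝔼 : {A : Set} → (A → ℚ) → Rand A → ℚ
𝔼 f (ret a)    = f a
𝔼 f (toss l r) = ½ ℚ.* (𝔼 f l ℚ.+ 𝔼 f r)

Pr : {A : Set} → (A → Bool) → Rand A → ℚ
Pr S = 𝔼 (λ a → if S a then 1ℚ else 0ℚ)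

-- P holds for every outcome of the coins.
Always : {A : Set} → (A → Set) → Rand A → Set
Always P (ret a)    = P a
Always P (toss l r) = Always P l × Always P r

attach : {A : Set} {P : A → Set} (r : Rand A) → Always P r → Rand (Σ A P)
attach (ret a)    p       = ret (a , p)
attach (toss l r) (p , q) = toss (attach l p) (attach r q)

------------------------------------------------------------------------
-- Hypergraphs and packings

record Hypergraph (n : ℕ) : Set where
  field
    edge : Subset n → Bool   -- the vertex set is Fin n

open Hypergraph public

subsets : ∀ n → List (Subset n)
subsets zero    = [] ∷ []
subsets (suc n) = map (outside ∷_) (subsets n) ++ map (inside ∷_) (subsets n)

family : ∀ {n} → (Subset n → Bool) → List (Subset n)
family p = filterᵇ p (subsets _)

Neighbors : ∀ {n} → Hypergraph n → Hypergraph n → Set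
Neighbors G G′ = length (family λ e → edge G e xor edge G′ e) ℕ.≤ 1

-- Size N of the input: the vertices plus, for each hyperedge, 1 + its size.
size : ∀ {n} → Hypergraph n → ℕ
size {n} G = n ℕ.+ sum (map (suc ∘ ∣_∣) (family (edge G)))

record Subgraph {n} (G : Hypergraph n) : Set where
  field
    verts  : Subset n
    edges  : Subset n → Bool
    edges⊆ : ∀ f → edges f ≡ true → f ⊆ verts × edge G f ≡ true

open Subgraph public

image : ∀ {h n} → (Fin h → Fin n) → Subset h → Subset n
image φ e = Vec.tabulate λ v → does (any? λ i → (i ∈? e) ×-dec (φ i ≟ᶠ v))

-- Since the hyperedges of S lie within its vertex set, which is the image of
-- φ, each of them is φ(e) for some e ⊆ V(H).
record Iso {h n} (H : Hypergraph h) {G : Hypergraph n} (S : Subgraph G) : Set where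
  field
    φ         : Fin h → Fin n
    injective : Injective _≡_ _≡_ φ
    onto      : image φ ⊤ ≡ verts S
    edges-iso : ∀ e → edges S (image φ e) ≡ edge H e

open Iso public

Copy : ∀ {h n} → Hypergraph h → Hypergraph n → Set
Copy H G = Σ (Subgraph G) (Iso H)

Disjoint : ∀ {h n} {H : Hypergraph h} {G : Hypergraph n} → Copy H G → Copy H G → Set
Disjoint A B = Empty (verts (proj₁ A) ∩ verts (proj₁ B))

Packing : ∀ {h n} → Hypergraph h → Hypergraph n → Set
Packing H G = Σ (List (Copy H G)) (AllPairs Disjoint)

val : ∀ {h n} {H : Hypergraph h} {G : Hypergraph n} → Packing H G → ℕ
val S = length (proj₁ S)

IsOpt : ∀ {h n} → Hypergraph h → Hypergraph n → ℕ → Set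
IsOpt H G m = (∃ λ (S : Packing H G) → val S ≡ m) × (∀ (S : Packing H G) → val S ℕ.≤ m)

-- How a program writes a solution: copy after copy, each as the list of the
-- vertices φ 0, …, φ (h - 1).
encoding : ∀ {h n} {H : Hypergraph h} {G : Hypergraph n} → Packing H G → List ℕ
encoding S = concatMap (λ A → tabulate (toℕ ∘ φ (proj₂ A))) (proj₁ S)

------------------------------------------------------------------------
-- Randomized algorithms: structured programs for a random access machine
--
-- Machine words are natural numbers.  There are registers, an indirectly
-- addressed memory, an append-only output, a fair coin, and access to the
-- hyperedges of the input through a membership oracle (the analogue of an
-- adjacency matrix, which makes sublinear time in |E| meaningful).  The only
-- arithmetic is addition and truncated subtraction, so unit cost is
-- polynomially equivalent to Turing machine time.

Reg : Set
Reg = ℕ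

infixr 5 _⨾_

data Cmd : Set where
  _⨾_         : Cmd → Cmd → Cmd
  const       : Reg → ℕ → Cmd
  add sub     : Reg → Reg → Reg → Cmd   -- target, operands
  load        : Reg → Reg → Cmd         -- target, address
  store       : Reg → Reg → Cmd         -- address, source
  coin        : Reg → Cmd
  emit        : Reg → Cmd
  query       : Reg → Reg → Reg → Cmd   -- target, address, length
  ifZero_₁_₂_ : Reg → Cmd → Cmd → Cmd
  loop        : Reg → Cmd → Cmd         -- iteration count read on entry

record State : Set where
  constructor state
  field
    reg   : Reg → ℕ
    mem   : ℕ → ℕ
    out   : List ℕ
    clock : ℕ

open State public

_[_↦_] : (ℕ → ℕ) → ℕ → ℕ → (ℕ → ℕ)
(f [ i ↦ x ]) j = if i ≡ᵇ j then x else f j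

tick : ℕ → State → State
tick t σ = record σ { clock = clock σ ℕ.+ t }

set : Reg → ℕ → State → State
set r x σ = record σ { reg = reg σ [ r ↦ x ] }

listed : ∀ {n} → List ℕ → Subset n
listed xs = Vec.tabulate λ v → any (toℕ v ≡ᵇ_) xs

bit : Bool → ℕ
bit b = if b then 1 else 0

iterate : ℕ → (State → Rand State) → State → Rand State
iterate zero    f σ = ret σ
iterate (suc m) f σ = f σ >>= iterate m f

run : ∀ {n} → Hypergraph n → Cmd → State → Rand State
run G (c ⨾ d)              σ = run G c σ >>= run G d
run G (const r x)          σ = ret (tick 1 (set r x σ))
run G (add r s t)          σ = ret (tick 1 (set r (reg σ s ℕ.+ reg σ t) σ))
run G (sub r s t)          σ = ret (tick 1 (set r (reg σ s ℕ.∸ reg σ t) σ))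
run G (load r s)           σ = ret (tick 1 (set r (mem σ (reg σ s)) σ))
run G (store r s)          σ =
  ret (tick 1 (record σ { mem = mem σ [ reg σ r ↦ reg σ s ] }))
run G (coin r)             σ = toss (ret (tick 1 (set r 0 σ))) (ret (tick 1 (set r 1 σ)))
run G (emit r)             σ = ret (tick 1 (record σ { out = out σ ++ reg σ r ∷ [] }))
-- Is the set of vertices listed in mem[s], …, mem[s + t - 1] a hyperedge?
run G (query r s t)        σ = ret (tick (suc (reg σ t)) (set r (bit (edge G (listed cells))) σ))
  where cells = applyUpTo (λ i → mem σ (reg σ s ℕ.+ i)) (reg σ t)
run G (ifZero r ₁ c ₂ d)   σ with reg σ r
... | zero                   = run G c (tick 1 σ)
... | suc _                  = run G d (tick 1 σ)
run G (loop r c)           σ = iterate (reg σ r) (λ τ → run G c (tick 1 τ)) (tick 1 σ)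

-- Registers 0 and 1 hold the numeric arguments; everything else is zero
-- except for the memory cells holding the list argument.
start : ℕ → ℕ → List ℕ → State
start a b xs = state ((λ _ → 0) [ 0 ↦ a ] [ 1 ↦ b ]) (cell xs) [] 0
  where
  cell : List ℕ → ℕ → ℕ
  cell []       _       = 0
  cell (x ∷ _)  zero    = x
  cell (_ ∷ xs) (suc i) = cell xs i

------------------------------------------------------------------------
-- Implicit representation schemes.  The representation space is List ℕ.

Rep : Set
Rep = List ℕ

runEncoder : Cmd → ∀ {n} → Hypergraph n → ℕ → Rand State
runEncoder E {n} G k = run G E (start n k [])

runDecoder : Cmd → ∀ {n} → Hypergraph n → Rep → Rand State
runDecoder D {n} G C = run G D (start n (length C) C)

-- A randomized algorithm on hypergraphs is ε-DP.
DP : ℝ → {A : Set} → (∀ {n} → Hypergraph n → Rand A) → Set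
DP ε {A} M = ∀ {n} (G G′ : Hypergraph n) → Neighbors G G′ → (S : A → Bool) →
  fromℚ (Pr S (M G)) ≤ʳ exp (real ε) *ʳ fromℚ (Pr S (M G′))

record Scheme {h} (H : Hypergraph h) (ε : ℝ) : Set where
  field
    encoder : Cmd
    decoder : Cmd
    isDP    : ∀ k → 1 ℕ.≤ k → DP ε (λ G → mapR out (runEncoder encoder G k))
    valid   : ∀ {n} (G : Hypergraph n) (C : Rep) →
              Always (λ σ → ∃ λ (S : Packing H G) → out σ ≡ encoding S)
                     (runDecoder decoder G C)

  encode : ∀ {n} → Hypergraph n → ℕ → Rand Rep
  encode G k = mapR out (runEncoder encoder G k)

  decode : ∀ {n} (G : Hypergraph n) → Rep → Rand (Packing H G)
  decode G C = mapR (proj₁ ∘ proj₂) (attach (runDecoder decoder G C) (valid G C))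

  expectedVal : ∀ {n} → Hypergraph n → ℕ → ℚ
  expectedVal G k = 𝔼 (λ S → ℤ.+ val S ℚ./ 1) (encode G k >>= decode G)

module _ {h} {H : Hypergraph h} {ε : ℝ} (M : Scheme H ε) where
  open Scheme M

  -- decoder time at most c (1 + N)ᶜ
  PolyTimeDecoder : ℕ → Set
  PolyTimeDecoder c = ∀ {n} (G : Hypergraph n) (C : Rep) →
    Always (λ σ → clock σ ℕ.≤ c ℕ.* suc (size G) ℕ.^ c) (runDecoder decoder G C)

  -- α-approximation, with α depending on k
  Approximation : (ℕ → Approx) → Set
  Approximation α = ∀ {n} (G : Hypergraph n) m → IsOpt H G m →
    ∀ k → 1 ℕ.≤ k → k ℕ.≤ m → α k *ʳ fromℕ k ≤ʳ fromℚ (expectedVal G k)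

  FPTEncoder : Set
  FPTEncoder = ∃ λ (f : ℕ → ℕ) → ∃ λ d → ∀ {n} (G : Hypergraph n) k → 1 ℕ.≤ k →
    Always (λ σ → clock σ ℕ.≤ f k ℕ.* suc (size G) ℕ.^ d) (runEncoder encoder G k)

  FPTApproximation : (ℕ → Approx) → Set
  FPTApproximation α = Approximation α × FPTEncoder

  -- encoder time at most c k^(ck) (1 + n)ᶜ ln(1 + ε)
  EncoderTime : ℕ → Set
  EncoderTime c = ∀ {n} (G : Hypergraph n) k → 1 ℕ.≤ k →
    Always (λ σ → fromℕ (clock σ) ≤ʳ
                  fromℕ (c ℕ.* k ℕ.^ (c ℕ.* k) ℕ.* suc n ℕ.^ c) *ʳ ln (fromℕ 1 +ʳ real ε))
           (runEncoder encoder G k)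

-- 1 - c · (log k + (log log (1 + ε)) / k) / ε
ratio : ℕ → ℝ → ℕ → Approx
ratio c ε k =
  fromℕ 1 -ʳ fromℕ c *ʳ ((log₂ (fromℕ k) +ʳ log₂ (log₂ (fromℕ 1 +ʳ real ε)) /ʳ fromℕ k) /ʳ real ε)

{-# OPTIONS --safe #-}

-- The representation is a colouring of the vertices, and the decoder looks
-- for one copy of H in each colour class.  The encoder draws colourings with
-- 2^b ≥ k colours at random and accepts one with probability ω^d, where d is
-- the number of classes γ < k without a copy; it tries L 2^(khb) times and
-- falls back to a fresh colouring with probability about 1/ε, in which case
-- (as when all attempts fail) the output is independent of the input.  A
-- hyperedge affects only the class of its vertices, so d changes by at most
-- one between neighbours.
--
-- Let t ≈ ε/4.  If t ≤ 8 + 2khb then ω = 2^-t; if t is larger, then ω = 0,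
-- which is private because the output probabilities lie within a factor
-- exp(O(t)) of each other by the fallback alone.  A colouring giving the k
-- copies of an optimal packing different colours is drawn with probability at
-- least 2^-khb, whence (as in the exponential mechanism) E[d] = O(khb/t).
module Submission where

open import Defs
open import Data.Bool.Base using (Bool; true; false; if_then_else_; not; _∧_; _∨_; _xor_; T)
open import Data.Bool.ListAction using (any; all)
import Data.Bool.Properties as Boolₚ
open import Data.Empty using (⊥; ⊥-elim)
open import Data.Fin.Base as Fin using (Fin; toℕ)
import Data.Fin.Properties as Finₚ
open import Data.Fin.Subset using (Subset; _⊆_; Nonempty) renaming (⊤ to full; _∈_ to _∈ˢ_)
open import Data.Fin.Subset.Properties using (_∈?_; ∈⊤; x∈p∩q⁻; x∈p∩q⁺; ⊆-antisym; nonempty?)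
import Data.Integer.Base as ℤ
import Data.Integer.Properties as ℤₚ
open import Data.List.Base as List
  using (List; []; _∷_; _++_; length; map; allFin; applyUpTo; concatMap; filterᵇ; tabulate; take)
open import Data.List.Membership.Propositional using (_∈_; find)
open import Data.List.Membership.Propositional.Properties
  using (∈-allFin; ∈-filter⁺; ∈-filter⁻; ∈-concatMap⁺; ∈-concatMap⁻; ∈-map⁺; ∈-++⁺ˡ; ∈-++⁺ʳ;
         ∈-lookup; ∈-tabulate⁺; ∈-tabulate⁻)
import Data.List.Properties as Listₚ
open import Data.List.Relation.Unary.All as All using (All; []; _∷_)
import Data.List.Relation.Unary.All.Properties as Allₚ
open import Data.List.Relation.Unary.AllPairs using (AllPairs; []; _∷_)
import Data.List.Relation.Unary.AllPairs.Properties as AllPairsₚ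
open import Data.List.Relation.Unary.Any as Any using (here; there)
import Data.List.Relation.Unary.Any.Properties as Anyₚ
open import Data.Nat.Base as ℕ using (ℕ; zero; suc; z≤n; s≤s)
import Data.Nat.Coprimality as Coprime
import Data.Nat.Properties as ℕₚ
import Data.Nat.Solver as ℕSolver
open import Data.Product.Base using (Σ; ∃; _×_; _,_; proj₁; proj₂)
open import Data.Rational.Base as ℚ using (ℚ; 0ℚ; 1ℚ; ½; _+_; _*_; _-_; -_; _≤_; _<_; mkℚ)
import Data.Rational.Properties as ℚₚ
open import Data.Rational.Solver using (module +-*-Solver)
import Data.Rational.Unnormalised.Base as ℚᵘ
import Data.Rational.Unnormalised.Properties as ℚᵘₚ
open import Data.Sum.Base using (_⊎_; inj₁; inj₂; [_,_]′)
open import Data.Unit.Base using (⊤; tt)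
open import Data.Vec.Base as Vec using (Vec; lookup)
import Data.Vec.Properties as Vecₚ
open import Function.Base using (_∘_)
open import Function.Definitions using (Injective)
open import Relation.Binary.PropositionalEquality
open import Relation.Nullary using (Dec; ¬_; yes; no; contradiction)
open import Relation.Nullary.Decidable using (T?; decidable-stable; does; dec-true; _×-dec_)
open +-*-Solver using (solve; con; _:+_; _:*_; _:-_; :-_; _:=_)

-- The time bound forces the two regimes: a coin of bias 2^-t takes t tosses, about ε/4 of them,
-- while the budget grows only like ln(1 + ε). So t is capped at 8 + 2khb, and beyond that a missing
-- copy costs certain rejection, which needs no coin. The fallback serves privacy in both regimes.
-- With ω = 0 an outcome may be acceptable for one of two neighbours only. With ω = 2^-t the
-- probabilities that all attempts fail may differ by an uncontrolled factor, and the fallback,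
-- scaled by 2^t, dominates that term. The choice L = ⌈log₂(1 + t)⌉ balances three things: the
-- fallback, of probability 2^-L ≤ 1/(1 + t), loses at most k/t copies on average; L 2^(khb)
-- attempts all fail with probability at most 2^-L; and L + 1 ≤ 8 ln(1 + ε) pays for the number of
-- attempts. The quarter in t ≈ ε/4: weights and normalisation contribute a factor 2^t each, and of
-- the exponential only 2^j ≤ e^(2j) is used. For k = 1 and ε = 1 the promised ratio is exactly 1,
-- so the case k = 1 tolerates no loss and is argued separately.

module ℕ-Ring = ℕSolver.+-*-Solver

-- Rational arithmetic and the embedding of the natural numbers

module Rationals where

  opaque
    -- Opaque, so that outside this block `ι n` is an atom for the ring solver and is never
    -- normalised as a fraction; `ι-def` leads back to the form used in the statement.
    ι : ℕ → ℚ
    ι n = ℤ.+ n ℚ./ 1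

    ι-mk : ∀ n → ι n ≡ mkℚ (ℤ.+ n) 0 (Coprime.sym (Coprime.1-coprimeTo n))
    ι-mk n = ℚₚ.normalize-coprime (Coprime.sym (Coprime.1-coprimeTo n))

    toℚᵘ-ι : ∀ n → ℚ.toℚᵘ (ι n) ≡ ℚᵘ.mkℚᵘ (ℤ.+ n) 0
    toℚᵘ-ι n = cong ℚ.toℚᵘ (ι-mk n)

    ι-+ : ∀ m n → ι (m ℕ.+ n) ≡ ι m + ι n
    ι-+ m n = ℚₚ.toℚᵘ-injective (ℚᵘₚ.≃-trans lhs (ℚᵘₚ.≃-sym (ℚₚ.toℚᵘ-homo-+ (ι m) (ι n))))
      where
      lhs : ℚ.toℚᵘ (ι (m ℕ.+ n)) ℚᵘ.≃ ℚ.toℚᵘ (ι m) ℚᵘ.+ ℚ.toℚᵘ (ι n)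
      lhs rewrite toℚᵘ-ι (m ℕ.+ n) | toℚᵘ-ι m | toℚᵘ-ι n = ℚᵘ.*≡*
        (cong₂ ℤ._*_ (cong₂ ℤ._+_ (sym (ℤₚ.*-identityʳ (ℤ.+ m))) (sym (ℤₚ.*-identityʳ (ℤ.+ n)))) refl)

    ι-* : ∀ m n → ι (m ℕ.* n) ≡ ι m * ι n
    ι-* m n = ℚₚ.toℚᵘ-injective (ℚᵘₚ.≃-trans lhs (ℚᵘₚ.≃-sym (ℚₚ.toℚᵘ-homo-* (ι m) (ι n))))
      where
      lhs : ℚ.toℚᵘ (ι (m ℕ.* n)) ℚᵘ.≃ ℚ.toℚᵘ (ι m) ℚᵘ.* ℚ.toℚᵘ (ι n)
      lhs rewrite toℚᵘ-ι (m ℕ.* n) | toℚᵘ-ι m | toℚᵘ-ι n = ℚᵘ.*≡* (cong₂ ℤ._*_ (ℤₚ.pos-* m n) refl)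

    ι-mono : ∀ {m n} → m ℕ.≤ n → ι m ≤ ι n
    ι-mono {m} {n} m≤n = ℚₚ.toℚᵘ-cancel-≤
      (subst₂ ℚᵘ._≤_ (sym (toℚᵘ-ι m)) (sym (toℚᵘ-ι n)) (ℚᵘ.*≤* (ℤₚ.*-monoʳ-≤-nonNeg (ℤ.+ 1) (ℤ.+≤+ m≤n))))

    0≤ι : ∀ n → 0ℚ ≤ ι n
    0≤ι n = ι-mono {0} {n} z≤n

    ι-def : ∀ n → ι n ≡ ℤ.+ n ℚ./ 1
    ι-def n = refl

    ι-0 : ι 0 ≡ 0ℚ
    ι-0 = refl

    ι-1 : ι 1 ≡ 1ℚ
    ι-1 = refl

  ι-suc : ∀ n → ι (suc n) ≡ 1ℚ + ι n
  ι-suc n = trans (ι-+ 1 n) (cong (_+ ι n) ι-1)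

  infixl 6 _⊕_
  infixl 7 _⊛_

  _⊕_ : ∀ {p q} → 0ℚ ≤ p → 0ℚ ≤ q → 0ℚ ≤ p + q
  _⊕_ {p} {q} a b = ℚₚ.nonNegative⁻¹ (p + q)
    where instance
    _ = ℚₚ.nonNeg+nonNeg⇒nonNeg p {{ℚ.nonNegative a}} q {{ℚ.nonNegative b}}

  _⊛_ : ∀ {p q} → 0ℚ ≤ p → 0ℚ ≤ q → 0ℚ ≤ p * q
  _⊛_ {p} {q} a b = ℚₚ.nonNegative⁻¹ (p * q)
    where instance
    _ = ℚₚ.nonNeg*nonNeg⇒nonNeg p {{ℚ.nonNegative a}} q {{ℚ.nonNegative b}}

  p≤q⇒0≤q-p : ∀ {p q} → p ≤ q → 0ℚ ≤ q - p
  p≤q⇒0≤q-p {p} {q} p≤q = subst (_≤ q - p) (ℚₚ.+-inverseʳ p) (ℚₚ.+-monoˡ-≤ (- p) p≤q)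

  -- Inequalities are proved by writing the difference of their sides as an
  -- expression that is visibly nonnegative.
  ≤-by : ∀ {p q e} → 0ℚ ≤ e → q ≡ p + e → p ≤ q
  ≤-by {p} {q} {e} 0≤e q≡ = subst₂ _≤_ (ℚₚ.+-identityʳ p) (sym q≡) (ℚₚ.+-monoʳ-≤ p 0≤e)

  *-monoʳ : ∀ {p q r} → 0ℚ ≤ r → p ≤ q → r * p ≤ r * q
  *-monoʳ {r = r} 0≤r = ℚₚ.*-monoˡ-≤-nonNeg r {{ℚ.nonNegative 0≤r}}

  *-monoˡ : ∀ {p q r} → 0ℚ ≤ r → p ≤ q → p * r ≤ q * r
  *-monoˡ {r = r} 0≤r = ℚₚ.*-monoʳ-≤-nonNeg r {{ℚ.nonNegative 0≤r}}

  *-mono : ∀ {p q r s} → 0ℚ ≤ r → 0ℚ ≤ q → p ≤ q → r ≤ s → p * r ≤ q * s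
  *-mono 0≤r 0≤q p≤q r≤s = ℚₚ.≤-trans (*-monoˡ 0≤r p≤q) (*-monoʳ 0≤q r≤s)

  ½≤1 : ½ ≤ 1ℚ
  ½≤1 = ℚₚ.≤ᵇ⇒≤ _

  0≤½ : 0ℚ ≤ ½
  0≤½ = ℚₚ.≤ᵇ⇒≤ _

  0≤1 : 0ℚ ≤ 1ℚ
  0≤1 = ℚₚ.≤ᵇ⇒≤ _

open Rationals

-- Expectations, and the acceptance experiment on one sample

module Expectation where

  𝔼-bind : ∀ {A B : Set} (f : B → ℚ) (r : Rand A) (g : A → Rand B) →
           𝔼 f (r >>= g) ≡ 𝔼 (λ a → 𝔼 f (g a)) r
  𝔼-bind f (ret a)    g = refl
  𝔼-bind f (toss l r) g = cong₂ (λ x y → ½ * (x + y)) (𝔼-bind f l g) (𝔼-bind f r g)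

  𝔼-cong : ∀ {A : Set} {f g : A → ℚ} → (∀ a → f a ≡ g a) → ∀ r → 𝔼 f r ≡ 𝔼 g r
  𝔼-cong f≡g (ret a)    = f≡g a
  𝔼-cong f≡g (toss l r) = cong₂ (λ x y → ½ * (x + y)) (𝔼-cong f≡g l) (𝔼-cong f≡g r)

  𝔼-mono-Always : ∀ {A : Set} {f g : A → ℚ} r → Always (λ a → f a ≤ g a) r → 𝔼 f r ≤ 𝔼 g r
  𝔼-mono-Always (ret a)    p       = p
  𝔼-mono-Always (toss l r) (p , q) =
    *-monoʳ 0≤½ (ℚₚ.+-mono-≤ (𝔼-mono-Always l p) (𝔼-mono-Always r q))

  always : ∀ {A : Set} {P : A → Set} → (∀ a → P a) → ∀ r → Always P r
  always p (ret a)    = p a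
  always p (toss l r) = always p l , always p r

  Always-map : ∀ {A : Set} {P Q : A → Set} → (∀ a → P a → Q a) → ∀ r → Always P r → Always Q r
  Always-map f (ret a)    p       = f a p
  Always-map f (toss l r) (p , q) = Always-map f l p , Always-map f r q

  Always-bind : ∀ {A B : Set} {P : A → Set} {Q : B → Set} (r : Rand A) {g : A → Rand B} →
                Always P r → (∀ a → P a → Always Q (g a)) → Always Q (r >>= g)
  Always-bind (ret a)    p       h = h a p
  Always-bind (toss l r) (p , q) h = Always-bind l p h , Always-bind r q h

  𝔼-mono : ∀ {A : Set} {f g : A → ℚ} → (∀ a → f a ≤ g a) → ∀ r → 𝔼 f r ≤ 𝔼 g r
  𝔼-mono f≤g r = 𝔼-mono-Always r (always f≤g r)

  𝔼-const : ∀ {A : Set} c (r : Rand A) → 𝔼 (λ _ → c) r ≡ c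
  𝔼-const c (ret a)    = refl
  𝔼-const c (toss l r) rewrite 𝔼-const c l | 𝔼-const c r =
    solve 1 (λ c → con ½ :* (c :+ c) := c) refl c

  𝔼-+ : ∀ {A : Set} (f g : A → ℚ) r → 𝔼 (λ a → f a + g a) r ≡ 𝔼 f r + 𝔼 g r
  𝔼-+ f g (ret a)    = refl
  𝔼-+ f g (toss l r) rewrite 𝔼-+ f g l | 𝔼-+ f g r =
    solve 4 (λ a b c d → con ½ :* ((a :+ b) :+ (c :+ d)) := con ½ :* (a :+ c) :+ con ½ :* (b :+ d))
      refl (𝔼 f l) (𝔼 g l) (𝔼 f r) (𝔼 g r)

  𝔼-* : ∀ {A : Set} c (f : A → ℚ) r → 𝔼 (λ a → c * f a) r ≡ c * 𝔼 f r
  𝔼-* c f (ret a)    = refl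
  𝔼-* c f (toss l r) rewrite 𝔼-* c f l | 𝔼-* c f r =
    solve 3 (λ c a b → con ½ :* (c :* a :+ c :* b) := c :* (con ½ :* (a :+ b))) refl c (𝔼 f l) (𝔼 f r)

  𝔼≥ : ∀ {A : Set} {c} {f : A → ℚ} → (∀ a → c ≤ f a) → ∀ r → c ≤ 𝔼 f r
  𝔼≥ {c = c} c≤f r = subst (_≤ _) (𝔼-const c r) (𝔼-mono c≤f r)

  𝔼≤ : ∀ {A : Set} {c} {f : A → ℚ} → (∀ a → f a ≤ c) → ∀ r → 𝔼 f r ≤ c
  𝔼≤ {c = c} f≤c r = subst (_ ≤_) (𝔼-const c r) (𝔼-mono f≤c r)

  pow : ℚ → ℕ → ℚ
  pow x zero    = 1ℚ
  pow x (suc m) = x * pow x m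

  pow-+ : ∀ x m n → pow x (m ℕ.+ n) ≡ pow x m * pow x n
  pow-+ x zero    n = sym (ℚₚ.*-identityˡ _)
  pow-+ x (suc m) n rewrite pow-+ x m n = sym (ℚₚ.*-assoc x _ _)

  pow≥0 : ∀ {x} → 0ℚ ≤ x → ∀ m → 0ℚ ≤ pow x m
  pow≥0 0≤x zero    = 0≤1
  pow≥0 0≤x (suc m) = 0≤x ⊛ pow≥0 0≤x m

  pow-mono : ∀ {x y} → 0ℚ ≤ x → x ≤ y → ∀ m → pow x m ≤ pow y m
  pow-mono 0≤x x≤y zero    = ℚₚ.≤-refl
  pow-mono 0≤x x≤y (suc m) =
    *-mono (pow≥0 0≤x m) (ℚₚ.≤-trans 0≤x x≤y) x≤y (pow-mono 0≤x x≤y m)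

  pow-one : ∀ m → pow 1ℚ m ≡ 1ℚ
  pow-one zero    = refl
  pow-one (suc m) = trans (ℚₚ.*-identityˡ _) (pow-one m)

  pow≤1 : ∀ {x} → 0ℚ ≤ x → x ≤ 1ℚ → ∀ m → pow x m ≤ 1ℚ
  pow≤1 0≤x x≤1 m = subst (pow _ m ≤_) (pow-one m) (pow-mono 0≤x x≤1 m)

  2^-½^ : ∀ m → ι (2 ℕ.^ m) * pow ½ m ≡ 1ℚ
  2^-½^ zero    = trans (cong (_* 1ℚ) ι-1) refl
  2^-½^ (suc m) rewrite ι-* 2 (2 ℕ.^ m) | ι-+ 1 1 | ι-1 =
    trans (solve 2 (λ x y → ((con 1ℚ :+ con 1ℚ) :* x) :* (con ½ :* y) := x :* y) refl (ι (2 ℕ.^ m)) (pow ½ m))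
          (2^-½^ m)

  ½^≥0 : ∀ m → 0ℚ ≤ pow ½ m
  ½^≥0 = pow≥0 0≤½

  ½^≤1 : ∀ m → pow ½ m ≤ 1ℚ
  ½^≤1 = pow≤1 0≤½ ½≤1

  -- The coins go on after the first failure: the tree then has the shape of the program's loop,
  -- which has no early exit.
  heads : ℕ → Bool → Rand Bool
  heads zero    a = ret a
  heads (suc m) a = toss (heads m false) (heads m a)

  -- The expectation of `g` when `a` survives with probability `w` and is turned into `false`
  -- otherwise.
  mix : ℚ → (Bool → ℚ) → Bool → ℚ
  mix w g a = w * g a + (1ℚ - w) * g false

  𝔼-heads : ∀ g m a → 𝔼 g (heads m a) ≡ mix (pow ½ m) g a
  𝔼-heads g zero    a = solve 2 (λ x y → x := con 1ℚ :* x :+ (con 1ℚ :- con 1ℚ) :* y) refl (g a) (g false)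
  𝔼-heads g (suc m) a rewrite 𝔼-heads g m false | 𝔼-heads g m a =
    solve 3 (λ p x y → con ½ :* ((p :* y :+ (con 1ℚ :- p) :* y) :+ (p :* x :+ (con 1ℚ :- p) :* y))
       := con ½ :* p :* x :+ (con 1ℚ :- con ½ :* p) :* y) refl (pow ½ m) (g a) (g false)

  -- What a class without a copy costs an attempt: t fair coins that must all
  -- show heads or, if the first argument is positive, rejection.
  penalty : ℕ → ℕ → Bool → Rand Bool
  penalty zero    t a = heads t a
  penalty (suc _) t a = ret false

  ω : ℕ → ℕ → ℚ
  ω zero    t = pow ½ t
  ω (suc _) t = 0ℚ

  0≤ω : ∀ s t → 0ℚ ≤ ω s t
  0≤ω zero    t = ½^≥0 t
  0≤ω (suc _) t = ℚₚ.≤-refl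

  ω≤1 : ∀ s t → ω s t ≤ 1ℚ
  ω≤1 zero    t = ½^≤1 t
  ω≤1 (suc _) t = 0≤1

  𝔼-penalty : ∀ g s t a → 𝔼 g (penalty s t a) ≡ mix (ω s t) g a
  𝔼-penalty g zero    t a = 𝔼-heads g t a
  𝔼-penalty g (suc _) t a = solve 2 (λ x y → y := con 0ℚ :* x :+ (con 1ℚ :- con 0ℚ) :* y) refl (g a) (g false)

  -- One attempt: accept s t has m γ examines the classes γ, …, γ + m - 1.
  accept : ℕ → ℕ → (ℕ → Bool) → ℕ → ℕ → Bool → Rand Bool
  accept s t has zero    γ a = ret a
  accept s t has (suc m) γ a =
    (if has γ then ret a else penalty s t a) >>= accept s t has m (suc γ)

  cost : ℕ → ℕ → Bool → ℚ
  cost s t b = if b then 1ℚ else ω s t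

  0≤cost : ∀ s t b → 0ℚ ≤ cost s t b
  0≤cost s t true  = 0≤1
  0≤cost s t false = 0≤ω s t

  cost≤1 : ∀ s t b → cost s t b ≤ 1ℚ
  cost≤1 s t true  = ℚₚ.≤-refl
  cost≤1 s t false = ω≤1 s t

  weight : ℕ → ℕ → (ℕ → Bool) → ℕ → ℕ → ℚ
  weight s t has zero    γ = 1ℚ
  weight s t has (suc m) γ = cost s t (has γ) * weight s t has m (suc γ)

  0≤weight : ∀ s t has m γ → 0ℚ ≤ weight s t has m γ
  0≤weight s t has zero    γ = 0≤1
  0≤weight s t has (suc m) γ = 0≤cost s t (has γ) ⊛ 0≤weight s t has m (suc γ)

  weight≤1 : ∀ s t has m γ → weight s t has m γ ≤ 1ℚ
  weight≤1 s t has zero    γ = ℚₚ.≤-refl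
  weight≤1 s t has (suc m) γ =
    *-mono (0≤weight s t has m (suc γ)) 0≤1 (cost≤1 s t (has γ)) (weight≤1 s t has m (suc γ))

  -- Mixing fixes the value at `false`, so mixing with `c` after mixing with `w` is mixing with
  -- `c * w`: the survival probabilities of the classes multiply.
  𝔼-accept : ∀ g s t has m γ a → 𝔼 g (accept s t has m γ a) ≡ mix (weight s t has m γ) g a
  𝔼-accept g s t has zero    γ a =
    solve 2 (λ x y → x := con 1ℚ :* x :+ (con 1ℚ :- con 1ℚ) :* y) refl (g a) (g false)
  𝔼-accept g s t has (suc m) γ a = begin
    𝔼 g (r >>= accept s t has m (suc γ))  ≡⟨ 𝔼-bind g r _ ⟩
    𝔼 (λ c → 𝔼 g (accept s t has m (suc γ) c)) r  ≡⟨ 𝔼-cong (𝔼-accept g s t has m (suc γ)) r ⟩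
    𝔼 (mix w g) r  ≡⟨ step (has γ) ⟩
    mix (cost s t (has γ)) (mix w g) a
      ≡⟨ solve 4 (λ c w x y → c :* (w :* x :+ (con 1ℚ :- w) :* y) :+ (con 1ℚ :- c) :* (w :* y :+ (con 1ℚ :- w) :* y)
           := c :* w :* x :+ (con 1ℚ :- c :* w) :* y) refl (cost s t (has γ)) w (g a) (g false) ⟩
    mix (cost s t (has γ) * w) g a  ∎
    where
    open ≡-Reasoning
    w = weight s t has m (suc γ)
    r = if has γ then ret a else penalty s t a
    step : ∀ b → 𝔼 (mix w g) (if b then ret a else penalty s t a) ≡ mix (cost s t b) (mix w g) a
    step true  = solve 2 (λ x y → x := con 1ℚ :* x :+ (con 1ℚ :- con 1ℚ) :* y) refl (mix w g a) (mix w g false)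
    step false = 𝔼-penalty (mix w g) s t a

  module Selection {X : Set} (gen : Rand X) where

    tries : (X → Rand Bool) → ℕ → Rand X
    tries acc zero    = gen
    tries acc (suc m) = gen >>= λ x → acc x >>= λ a → if a then ret x else tries acc m

    mechanism : (X → Rand Bool) → ℕ → ℕ → Rand X
    mechanism acc L m = heads L true >>= λ a → if a then gen else tries acc m

    mean : (X → ℚ) → ℚ
    mean f = 𝔼 f gen

    module Accepting (acc : X → Rand Bool) (w : X → ℚ)
      (acc-w : ∀ g x → 𝔼 g (acc x) ≡ mix (w x) g true)
      (0≤w : ∀ x → 0ℚ ≤ w x) (w≤1 : ∀ x → w x ≤ 1ℚ) where

      acceptance : ℚ
      acceptance = mean w

      0≤acceptance : 0ℚ ≤ acceptance
      0≤acceptance = 𝔼≥ 0≤w gen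

      acceptance≤1 : acceptance ≤ 1ℚ
      acceptance≤1 = 𝔼≤ w≤1 gen

      𝔼-tries : ∀ f m → 𝔼 f (tries acc (suc m)) ≡
                mean (λ x → w x * f x) + (1ℚ - acceptance) * 𝔼 f (tries acc m)
      𝔼-tries f m = begin
        𝔼 f (tries acc (suc m))
          ≡⟨ 𝔼-bind f gen _ ⟩
        mean (λ x → 𝔼 f (acc x >>= λ a → if a then ret x else tries acc m))
          ≡⟨ 𝔼-cong (λ x → trans (𝔼-bind f (acc x) _) (acc-w _ x)) gen ⟩
        mean (λ x → w x * f x + (1ℚ - w x) * e)
          ≡⟨ 𝔼-cong (λ x → solve 3 (λ a b c → a :* b :+ (con 1ℚ :- a) :* c := a :* b :+ (c :+ (:- c) :* a)) refl (w x) (f x) e) gen ⟩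
        mean (λ x → w x * f x + (e + (- e) * w x))
          ≡⟨ 𝔼-+ _ _ gen ⟩
        mean (λ x → w x * f x) + mean (λ x → e + (- e) * w x)
          ≡⟨ cong (mean (λ x → w x * f x) +_) (trans (𝔼-+ _ _ gen) (cong₂ _+_ (𝔼-const e gen) (𝔼-* (- e) w gen))) ⟩
        mean (λ x → w x * f x) + (e + (- e) * acceptance)
          ≡⟨ solve 3 (λ a b c → a :+ (b :+ (:- b) :* c) := a :+ (con 1ℚ :- c) :* b) refl (mean (λ x → w x * f x)) e acceptance ⟩
        mean (λ x → w x * f x) + (1ℚ - acceptance) * e ∎
        where
        open ≡-Reasoning
        e = 𝔼 f (tries acc m)

      𝔼-mechanism : ∀ f L m → 𝔼 f (mechanism acc L m) ≡
                    pow ½ L * mean f + (1ℚ - pow ½ L) * 𝔼 f (tries acc m)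
      𝔼-mechanism f L m = trans (𝔼-bind f (heads L true) _) (𝔼-heads _ L true)

      0≤reject : 0ℚ ≤ 1ℚ - acceptance
      0≤reject = p≤q⇒0≤q-p acceptance≤1

open Expectation

-- Rejection sampling with finitely many attempts: value and privacy

module RejectionSampling where

  -- The sum of (1 - a)^i over i < m, that is (1 - (1 - a)^m) / a written without division, since an
  -- acceptance probability may be 0.
  geometric : ℚ → ℕ → ℚ
  geometric a zero    = 0ℚ
  geometric a (suc m) = 1ℚ + (1ℚ - a) * geometric a m

  0≤geometric : ∀ {a} → a ≤ 1ℚ → ∀ m → 0ℚ ≤ geometric a m
  0≤geometric a≤1 zero    = ℚₚ.≤-refl
  0≤geometric a≤1 (suc m) = 0≤1 ⊕ p≤q⇒0≤q-p a≤1 ⊛ 0≤geometric a≤1 m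

  geometric-sum : ∀ a m → a * geometric a m + pow (1ℚ - a) m ≡ 1ℚ
  geometric-sum a zero    = solve 1 (λ a → a :* con 0ℚ :+ con 1ℚ := con 1ℚ) refl a
  geometric-sum a (suc m) = trans
    (solve 3 (λ a g p → a :* (con 1ℚ :+ (con 1ℚ :- a) :* g) :+ (con 1ℚ :- a) :* p
       := a :+ (con 1ℚ :- a) :* (a :* g :+ p)) refl a (geometric a m) (pow (1ℚ - a) m))
    (trans (cong (λ z → a + (1ℚ - a) * z) (geometric-sum a m))
           (solve 1 (λ a → a :+ (con 1ℚ :- a) :* con 1ℚ := con 1ℚ) refl a))

  geometric-antitone : ∀ {a b} → a ≤ b → b ≤ 1ℚ → ∀ m → geometric b m ≤ geometric a m
  geometric-antitone a≤b b≤1 zero = ℚₚ.≤-refl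
  geometric-antitone {a} {b} a≤b b≤1 (suc m) = ≤-by
    (p≤q⇒0≤q-p (ℚₚ.≤-trans a≤b b≤1) ⊛ p≤q⇒0≤q-p (geometric-antitone a≤b b≤1 m)
      ⊕ p≤q⇒0≤q-p a≤b ⊛ 0≤geometric b≤1 m)
    (solve 4 (λ a b g h → con 1ℚ :+ (con 1ℚ :- a) :* g :=
        (con 1ℚ :+ (con 1ℚ :- b) :* h) :+ ((con 1ℚ :- a) :* (g :- h) :+ (b :- a) :* h))
      refl a b (geometric a m) (geometric b m))

  1≤⇒p≤*p : ∀ {w p} → 1ℚ ≤ w → 0ℚ ≤ p → p ≤ w * p
  1≤⇒p≤*p {w} {p} 1≤w 0≤p = subst (_≤ w * p) (ℚₚ.*-identityˡ p) (*-monoˡ 0≤p 1≤w)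

  -- For a < b the bound follows from a · geometric a m ≤ b · geometric b m.
  geometric-ratio : ∀ {w a b} → 1ℚ ≤ w → 0ℚ ≤ a → a ≤ 1ℚ → b ≤ 1ℚ → b ≤ w * a →
                    ∀ m → geometric a m ≤ w * geometric b m
  geometric-ratio {w} {a} {b} 1≤w 0≤a a≤1 b≤1 b≤wa m with b ℚₚ.≤? a
  ... | yes b≤a = ℚₚ.≤-trans (geometric-antitone b≤a a≤1 m) (1≤⇒p≤*p 1≤w (0≤geometric b≤1 m))
  ... | no b≰a = ℚₚ.*-cancelˡ-≤-pos a {{ℚ.positive 0<a}} scaled
    where
    a<b : a < b
    a<b = ℚₚ.≰⇒> b≰a
    0<a : 0ℚ < a
    0<a = ℚₚ.≰⇒> λ a≤0 → b≰a (subst (b ≤_)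
      (trans (cong (w *_) (ℚₚ.≤-antisym a≤0 0≤a)) (trans (ℚₚ.*-zeroʳ w) (ℚₚ.≤-antisym 0≤a a≤0))) b≤wa)
    isolate : ∀ x → x * geometric x m ≡ 1ℚ - pow (1ℚ - x) m
    isolate x = trans (solve 2 (λ y p → y := (y :+ p) :- p) refl (x * geometric x m) (pow (1ℚ - x) m))
                      (cong (_- pow (1ℚ - x) m) (geometric-sum x m))
    scaled : a * geometric a m ≤ a * (w * geometric b m)
    scaled = begin
      a * geometric a m          ≡⟨ isolate a ⟩
      1ℚ - pow (1ℚ - a) m
        ≤⟨ ℚₚ.+-monoʳ-≤ 1ℚ (ℚₚ.neg-antimono-≤ (pow-mono (p≤q⇒0≤q-p b≤1)
             (ℚₚ.+-monoʳ-≤ 1ℚ (ℚₚ.neg-antimono-≤ (ℚₚ.<⇒≤ a<b))) m)) ⟩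
      1ℚ - pow (1ℚ - b) m        ≡⟨ isolate b ⟨
      b * geometric b m          ≤⟨ *-monoˡ (0≤geometric b≤1 m) b≤wa ⟩
      w * a * geometric b m      ≡⟨ solve 3 (λ w a g → w :* a :* g := a :* (w :* g)) refl w a (geometric b m) ⟩
      a * (w * geometric b m)    ∎
      where open ℚₚ.≤-Reasoning

  module SelectionBounds {X : Set} (gen : Rand X) where

    open Selection gen

    module Single (acc : X → Rand Bool) (w : X → ℚ)
      (acc-w : ∀ g x → 𝔼 g (acc x) ≡ mix (w x) g true)
      (0≤w : ∀ x → 0ℚ ≤ w x) (w≤1 : ∀ x → w x ≤ 1ℚ) where

      open Accepting acc w acc-w 0≤w w≤1 public

      -- Each attempt contributes the same accepted mass, discounted by the probability (1 - a)^i of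
      -- reaching it; the last term is the fresh sample after m rejections.
      tries-closed : ∀ f m → 𝔼 f (tries acc m) ≡
        mean (λ x → w x * f x) * geometric acceptance m + pow (1ℚ - acceptance) m * mean f
      tries-closed f zero = solve 2 (λ a g → g := a :* con 0ℚ :+ con 1ℚ :* g) refl (mean (λ x → w x * f x)) (mean f)
      tries-closed f (suc m) = trans (𝔼-tries f m) (trans
        (cong (λ e → mean (λ x → w x * f x) + (1ℚ - acceptance) * e) (tries-closed f m))
        (solve 5 (λ a r g p e → a :+ r :* (a :* g :+ p :* e) := a :* (con 1ℚ :+ r :* g) :+ r :* p :* e) refl
          (mean (λ x → w x * f x)) (1ℚ - acceptance) (geometric acceptance m) (pow (1ℚ - acceptance) m) (mean f)))

      -- A union bound: the result is one of at most `suc m` draws from `gen`.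
      tries≤ : ∀ {f} → (∀ x → 0ℚ ≤ f x) → ∀ m → 𝔼 f (tries acc m) ≤ ι (suc m) * mean f
      tries≤ {f} 0≤f zero = ℚₚ.≤-reflexive (trans (sym (ℚₚ.*-identityˡ (mean f))) (cong (_* mean f) (sym ι-1)))
      tries≤ {f} 0≤f (suc m) = begin
        𝔼 f (tries acc (suc m))    ≡⟨ 𝔼-tries f m ⟩
        mean (λ x → w x * f x) + (1ℚ - acceptance) * e
          ≤⟨ ℚₚ.+-mono-≤
               (𝔼-mono (λ x → subst (w x * f x ≤_) (ℚₚ.*-identityˡ (f x)) (*-monoˡ (0≤f x) (w≤1 x))) gen)
               (≤-by (0≤acceptance ⊛ 0≤e)
                 (solve 2 (λ a e → e := (con 1ℚ :- a) :* e :+ a :* e) refl acceptance e)) ⟩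
        mean f + e                 ≤⟨ ℚₚ.+-monoʳ-≤ (mean f) (tries≤ 0≤f m) ⟩
        mean f + ι (suc m) * mean f
          ≡⟨ trans (solve 2 (λ f i → f :+ i :* f := (con 1ℚ :+ i) :* f) refl (mean f) (ι (suc m)))
                   (cong (_* mean f) (sym (ι-suc (suc m)))) ⟩
        ι (suc (suc m)) * mean f   ∎
        where
        open ℚₚ.≤-Reasoning
        e = 𝔼 f (tries acc m)
        0≤e : 0ℚ ≤ e
        0≤e = 𝔼≥ 0≤f (tries acc m)

      -- v is the value promised by an accepted sample, scaled by s.
      tries≥ : ∀ {f s v} → (∀ x → 0ℚ ≤ f x) → 0ℚ ≤ s → v * acceptance ≤ s * mean (λ x → w x * f x) →
               ∀ m → v * (1ℚ - pow (1ℚ - acceptance) m) ≤ s * 𝔼 f (tries acc m)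
      tries≥ {f} {s} {v} 0≤f 0≤s v≤ zero = ≤-by (0≤s ⊛ 𝔼≥ 0≤f gen)
        (solve 2 (λ v e → e := v :* (con 1ℚ :- con 1ℚ) :+ e) refl v (s * mean f))
      tries≥ {f} {s} {v} 0≤f 0≤s v≤ (suc m) = subst (v * (1ℚ - pow (1ℚ - acceptance) (suc m)) ≤_)
        (cong (s *_) (sym (𝔼-tries f m)))
        (≤-by (p≤q⇒0≤q-p v≤ ⊕ 0≤reject ⊛ p≤q⇒0≤q-p (tries≥ {f} {s} {v} 0≤f 0≤s v≤ m))
          (solve 6 (λ s b a e v p → s :* (b :+ (con 1ℚ :- a) :* e) :=
              v :* (con 1ℚ :- (con 1ℚ :- a) :* p) :+
              ((s :* b :- v :* a) :+ (con 1ℚ :- a) :* (s :* e :- v :* (con 1ℚ :- p))))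
            refl s (mean (λ x → w x * f x)) acceptance (𝔼 f (tries acc m)) v (pow (1ℚ - acceptance) m)))

      mechanism≥ : ∀ {f s v} L m → (∀ x → 0ℚ ≤ f x) → 0ℚ ≤ s → v * acceptance ≤ s * mean (λ x → w x * f x) →
                   (1ℚ - pow ½ L) * (v * (1ℚ - pow (1ℚ - acceptance) m)) ≤ s * 𝔼 f (mechanism acc L m)
      mechanism≥ {f} {s} {v} L m 0≤f 0≤s v≤ = subst (_ ≤_) (cong (s *_) (sym (𝔼-mechanism f L m)))
        (≤-by (½^≥0 L ⊛ (0≤s ⊛ 𝔼≥ 0≤f gen) ⊕ p≤q⇒0≤q-p (½^≤1 L) ⊛ p≤q⇒0≤q-p (tries≥ {f} {s} {v} 0≤f 0≤s v≤ m))
          (solve 5 (λ s b g e x → s :* (b :* g :+ (con 1ℚ :- b) :* e) :=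
               (con 1ℚ :- b) :* x :+ (b :* (s :* g) :+ (con 1ℚ :- b) :* (s :* e :- x)))
            refl s (pow ½ L) (mean f) (𝔼 f (tries acc m)) (v * (1ℚ - pow (1ℚ - acceptance) m))))

      -- Every outcome is a draw from `gen`, whichever attempt produced it. This is the lossless
      -- bound needed for k = 1.
      constant≤mechanism : ∀ {f c} L m → (∀ x → 0ℚ ≤ f x) → Always (λ x → c ≤ f x) gen → c ≤ 𝔼 f (mechanism acc L m)
      constant≤mechanism {f} {c} L m 0≤f c≤f = subst (c ≤_) (sym (𝔼-mechanism f L m))
        (≤-by (½^≥0 L ⊛ p≤q⇒0≤q-p c≤mean ⊕ p≤q⇒0≤q-p (½^≤1 L) ⊛ p≤q⇒0≤q-p (c≤tries m))
          (solve 4 (λ b g e c → b :* g :+ (con 1ℚ :- b) :* e := c :+ (b :* (g :- c) :+ (con 1ℚ :- b) :* (e :- c)))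
            refl (pow ½ L) (mean f) (𝔼 f (tries acc m)) c))
        where
        c≤mean : c ≤ mean f
        c≤mean = subst (_≤ mean f) (𝔼-const c gen) (𝔼-mono-Always gen c≤f)
        ca≤ : c * acceptance ≤ mean (λ x → w x * f x)
        ca≤ = subst (_≤ mean (λ x → w x * f x)) (𝔼-* c w gen)
          (𝔼-mono-Always gen (Always-map (λ x c≤ → subst (_≤ w x * f x) (ℚₚ.*-comm (w x) c) (*-monoʳ (0≤w x) c≤)) gen c≤f))
        c≤tries : ∀ m → c ≤ 𝔼 f (tries acc m)
        c≤tries zero    = c≤mean
        c≤tries (suc m) = subst (c ≤_) (sym (𝔼-tries f m))
          (≤-by (p≤q⇒0≤q-p ca≤ ⊕ 0≤reject ⊛ p≤q⇒0≤q-p (c≤tries m))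
            (solve 4 (λ b a e c → b :+ (con 1ℚ :- a) :* e := c :+ ((b :- c :* a) :+ (con 1ℚ :- a) :* (e :- c)))
              refl (mean (λ x → w x * f x)) acceptance (𝔼 f (tries acc m)) c))

    module Pair (acc acc′ : X → Rand Bool) (w w′ : X → ℚ)
      (acc-w : ∀ g x → 𝔼 g (acc x) ≡ mix (w x) g true)
      (0≤w : ∀ x → 0ℚ ≤ w x) (w≤1 : ∀ x → w x ≤ 1ℚ)
      (acc-w′ : ∀ g x → 𝔼 g (acc′ x) ≡ mix (w′ x) g true)
      (0≤w′ : ∀ x → 0ℚ ≤ w′ x) (w′≤1 : ∀ x → w′ x ≤ 1ℚ) where

      private
        module M  = Single acc  w  acc-w  0≤w  w≤1
        module M′ = Single acc′ w′ acc-w′ 0≤w′ w′≤1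

      -- The term of the rejected runs needs only that it is between pow ½ L and 1.
      ratio-close : ∀ {f W} L m → (∀ x → 0ℚ ≤ f x) → 1ℚ ≤ W → 1ℚ ≤ W * pow ½ L →
        (∀ x → w x ≤ W * w′ x) → (∀ x → w′ x ≤ W * w x) →
        𝔼 f (mechanism acc L m) ≤ W * W * 𝔼 f (mechanism acc′ L m)
      ratio-close {f} {W} L m 0≤f 1≤W 1≤Wβ w≤ w′≤ = subst₂ _≤_ (sym lhs) (cong (W * W *_) (sym rhs))
        (≤-by ((p≤q⇒0≤q-p β≤1 ⊛ p≤q⇒0≤q-p Ag≤) ⊕
               ((p≤q⇒0≤q-p β≤1 ⊛ p≤q⇒0≤q-p p≤1) ⊛ 0≤G ⊕
               ((0≤W ⊛ p≤q⇒0≤q-p 1≤Wβ ⊕ p≤q⇒0≤q-p 1≤W) ⊛ 0≤G ⊕ ((0≤W ⊛ 0≤W) ⊛ (p≤q⇒0≤q-p β≤1 ⊛ 0≤p′)) ⊛ 0≤G)))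
          (solve 7 (λ W β A A′ p p′ G →
             W :* W :* (β :* G :+ (con 1ℚ :- β) :* (A′ :+ p′ :* G)) :=
             (β :* G :+ (con 1ℚ :- β) :* (A :+ p :* G)) :+
             ((con 1ℚ :- β) :* (W :* W :* A′ :- A) :+
              ((con 1ℚ :- β) :* (con 1ℚ :- p) :* G :+
               ((W :* (W :* β :- con 1ℚ) :+ (W :- con 1ℚ)) :* G :+ ((W :* W) :* ((con 1ℚ :- β) :* p′)) :* G))))
            refl W β (A * g) (A′ * g′) p p′ G))
        where
        β = pow ½ L
        A  = mean (λ x → w x * f x)
        A′ = mean (λ x → w′ x * f x)
        G  = mean f
        g  = geometric M.acceptance m
        g′ = geometric M′.acceptance m
        p  = pow (1ℚ - M.acceptance) m
        p′ = pow (1ℚ - M′.acceptance) m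
        lhs : 𝔼 f (mechanism acc L m) ≡ β * G + (1ℚ - β) * (A * g + p * G)
        lhs = trans (M.𝔼-mechanism f L m) (cong (λ e → β * G + (1ℚ - β) * e) (M.tries-closed f m))
        rhs : 𝔼 f (mechanism acc′ L m) ≡ β * G + (1ℚ - β) * (A′ * g′ + p′ * G)
        rhs = trans (M′.𝔼-mechanism f L m) (cong (λ e → β * G + (1ℚ - β) * e) (M′.tries-closed f m))
        β≤1 = ½^≤1 L
        0≤W : 0ℚ ≤ W
        0≤W = ℚₚ.≤-trans 0≤1 1≤W
        0≤G : 0ℚ ≤ G
        0≤G = 𝔼≥ 0≤f gen
        0≤p′ = pow≥0 M′.0≤reject m
        p≤1 : p ≤ 1ℚ
        p≤1 = pow≤1 M.0≤reject (≤-by M.0≤acceptance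
          (solve 1 (λ a → con 1ℚ := (con 1ℚ :- a) :+ a) refl M.acceptance)) m
        -- One factor `W` bounds the unnormalised accepted mass; the other, in `g≤`, bounds the
        -- normalisation.
        A≤ : A ≤ W * A′
        A≤ = subst (A ≤_) (𝔼-* W _ gen) (𝔼-mono (λ x → subst (w x * f x ≤_) (ℚₚ.*-assoc W (w′ x) (f x))
          (*-monoˡ (0≤f x) (w≤ x))) gen)
        g≤ : g ≤ W * g′
        g≤ = geometric-ratio 1≤W M.0≤acceptance M.acceptance≤1 M′.acceptance≤1
          (subst (M′.acceptance ≤_) (𝔼-* W w gen) (𝔼-mono w′≤ gen)) m
        0≤A′ : 0ℚ ≤ A′
        0≤A′ = 𝔼≥ (λ x → 0≤w′ x ⊛ 0≤f x) gen
        Ag≤ : A * g ≤ W * W * (A′ * g′)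
        Ag≤ = subst (A * g ≤_) (solve 3 (λ W a g → W :* a :* (W :* g) := W :* W :* (a :* g)) refl W A′ g′)
          (*-mono (0≤geometric M.acceptance≤1 m) (0≤W ⊛ 0≤A′) A≤ g≤)

      -- From below, the fallback alone contributes `pow ½ L * mean f` for every input; from above,
      -- all draws together contribute at most `suc m` times `mean f`. This covers pairs of weights
      -- of which one vanishes and the other does not.
      ratio-bounded : ∀ {f V} L m → (∀ x → 0ℚ ≤ f x) → 0ℚ ≤ V → ι (suc m) ≤ V * pow ½ L →
        𝔼 f (mechanism acc L m) ≤ V * 𝔼 f (mechanism acc′ L m)
      ratio-bounded {f} {V} L m 0≤f 0≤V ιm≤ = subst₂ _≤_ (sym (M.𝔼-mechanism f L m)) (cong (V *_) (sym (M′.𝔼-mechanism f L m)))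
        (≤-by (p≤q⇒0≤q-p (½^≤1 L) ⊛ p≤q⇒0≤q-p (M.tries≤ 0≤f m)
               ⊕ (½^≥0 L ⊛ 0≤i ⊕ p≤q⇒0≤q-p ιm≤) ⊛ 0≤G ⊕ (0≤V ⊛ (p≤q⇒0≤q-p (½^≤1 L) ⊛ 𝔼≥ 0≤f (tries acc′ m))))
          (trans (solve 6 (λ V β G E E′ i →
              V :* (β :* G :+ (con 1ℚ :- β) :* E′) :=
              (β :* G :+ (con 1ℚ :- β) :* E) :+
              ((con 1ℚ :- β) :* ((con 1ℚ :+ i) :* G :- E) :+ (β :* i :+ (V :* β :- (con 1ℚ :+ i))) :* G :+ V :* ((con 1ℚ :- β) :* E′)))
            refl V β G E E′ (ι m))
            (cong (λ z → (β * G + (1ℚ - β) * E) +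
              ((1ℚ - β) * (z * G - E) + (β * ι m + (V * β - z)) * G + V * ((1ℚ - β) * E′))) (sym (ι-suc m)))))
        where
        β = pow ½ L
        G = mean f
        E = 𝔼 f (tries acc m)
        E′ = 𝔼 f (tries acc′ m)
        0≤i = 0≤ι m
        0≤G : 0ℚ ≤ G
        0≤G = 𝔼≥ 0≤f gen

open RejectionSampling

-- Weights of colourings, and the probability of a prescribed colouring

module Colourings where

  n<2^n : ∀ n → n ℕ.< 2 ℕ.^ n
  n<2^n zero    = s≤s z≤n
  n<2^n (suc n) = ℕₚ.+-mono-≤ (ℕₚ.m^n>0 2 n) (ℕₚ.≤-trans (n<2^n n) (ℕₚ.m≤m+n (2 ℕ.^ n) 0))

  pow½*≤ : ∀ z → ι z * pow ½ z ≤ 1ℚ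
  pow½*≤ z = subst (ι z * pow ½ z ≤_) (2^-½^ z) (*-monoˡ (½^≥0 z) (ι-mono (ℕₚ.<⇒≤ (n<2^n z))))

  -- The utility estimate of the exponential mechanism. A loss of at most `B` is paid by the first
  -- term; for y = B + z the excess is 2^-B times z 2^-z, and z 2^-z ≤ 1.
  exponential-loss : ∀ B y → ι y * pow ½ y ≤ ι B * pow ½ y + pow ½ B
  exponential-loss B y with ℕₚ.≤-total y B
  ... | inj₁ y≤B = ≤-by (p≤q⇒0≤q-p (*-monoˡ (½^≥0 y) (ι-mono y≤B)) ⊕ ½^≥0 B)
          (solve 3 (λ a b c → a :+ c := b :+ ((a :- b) :+ c)) refl (ι B * pow ½ y) (ι y * pow ½ y) (pow ½ B))
  ... | inj₂ B≤y = subst (λ y → ι y * pow ½ y ≤ ι B * pow ½ y + pow ½ B) (ℕₚ.m+[n∸m]≡n B≤y) (split (y ℕ.∸ B))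
    where
    split : ∀ z → ι (B ℕ.+ z) * pow ½ (B ℕ.+ z) ≤ ι B * pow ½ (B ℕ.+ z) + pow ½ B
    split z rewrite pow-+ ½ B z | ι-+ B z = ≤-by (½^≥0 B ⊛ p≤q⇒0≤q-p (pow½*≤ z))
      (solve 4 (λ b z p q → b :* (p :* q) :+ p := (b :+ z) :* (p :* q) :+ p :* (con 1ℚ :- z :* q)) refl
        (ι B) (ι z) (pow ½ B) (pow ½ z))

  missing tally : (ℕ → Bool) → ℕ → ℕ → ℕ
  missing has zero    γ = 0
  missing has (suc m) γ = bit (not (has γ)) ℕ.+ missing has m (suc γ)
  tally has zero    γ = 0
  tally has (suc m) γ = bit (has γ) ℕ.+ tally has m (suc γ)

  tally+missing : ∀ has m γ → tally has m γ ℕ.+ missing has m γ ≡ m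
  tally+missing has zero    γ = refl
  tally+missing has (suc m) γ with has γ
  ... | true  = cong suc (tally+missing has m (suc γ))
  ... | false = trans (ℕₚ.+-suc _ _) (cong suc (tally+missing has m (suc γ)))

  weight-small : ∀ t has m γ → weight 0 t has m γ ≡ pow ½ (t ℕ.* missing has m γ)
  weight-small t has zero    γ rewrite ℕₚ.*-zeroʳ t = refl
  weight-small t has (suc m) γ with has γ
  ... | true  = trans (ℚₚ.*-identityˡ _) (weight-small t has m (suc γ))
  ... | false rewrite ℕₚ.*-suc t (missing has m (suc γ)) | weight-small t has m (suc γ) = sym (pow-+ ½ t _)

  weight-large : ∀ s t has m γ → missing has m γ ≡ 0 ⊎ weight (suc s) t has m γ ≡ 0ℚ
  weight-large s t has zero    γ = inj₁ refl
  weight-large s t has (suc m) γ with has γ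
  ... | false = inj₂ (ℚₚ.*-zeroˡ (weight (suc s) t has m (suc γ)))
  ... | true  with weight-large s t has m (suc γ)
  ...   | inj₁ none = inj₁ none
  ...   | inj₂ w≡0  = inj₂ (trans (ℚₚ.*-identityˡ _) w≡0)

  -- With d missing classes the soft weight is 2^-(td), so this is `exponential-loss` at y = td. In
  -- the strict regime the left side vanishes, since a positive weight forces d = 0.
  weight-loss : ∀ s t B has m γ →
    ι t * (ι (missing has m γ) * weight s (t ℕ.∸ s) has m γ) ≤ ι B * weight s (t ℕ.∸ s) has m γ + pow ½ B
  weight-loss zero t B has m γ rewrite weight-small t has m γ =
    subst (_≤ ι B * pow ½ (t ℕ.* d) + pow ½ B)
      (trans (cong (_* pow ½ (t ℕ.* d)) (ι-* t d)) (ℚₚ.*-assoc (ι t) (ι d) _))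
      (exponential-loss B (t ℕ.* d))
    where d = missing has m γ
  weight-loss (suc s) t B has m γ = subst (_≤ ι B * w + pow ½ B) (sym vanishes)
    (0≤ι B ⊛ 0≤weight (suc s) (t ℕ.∸ suc s) has m γ ⊕ ½^≥0 B)
    where
    w = weight (suc s) (t ℕ.∸ suc s) has m γ
    vanishes : ι t * (ι (missing has m γ) * w) ≡ 0ℚ
    vanishes with weight-large s (t ℕ.∸ suc s) has m γ
    ... | inj₁ none = trans (cong (λ d → ι t * (ι d * w)) none) (trans (cong (λ z → ι t * (z * w)) ι-0)
                        (trans (cong (ι t *_) (ℚₚ.*-zeroˡ w)) (ℚₚ.*-zeroʳ (ι t))))
    ... | inj₂ w≡0  = trans (cong (λ w → ι t * (ι (missing has m γ) * w)) w≡0)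
                        (trans (cong (ι t *_) (ℚₚ.*-zeroʳ (ι (missing has m γ)))) (ℚₚ.*-zeroʳ (ι t)))

  all-present : ∀ s t has m γ → (∀ i → γ ℕ.≤ i → i ℕ.< γ ℕ.+ m → has i ≡ true) → weight s t has m γ ≡ 1ℚ
  all-present s t has zero    γ h = refl
  all-present s t has (suc m) γ h rewrite h γ ℕₚ.≤-refl (ℕₚ.m<m+n γ (s≤s z≤n)) =
    trans (ℚₚ.*-identityˡ _) (all-present s t has m (suc γ)
      λ i γ<i i< → h i (ℕₚ.<⇒≤ γ<i) (subst (i ℕ.<_) (sym (ℕₚ.+-suc γ m)) i<))

  1≤2^ : ∀ t → 1ℚ ≤ ι (2 ℕ.^ t)
  1≤2^ t = subst (_≤ ι (2 ℕ.^ t)) ι-1 (ι-mono (ℕₚ.m^n>0 2 t))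

  1≤2^*cost : ∀ t b → 1ℚ ≤ ι (2 ℕ.^ t) * cost 0 t b
  1≤2^*cost t true  = subst (1ℚ ≤_) (sym (ℚₚ.*-identityʳ _)) (1≤2^ t)
  1≤2^*cost t false = ℚₚ.≤-reflexive (sym (2^-½^ t))

  weight-agree : ∀ s t has has′ m γ → (∀ i → γ ℕ.≤ i → has i ≡ has′ i) →
                 weight s t has m γ ≡ weight s t has′ m γ
  weight-agree s t has has′ zero    γ same = refl
  weight-agree s t has has′ (suc m) γ same = cong₂ (λ b w → cost s t b * w) (same γ ℕₚ.≤-refl)
    (weight-agree s t has has′ m (suc γ) λ i γ<i → same i (ℕₚ.<⇒≤ γ<i))

  -- Only the factor of class `γ₀` can differ, and each factor lies between 2^-t and 1. Once `γ₀` is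
  -- passed, the remaining products agree.
  weight-ratio : ∀ t has has′ γ₀ → (∀ γ → γ ≢ γ₀ → has γ ≡ has′ γ) → ∀ m γ →
                 weight 0 t has m γ ≤ ι (2 ℕ.^ t) * weight 0 t has′ m γ
  weight-ratio t has has′ γ₀ same zero    γ = 1≤⇒p≤*p (1≤2^ t) 0≤1
  weight-ratio t has has′ γ₀ same (suc m) γ with γ ℕₚ.≟ γ₀
  ... | yes refl = begin
          cost 0 t (has γ) * weight 0 t has m (suc γ)
            ≡⟨ cong (cost 0 t (has γ) *_) (weight-agree 0 t has has′ m (suc γ)
                 λ i γ<i → same i λ i≡γ → ℕₚ.<-irrefl (sym i≡γ) γ<i) ⟩
          cost 0 t (has γ) * w′
            ≤⟨ *-monoˡ (0≤weight 0 t has′ m (suc γ)) (ℚₚ.≤-trans (cost≤1 0 t (has γ)) (1≤2^*cost t (has′ γ))) ⟩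
          ι (2 ℕ.^ t) * cost 0 t (has′ γ) * w′
            ≡⟨ ℚₚ.*-assoc (ι (2 ℕ.^ t)) (cost 0 t (has′ γ)) w′ ⟩
          ι (2 ℕ.^ t) * (cost 0 t (has′ γ) * w′) ∎
    where
    open ℚₚ.≤-Reasoning
    w′ = weight 0 t has′ m (suc γ)
  ... | no γ≢γ₀ rewrite same γ γ≢γ₀ = subst (cost 0 t (has′ γ) * weight 0 t has m (suc γ) ≤_)
          (solve 3 (λ c W w → c :* (W :* w) := W :* (c :* w)) refl (cost 0 t (has′ γ)) (ι (2 ℕ.^ t)) (weight 0 t has′ m (suc γ)))
          (*-monoʳ (0≤cost 0 t (has′ γ)) (weight-ratio t has has′ γ₀ same m (suc γ)))

  bits : ℕ → ℕ → Rand ℕ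
  bits zero    c = ret c
  bits (suc b) c = toss (bits b (c ℕ.+ c ℕ.+ 0)) (bits b (c ℕ.+ c ℕ.+ 1))

  colouring : ℕ → ℕ → Rand (List ℕ)
  colouring b zero    = ret []
  colouring b (suc n) = bits b 0 >>= λ c → mapR (c ∷_) (colouring b n)

  -- Vertices beyond the end of the list have colour 0.
  colour : List ℕ → ℕ → ℕ
  colour []       v       = 0
  colour (c ∷ cs) zero    = c
  colour (c ∷ cs) (suc v) = colour cs v

  colours-zero : ∀ n → Always (λ cs → ∀ v → colour cs v ≡ 0) (colouring 0 n)
  colours-zero zero    = λ v → refl
  colours-zero (suc n) = Always-bind (colouring 0 n) (colours-zero n)
    λ { cs z zero → refl ; cs z (suc v) → z v }

  -- The hypotheses put `x` into the interval of numbers whose binary expansion is `c` followed by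
  -- `b` further bits; each coin selects one half of it.
  bits-hit : ∀ {f : ℕ → ℚ} → (∀ c → 0ℚ ≤ f c) → ∀ b c x → c ℕ.* 2 ℕ.^ b ℕ.≤ x → x ℕ.< suc c ℕ.* 2 ℕ.^ b →
             pow ½ b * f x ≤ 𝔼 f (bits b c)
  bits-hit {f} 0≤f zero c x lo hi = ℚₚ.≤-reflexive (trans (ℚₚ.*-identityˡ (f x)) (cong f x≡c))
    where
    x≡c : x ≡ c
    x≡c = ℕₚ.≤-antisym (ℕ.s≤s⁻¹ (subst (x ℕ.<_) (ℕₚ.*-identityʳ (suc c)) hi)) (subst (ℕ._≤ x) (ℕₚ.*-identityʳ c) lo)
  bits-hit {f} 0≤f (suc b) c x lo hi with x ℕₚ.<? suc (c ℕ.+ c ℕ.+ 0) ℕ.* 2 ℕ.^ b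
  ... | yes x< = ≤-by
          (0≤½ ⊛ (p≤q⇒0≤q-p (bits-hit 0≤f b (c ℕ.+ c ℕ.+ 0) x (subst (ℕ._≤ x) double lo) x<)
                  ⊕ 𝔼≥ 0≤f (bits b (c ℕ.+ c ℕ.+ 1))))
          (solve 4 (λ p x l r → con ½ :* (l :+ r) := con ½ :* p :* x :+ con ½ :* ((l :- p :* x) :+ r)) refl
            (pow ½ b) (f x) (𝔼 f (bits b (c ℕ.+ c ℕ.+ 0))) (𝔼 f (bits b (c ℕ.+ c ℕ.+ 1))))
    where
    double : c ℕ.* (2 ℕ.* 2 ℕ.^ b) ≡ (c ℕ.+ c ℕ.+ 0) ℕ.* 2 ℕ.^ b
    double = trans (sym (ℕₚ.*-assoc c 2 (2 ℕ.^ b))) (cong (ℕ._* 2 ℕ.^ b)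
      (trans (ℕₚ.*-comm c 2) (trans (cong (c ℕ.+_) (ℕₚ.+-identityʳ c)) (sym (ℕₚ.+-identityʳ (c ℕ.+ c))))))
  ... | no x≮ = ≤-by
          (0≤½ ⊛ (p≤q⇒0≤q-p (bits-hit 0≤f b (c ℕ.+ c ℕ.+ 1) x lo′ hi′)
                  ⊕ 𝔼≥ 0≤f (bits b (c ℕ.+ c ℕ.+ 0))))
          (solve 4 (λ p x l r → con ½ :* (l :+ r) := con ½ :* p :* x :+ con ½ :* ((r :- p :* x) :+ l)) refl
            (pow ½ b) (f x) (𝔼 f (bits b (c ℕ.+ c ℕ.+ 0))) (𝔼 f (bits b (c ℕ.+ c ℕ.+ 1))))
    where
    lo′ : (c ℕ.+ c ℕ.+ 1) ℕ.* 2 ℕ.^ b ℕ.≤ x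
    lo′ = subst (λ z → z ℕ.* 2 ℕ.^ b ℕ.≤ x)
      (trans (cong suc (ℕₚ.+-identityʳ (c ℕ.+ c))) (ℕₚ.+-comm 1 (c ℕ.+ c))) (ℕₚ.≮⇒≥ x≮)
    hi′ : x ℕ.< suc (c ℕ.+ c ℕ.+ 1) ℕ.* 2 ℕ.^ b
    hi′ = subst (x ℕ.<_) (trans (sym (ℕₚ.*-assoc (suc c) 2 (2 ℕ.^ b))) (cong (ℕ._* 2 ℕ.^ b)
      (trans (ℕₚ.*-comm (suc c) 2) (trans (cong (suc c ℕ.+_) (ℕₚ.+-identityʳ (suc c)))
        (cong suc (trans (ℕₚ.+-suc c c) (ℕₚ.+-comm 1 (c ℕ.+ c)))))))) hi

  -- The function `F` stands for an event: it is at least 1 when all masked vertices have their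
  -- target colours. Each masked vertex costs a factor 2^-b, the others cost nothing. The offset `v`
  -- is what the induction along the list moves.
  colouring-hit : ∀ b (mask : ℕ → Bool) (target : ℕ → ℕ) → (∀ v → target v ℕ.< 2 ℕ.^ b) →
    ∀ n v (F : List ℕ → ℚ) → (∀ cs → 0ℚ ≤ F cs) →
    (∀ cs → length cs ≡ n → (∀ i → i ℕ.< n → mask (v ℕ.+ i) ≡ true → colour cs i ≡ target (v ℕ.+ i)) → 1ℚ ≤ F cs) →
    pow ½ (b ℕ.* tally mask n v) ≤ 𝔼 F (colouring b n)
  colouring-hit b mask target bound zero v F 0≤F hit rewrite ℕₚ.*-zeroʳ b = hit [] refl λ i ()
  colouring-hit b mask target bound (suc n) v F 0≤F hit = subst (_ ≤_) (sym split) (go (mask v) refl)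
    where
    inner : ℕ → ℚ
    inner c = 𝔼 (λ cs → F (c ∷ cs)) (colouring b n)
    split : 𝔼 F (colouring b (suc n)) ≡ 𝔼 inner (bits b 0)
    split = trans (𝔼-bind F (bits b 0) _) (𝔼-cong (λ c → 𝔼-bind F (colouring b n) _) (bits b 0))
    m = tally mask n (suc v)
    0≤inner : ∀ c → 0ℚ ≤ inner c
    0≤inner c = 𝔼≥ (λ cs → 0≤F (c ∷ cs)) (colouring b n)
    rest : ∀ c → (mask v ≡ true → c ≡ target v) → pow ½ (b ℕ.* m) ≤ inner c
    rest c c-ok = colouring-hit b mask target bound n (suc v) (λ cs → F (c ∷ cs)) (λ cs → 0≤F (c ∷ cs))
      λ cs len ok → hit (c ∷ cs) (cong suc len) λ
        { zero    i<n on → subst (λ z → c ≡ target z) (sym (ℕₚ.+-identityʳ v))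
                             (c-ok (subst (λ z → mask z ≡ true) (ℕₚ.+-identityʳ v) on))
        ; (suc i) i<n on → subst (λ z → colour cs i ≡ target z) (sym (ℕₚ.+-suc v i))
                             (ok i (ℕ.s≤s⁻¹ i<n) (subst (λ z → mask z ≡ true) (ℕₚ.+-suc v i) on)) }
    go : ∀ a → mask v ≡ a → pow ½ (b ℕ.* (bit a ℕ.+ m)) ≤ 𝔼 inner (bits b 0)
    go false off = 𝔼≥ (λ c → rest c λ on → contradiction (trans (sym off) on) λ ()) (bits b 0)
    go true  on rewrite ℕₚ.*-suc b m | pow-+ ½ b (b ℕ.* m) = ℚₚ.≤-trans
      (*-monoʳ (½^≥0 b) (rest (target v) λ _ → refl))
      (bits-hit 0≤inner b 0 (target v) z≤n (subst (target v ℕ.<_) (sym (ℕₚ.*-identityˡ (2 ℕ.^ b))) (bound v)))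

open Colourings

-- A program logic for coin-free commands, and the tests of a single tuple

module HoareLogic where

  Det : (State → Set) → Rand State → Set
  Det P r = Σ State λ τ → r ≡ ret τ × P τ

  infixl 1 _▹_

  _▹_ : ∀ {P Q : State → Set} {r : Rand State} {f} → Det P r → (∀ τ → P τ → Det Q (f τ)) → Det Q (r >>= f)
  (τ , refl , p) ▹ k = k τ p

  Det-map : ∀ {P Q : State → Set} {r} → (∀ τ → P τ → Q τ) → Det P r → Det Q r
  Det-map f (τ , eq , p) = τ , eq , f τ p

  -- The wrapper keeps the command and the initial state visible to unification.
  record Triple {n} (G : Hypergraph n) (c : Cmd) (σ : State) (P : State → Set) : Set where
    constructor triple
    field
      det : Det P (run G c σ)

  open Triple

  module _ {n} {G : Hypergraph n} where

    infixl 1 _▸_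

    _▸_ : ∀ {c d σ P Q} → Triple G c σ Q → (∀ τ → Q τ → Triple G d τ P) → Triple G (c ⨾ d) σ P
    triple t ▸ k = triple (t ▹ λ τ q → det (k τ q))

    weaken : ∀ {c σ P Q} → (∀ τ → P τ → Q τ) → Triple G c σ P → Triple G c σ Q
    weaken f (triple t) = triple (Det-map f t)

    straight : ∀ {c d σ τ P} → run G c σ ≡ ret τ → Triple G d τ P → Triple G (c ⨾ d) σ P
    straight eq (triple t) = triple ((_ , eq , t) ▹ λ _ t → t)

    run-ifZero : ∀ {r c d} σ → reg σ r ≡ 0 → run G (ifZero r ₁ c ₂ d) σ ≡ run G c (tick 1 σ)
    run-ifZero {r} σ eq with reg σ r | eq
    ... | .0 | refl = refl

    run-ifSuc : ∀ {r c d} σ {x} → reg σ r ≡ suc x → run G (ifZero r ₁ c ₂ d) σ ≡ run G d (tick 1 σ)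
    run-ifSuc {r} σ eq with reg σ r | eq
    ... | .(suc _) | refl = refl

    if-zero : ∀ {P r c d σ} → reg σ r ≡ 0 → Triple G c (tick 1 σ) P → Triple G (ifZero r ₁ c ₂ d) σ P
    if-zero {P} {σ = σ} eq (triple t) = triple (subst (Det P) (sym (run-ifZero σ eq)) t)

    if-suc : ∀ {P r c d σ x} → reg σ r ≡ suc x → Triple G d (tick 1 σ) P → Triple G (ifZero r ₁ c ₂ d) σ P
    if-suc {P} {σ = σ} eq (triple t) = triple (subst (Det P) (sym (run-ifSuc σ eq)) t)

    Det-iterate : ∀ (P : ℕ → State → Set) {f} N → (∀ i σ → i ℕ.< N → P i σ → Det (P (suc i)) (f σ)) →
                  ∀ m i σ → i ℕ.+ m ≡ N → P i σ → Det (P N) (iterate m f σ)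
    Det-iterate P N step zero    i σ eq p = σ , refl , subst (λ i → P i σ) (trans (sym (ℕₚ.+-identityʳ i)) eq) p
    Det-iterate P N step (suc m) i σ eq p =
      step i σ (subst (i ℕ.<_) eq (ℕₚ.m<m+n i (s≤s z≤n))) p ▹
      λ τ q → Det-iterate P N step m (suc i) τ (trans (sym (ℕₚ.+-suc i m)) eq) q

    looping : ∀ {r c σ} (P : ℕ → State → Set) N → reg σ r ≡ N → P 0 (tick 1 σ) →
              (∀ i τ → i ℕ.< N → P i τ → Triple G c (tick 1 τ) (P (suc i))) → Triple G (loop r c) σ (P N)
    looping {r} {c} {σ} P N refl p step = triple (Det-iterate P N (λ i τ i<N q → det (step i τ i<N q)) N 0 (tick 1 σ) refl p)

  -- The registers 0, …, 6 hold the parameters of the main program, which never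
  -- writes them; rZero is never written at all.
  rN rK rH rB rT rP rL rOne rClass rOk rFound rX rY rBuf rStrict rAcc rFlag rV rCol rSum rPow rZero : Reg
  rN = 0
  rK = 1
  rH = 2
  rB = 3
  rT = 4
  rP = 5
  rL = 6
  rOne = 8
  rClass = 9
  rOk = 10
  rFound = 11
  rX = 12
  rY = 13
  rBuf = 14
  rStrict = 15
  rAcc = 16
  rFlag = 17
  rV = 18
  rCol = 19
  rSum = 20
  rPow = 21
  rZero = 31

  rTuple : ℕ → Reg
  rTuple j = 32 ℕ.+ j

  nop : Cmd
  nop = const rX 0

  each : {X : Set} → (X → Cmd) → List X → Cmd
  each f []       = nop
  each f (x ∷ xs) = f x ⨾ each f xs

  -- Subtraction is truncated, so equality is tested by adding both differences: `rX` becomes |rBuf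
  -- - rY|, which is 0 exactly when the two agree.
  compare : Cmd
  compare = sub rX rBuf rY ⨾ sub rY rY rBuf ⨾ add rX rX rY

  requireEqual requireDistinct : Cmd
  requireEqual    = compare ⨾ ifZero rX ₁ nop ₂ const rOk 0
  requireDistinct = compare ⨾ ifZero rX ₁ const rOk 0 ₂ nop

  module Tests (h : ℕ) where

    testColour : Fin h → Cmd
    testColour j = load rBuf (rTuple (toℕ j)) ⨾ add rY rClass rZero ⨾ requireEqual

    testDistinct : Fin h → Fin h → Cmd
    testDistinct i j = if does (i Finₚ.≟ j) then nop
      else (add rBuf (rTuple (toℕ i)) rZero ⨾ add rY (rTuple (toℕ j)) rZero ⨾ requireDistinct)

    -- The cells mem[n], …, mem[n + h - 1] list e, padded with the non-vertex n.
    writeCell : Subset h → Fin h → Cmd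
    writeCell e i = store rBuf (if lookup e i then rTuple (toℕ i) else rN) ⨾ add rBuf rBuf rOne

    testEdge : Subset h → Cmd
    testEdge e = add rBuf rN rZero ⨾ each (writeCell e) (allFin h) ⨾
      query rX rN rH ⨾ ifZero rX ₁ const rOk 0 ₂ nop

    testAll : List (Subset h) → Cmd
    testAll es = each testColour (allFin h) ⨾ each (λ i → each (testDistinct i) (allFin h)) (allFin h) ⨾ each testEdge es

    body : List (Subset h) → Cmd → Cmd
    body es act = const rOk 1 ⨾ testAll es ⨾
      ifZero rOk ₁ nop ₂ (ifZero rFound ₁ (const rFound 1 ⨾ act) ₂ nop)

    nest : ℕ → Cmd → Cmd
    nest zero    c = c
    nest (suc m) c = const (rTuple m) 0 ⨾ loop rN (nest m c ⨾ add (rTuple m) (rTuple m) rOne)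

    -- Runs act on the first copy in class rClass, if there is one.
    scan : List (Subset h) → Cmd → Cmd
    scan es act = const rFound 0 ⨾ nest h (body es act)

  -- A list, so that one equation transports all registers at once. The order makes prefixes
  -- meaningful: the first ten entries stay fixed during `main`, and the eleventh, `rFlag`, is set
  -- there once.
  view : State → List ℕ
  view σ = reg σ rN ∷ reg σ rK ∷ reg σ rH ∷ reg σ rB ∷ reg σ rT ∷ reg σ rP ∷ reg σ rL ∷ reg σ rOne ∷
           reg σ rStrict ∷ reg σ rZero ∷ reg σ rFlag ∷ reg σ rAcc ∷ reg σ rClass ∷ []

  -- The cells below the number of vertices hold the colouring; those from there on are scratch
  -- space for queries.
  record Keeps (σ τ : State) : Set where
    field
      views : view τ ≡ view σ
      cells : ∀ v → v ℕ.< reg σ rN → mem τ v ≡ mem σ v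

    at : ∀ i → colour (view τ) i ≡ colour (view σ) i
    at i = cong (λ l → colour l i) views

  open Keeps

  record Same (σ τ : State) : Set where
    field
      keeps  : Keeps σ τ
      outs   : out τ ≡ out σ
      founds : reg τ rFound ≡ reg σ rFound
      tuples : ∀ j → reg τ (rTuple j) ≡ reg σ (rTuple j)

  open Same

  keeps-refl : ∀ {σ τ} → view τ ≡ view σ → mem τ ≡ mem σ → Keeps σ τ
  keeps-refl v m = record { views = v ; cells = λ u _ → cong (λ f → f u) m }

  keeps-trans : ∀ {σ τ υ} → Keeps σ τ → Keeps τ υ → Keeps σ υ
  keeps-trans p q = record
    { views = trans (views q) (views p)
    ; cells = λ v v<n → trans (cells q v (subst (v ℕ.<_) (sym (at p 0)) v<n)) (cells p v v<n) }

  same-refl : ∀ {σ τ} → view τ ≡ view σ → mem τ ≡ mem σ → out τ ≡ out σ → reg τ rFound ≡ reg σ rFound →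
              (∀ j → reg τ (rTuple j) ≡ reg σ (rTuple j)) → Same σ τ
  same-refl v m o f t = record { keeps = keeps-refl v m ; outs = o ; founds = f ; tuples = t }

  same-trans : ∀ {σ τ υ} → Same σ τ → Same τ υ → Same σ υ
  same-trans p q = record
    { keeps  = keeps-trans (keeps p) (keeps q)
    ; outs   = trans (outs q) (outs p)
    ; founds = trans (founds q) (founds p)
    ; tuples = λ j → trans (tuples q j) (tuples p j) }

  record Setting (n h : ℕ) (χ : ℕ → ℕ) (γ : ℕ) (σ : State) : Set where
    field
      vertices : reg σ rN ≡ n
      arity    : reg σ rH ≡ h
      one      : reg σ rOne ≡ 1
      zeroed   : reg σ rZero ≡ 0
      class    : reg σ rClass ≡ γ
      colours  : ∀ v → v ℕ.< n → mem σ v ≡ χ v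

  open Setting

  setting-keeps : ∀ {n h χ γ σ τ} → Keeps σ τ → Setting n h χ γ σ → Setting n h χ γ τ
  setting-keeps p s = record
    { vertices = trans (at p 0) (vertices s)
    ; arity    = trans (at p 2) (arity s)
    ; one      = trans (at p 7) (one s)
    ; zeroed   = trans (at p 9) (zeroed s)
    ; class    = trans (at p 12) (class s)
    ; colours  = λ v v<n → trans (cells p v (subst (v ℕ.<_) (sym (vertices s)) v<n)) (colours s v v<n) }

  ≡ᵇ-refl : ∀ p → (p ℕ.≡ᵇ p) ≡ true
  ≡ᵇ-refl zero    = refl
  ≡ᵇ-refl (suc p) = ≡ᵇ-refl p

  ≡ᵇ⇒≡ : ∀ p q → (p ℕ.≡ᵇ q) ≡ true → p ≡ q
  ≡ᵇ⇒≡ p q eq = ℕₚ.≡ᵇ⇒≡ p q (subst T (sym eq) tt)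

  distance-zero : ∀ p q → (p ℕ.≡ᵇ q) ≡ true → (p ℕ.∸ q) ℕ.+ (q ℕ.∸ p) ≡ 0
  distance-zero p q eq rewrite ≡ᵇ⇒≡ p q eq | ℕₚ.n∸n≡0 q = refl

  distance-suc : ∀ p q → (p ℕ.≡ᵇ q) ≡ false → ∃ λ x → (p ℕ.∸ q) ℕ.+ (q ℕ.∸ p) ≡ suc x
  distance-suc zero    (suc q) eq = q , refl
  distance-suc (suc p) zero    eq = p ℕ.+ 0 , refl
  distance-suc (suc p) (suc q) eq = distance-suc p q eq

  bool-≡ : ∀ {a b} → (T a → T b) → (T b → T a) → a ≡ b
  bool-≡ {false} {false} f g = refl
  bool-≡ {false} {true}  f g = ⊥-elim (g tt)
  bool-≡ {true}  {false} f g = ⊥-elim (f tt)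
  bool-≡ {true}  {true}  f g = refl

  index-applyUpTo : ∀ (f : ℕ → ℕ) l → (∀ i → i ℕ.< length l → f i ≡ colour l i) → applyUpTo f (length l) ≡ l
  index-applyUpTo f []      eq = refl
  index-applyUpTo f (x ∷ l) eq = cong₂ _∷_ (eq 0 (s≤s z≤n)) (index-applyUpTo (λ i → f (suc i)) l λ i i< → eq (suc i) (s≤s i<))

  update-same : ∀ (f : ℕ → ℕ) a x → (f [ a ↦ x ]) a ≡ x
  update-same f a x = cong (λ b → if b then x else f a) (≡ᵇ-refl a)

  update-other : ∀ (f : ℕ → ℕ) a x u → u ≢ a → (f [ a ↦ x ]) u ≡ f u
  update-other f a x u u≢a with a ℕ.≡ᵇ u in eq
  ... | true  = contradiction (sym (≡ᵇ⇒≡ a u eq)) u≢a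
  ... | false = refl

  module Search {n h : ℕ} (G : Hypergraph n) (es : List (Subset h)) where

    open Tests h

    Tuple : Set
    Tuple = Vec (Fin n) h

    good : (ℕ → ℕ) → ℕ → Tuple → Bool
    good χ γ φ =
      all (λ j → χ (toℕ (lookup φ j)) ℕ.≡ᵇ γ) (allFin h) ∧
      (all (λ i → all (λ j → does (i Finₚ.≟ j) ∨ not (toℕ (lookup φ i) ℕ.≡ᵇ toℕ (lookup φ j))) (allFin h)) (allFin h) ∧
       all (λ e → edge G (image (lookup φ) e)) es)

    Holding : Tuple → State → Set
    Holding φ σ = ∀ j → reg σ (rTuple (toℕ j)) ≡ toℕ (lookup φ j)

    module _ (χ : ℕ → ℕ) (γ : ℕ) (φ : Tuple) where

      Test : Cmd → Bool → Set
      Test c b = ∀ σ → Setting n h χ γ σ → Holding φ σ → ∀ v → reg σ rOk ≡ bit v →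
        Triple G c σ (λ τ → Same σ τ × reg τ rOk ≡ bit (v ∧ b))

      holding-same : ∀ {σ τ} → Same σ τ → Holding φ σ → Holding φ τ
      holding-same p hold j = trans (tuples p (toℕ j)) (hold j)

      keep-true : ∀ v {x} → x ≡ bit v → x ≡ bit (v ∧ true)
      keep-true v eq = trans eq (cong bit (sym (Boolₚ.∧-identityʳ v)))

      become-false : ∀ v → 0 ≡ bit (v ∧ false)
      become-false v = cong bit (sym (Boolₚ.∧-zeroʳ v))

      test-nop : Test nop true
      test-nop σ s hold v ok = triple (_ , refl , same-refl refl refl refl refl (λ j → refl) , keep-true v ok)

      test-⨾ : ∀ {c d a b} → Test c a → Test d b → Test (c ⨾ d) (a ∧ b)
      test-⨾ {a = a} {b} tc td σ s hold v ok = tc σ s hold v ok ▸ λ τ (p , ok′) →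
        weaken (λ υ (q , ok″) → same-trans p q , trans ok″ (cong bit (Boolₚ.∧-assoc v a b)))
          (td τ (setting-keeps (keeps p) s) (holding-same p hold) (v ∧ a) ok′)

      test-each : ∀ {X : Set} (c : X → Cmd) (b : X → Bool) → (∀ x → Test (c x) (b x)) → ∀ xs → Test (each c xs) (all b xs)
      test-each c b t []       = test-nop
      test-each c b t (x ∷ xs) = test-⨾ (t x) (test-each c b t xs)

      distance : State → ℕ
      distance σ = (reg σ rBuf ℕ.∸ reg σ rY) ℕ.+ (reg σ rY ℕ.∸ reg σ rBuf)

      compare-run : ∀ σ → Triple G compare σ (λ τ → Same σ τ × reg τ rOk ≡ reg σ rOk × reg τ rX ≡ distance σ)
      compare-run σ = triple (_ , refl , same-refl refl refl refl refl (λ j → refl) , refl , refl)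

      equal-run : ∀ σ v → reg σ rOk ≡ bit v →
        Triple G requireEqual σ (λ τ → Same σ τ × reg τ rOk ≡ bit (v ∧ (reg σ rBuf ℕ.≡ᵇ reg σ rY)))
      equal-run σ v ok = compare-run σ ▸ λ τ (p , ok′ , x) → branch τ p (trans ok′ ok) x _ refl
        where
        branch : ∀ τ → Same σ τ → reg τ rOk ≡ bit v → reg τ rX ≡ distance σ →
          ∀ b → (reg σ rBuf ℕ.≡ᵇ reg σ rY) ≡ b → Triple G (ifZero rX ₁ nop ₂ const rOk 0) τ
          (λ υ → Same σ υ × reg υ rOk ≡ bit (v ∧ b))
        branch τ p ok x true  eq = if-zero (trans x (distance-zero (reg σ rBuf) (reg σ rY) eq))
          (triple (_ , refl , same-trans p (same-refl refl refl refl refl (λ j → refl)) , keep-true v ok))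
        branch τ p ok x false eq = if-suc (trans x (proj₂ (distance-suc (reg σ rBuf) (reg σ rY) eq)))
          (triple (_ , refl , same-trans p (same-refl refl refl refl refl (λ j → refl)) , become-false v))

      distinct-run : ∀ σ v → reg σ rOk ≡ bit v →
        Triple G requireDistinct σ (λ τ → Same σ τ × reg τ rOk ≡ bit (v ∧ not (reg σ rBuf ℕ.≡ᵇ reg σ rY)))
      distinct-run σ v ok = compare-run σ ▸ λ τ (p , ok′ , x) → branch τ p (trans ok′ ok) x _ refl
        where
        branch : ∀ τ → Same σ τ → reg τ rOk ≡ bit v → reg τ rX ≡ distance σ →
          ∀ b → (reg σ rBuf ℕ.≡ᵇ reg σ rY) ≡ b → Triple G (ifZero rX ₁ const rOk 0 ₂ nop) τ
          (λ υ → Same σ υ × reg υ rOk ≡ bit (v ∧ not b))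
        branch τ p ok x true  eq = if-zero (trans x (distance-zero (reg σ rBuf) (reg σ rY) eq))
          (triple (_ , refl , same-trans p (same-refl refl refl refl refl (λ j → refl)) , become-false v))
        branch τ p ok x false eq = if-suc (trans x (proj₂ (distance-suc (reg σ rBuf) (reg σ rY) eq)))
          (triple (_ , refl , same-trans p (same-refl refl refl refl refl (λ j → refl)) , keep-true v ok))

      test-colour : ∀ j → Test (testColour j) (χ (toℕ (lookup φ j)) ℕ.≡ᵇ γ)
      test-colour j σ s hold v ok = straight refl (straight refl (weaken
          (λ τ (p , ok′) → same-trans (same-refl refl refl refl refl (λ j → refl)) p
            , trans ok′ (cong (λ b → bit (v ∧ b)) (cong₂ ℕ._≡ᵇ_ colour-eq class-eq)))
          (equal-run _ v ok)))
        where
        colour-eq : mem σ (reg σ (rTuple (toℕ j))) ≡ χ (toℕ (lookup φ j))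
        colour-eq = trans (cong (mem σ) (hold j)) (colours s _ (Finₚ.toℕ<n (lookup φ j)))
        class-eq : reg σ rClass ℕ.+ reg σ rZero ≡ γ
        class-eq = trans (cong₂ ℕ._+_ (class s) (zeroed s)) (ℕₚ.+-identityʳ γ)

      test-distinct : ∀ i j → Test (testDistinct i j) (does (i Finₚ.≟ j) ∨ not (toℕ (lookup φ i) ℕ.≡ᵇ toℕ (lookup φ j)))
      test-distinct i j with does (i Finₚ.≟ j)
      ... | true  = test-nop
      ... | false = λ σ s hold v ok → straight refl (straight refl (weaken
          (λ τ (p , ok′) → same-trans (same-refl refl refl refl refl (λ j → refl)) p
            , trans ok′ (cong (λ b → bit (v ∧ not b)) (cong₂ ℕ._≡ᵇ_ (value s hold i) (value s hold j))))
          (distinct-run _ v ok)))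
        where
        value : ∀ {σ} → Setting n h χ γ σ → Holding φ σ → ∀ i → reg σ (rTuple (toℕ i)) ℕ.+ reg σ rZero ≡ toℕ (lookup φ i)
        value s hold i = trans (cong₂ ℕ._+_ (hold i) (zeroed s)) (ℕₚ.+-identityʳ _)

      entry : Subset h → Fin h → ℕ
      entry e i = if lookup e i then toℕ (lookup φ i) else n

      entry-reg : ∀ {σ} → Setting n h χ γ σ → Holding φ σ → ∀ e i →
                  reg σ (if lookup e i then rTuple (toℕ i) else rN) ≡ entry e i
      entry-reg s hold e i with lookup e i
      ... | true  = hold i
      ... | false = vertices s

      Filled : ℕ → List ℕ → State → State → Set
      Filled a l σ τ = Same σ τ × reg τ rOk ≡ reg σ rOk × (∀ u → u ℕ.< a → mem τ u ≡ mem σ u) ×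
                       (∀ i → i ℕ.< length l → mem τ (a ℕ.+ i) ≡ colour l i)

      write-run : ∀ e x σ → Setting n h χ γ σ → Holding φ σ → n ℕ.≤ reg σ rBuf →
        Triple G (writeCell e x) σ (λ τ → Filled (reg σ rBuf) (entry e x ∷ []) σ τ × reg τ rBuf ≡ suc (reg σ rBuf))
      write-run e x σ s hold n≤ = triple (_ , refl ,
          (record { keeps = record { views = refl ; cells = λ v v<n → other v (ℕₚ.<-≤-trans (subst (v ℕ.<_) (vertices s) v<n) n≤) }
                  ; outs = refl ; founds = refl ; tuples = λ j → refl }
          , refl , other
          , λ { zero _ → trans (cong (mem σ [ reg σ rBuf ↦ _ ]) (ℕₚ.+-identityʳ _)) (trans (update-same (mem σ) (reg σ rBuf) _) (entry-reg s hold e x))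
              ; (suc i) (s≤s ()) })
          , trans (cong (reg σ rBuf ℕ.+_) (one s)) (ℕₚ.+-comm _ 1))
        where
        other : ∀ u → u ℕ.< reg σ rBuf → (mem σ [ reg σ rBuf ↦ reg σ (if lookup e x then rTuple (toℕ x) else rN) ]) u ≡ mem σ u
        other u u< = update-other (mem σ) (reg σ rBuf) _ u (ℕₚ.<⇒≢ u<)

      fill-run : ∀ e xs σ → Setting n h χ γ σ → Holding φ σ → n ℕ.≤ reg σ rBuf →
        Triple G (each (writeCell e) xs) σ (Filled (reg σ rBuf) (map (entry e) xs) σ)
      fill-run e []       σ s hold n≤ =
        triple (_ , refl , same-refl refl refl refl refl (λ j → refl) , refl , (λ u u< → refl) , λ i ())
      fill-run e (x ∷ xs) σ s hold n≤ = write-run e x σ s hold n≤ ▸ λ τ ((p , ok , low , cell) , next) →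
        weaken (λ υ (q , ok′ , low′ , cell′) → same-trans p q , trans ok′ ok
          , (λ u u< → trans (low′ u (subst (u ℕ.<_) (sym next) (ℕₚ.m<n⇒m<1+n u<))) (low u u<))
          , λ { zero i< → trans (low′ _ (subst (reg σ rBuf ℕ.+ 0 ℕ.<_) (sym next) (s≤s (ℕₚ.≤-reflexive (ℕₚ.+-identityʳ _))))) (cell 0 (s≤s z≤n))
              ; (suc i) (s≤s i<) → trans (cong (mem υ) (trans (ℕₚ.+-suc (reg σ rBuf) i) (cong (ℕ._+ i) (sym next)))) (cell′ i i<) })
          (fill-run e xs τ (setting-keeps (keeps p) s) (holding-same p hold)
            (subst (n ℕ.≤_) (sym next) (ℕₚ.m≤n⇒m≤1+n n≤)))

      -- The padding entry `n` is harmless because `listed` only asks about numbers below `n`; it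
      -- lets every query have the fixed length `h`.
      listed-entries : ∀ e → listed (map (entry e) (allFin h)) ≡ image (lookup φ) e
      listed-entries e = Vecₚ.tabulate-cong λ v → bool-≡ (to v) (from v)
        where
        hit : ∀ v i → T (toℕ v ℕ.≡ᵇ entry e i) → (lookup e i ≡ true) × lookup φ i ≡ v
        hit v i t with lookup e i
        ... | true  = refl , Finₚ.toℕ-injective (sym (ℕₚ.≡ᵇ⇒≡ _ _ t))
        ... | false = contradiction (ℕₚ.≡ᵇ⇒≡ _ _ t) (ℕₚ.<⇒≢ (Finₚ.toℕ<n v))
        to : ∀ v → T (any (toℕ v ℕ.≡ᵇ_) (map (entry e) (allFin h))) → T (does (Finₚ.any? λ i → (i ∈? e) ×-dec (lookup φ i Finₚ.≟ v)))
        to v t with Any.satisfied (Anyₚ.map⁻ (Anyₚ.any⁻ _ (map (entry e) (allFin h)) t))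
        ... | i , ti = subst T (sym (dec-true (Finₚ.any? λ i → (i ∈? e) ×-dec (lookup φ i Finₚ.≟ v))
                (i , Vecₚ.lookup⇒[]= i e (proj₁ (hit v i ti)) , proj₂ (hit v i ti)))) tt
        from : ∀ v → T (does (Finₚ.any? λ i → (i ∈? e) ×-dec (lookup φ i Finₚ.≟ v))) → T (any (toℕ v ℕ.≡ᵇ_) (map (entry e) (allFin h)))
        from v t with Finₚ.any? (λ i → (i ∈? e) ×-dec (lookup φ i Finₚ.≟ v))
        ... | yes (i , i∈e , refl) = Anyₚ.any⁺ _ (Anyₚ.map⁺ (Any.map (λ { refl → entry-hit }) (∈-allFin i)))
          where
          entry-hit : T (toℕ (lookup φ i) ℕ.≡ᵇ entry e i)
          entry-hit rewrite Vecₚ.[]=⇒lookup i∈e = ℕₚ.≡⇒≡ᵇ (toℕ (lookup φ i)) _ refl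

      test-edge : ∀ e → Test (testEdge e) (edge G (image (lookup φ) e))
      test-edge e σ s hold v ok = straight {τ = σ₁} refl
        (fill-run e (allFin h) σ₁ (setting-keeps (keeps p₁) s) (holding-same p₁ hold)
           (ℕₚ.≤-reflexive (sym start-buffer)) ▸ λ τ (p , ok′ , low , cell) →
         ask τ (same-trans p₁ p) (trans ok′ ok)
           (λ i i< → subst (λ a → mem τ (a ℕ.+ i) ≡ colour (map (entry e) (allFin h)) i) start-buffer (cell i i<)))
        where
        σ₁ : State
        σ₁ = tick 1 (set rBuf (reg σ rN ℕ.+ reg σ rZero) σ)
        p₁ : Same σ σ₁
        p₁ = same-refl refl refl refl refl (λ j → refl)
        start-buffer : reg σ rN ℕ.+ reg σ rZero ≡ n
        start-buffer = trans (cong₂ ℕ._+_ (vertices s) (zeroed s)) (ℕₚ.+-identityʳ n)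
        l = map (entry e) (allFin h)
        length-l : length l ≡ h
        length-l = trans (Listₚ.length-map (entry e) (allFin h)) (Listₚ.length-tabulate {n = h} (λ i → i))
        branch : ∀ τ → Same σ τ → reg τ rOk ≡ bit v → ∀ b → reg τ rX ≡ bit b →
          Triple G (ifZero rX ₁ const rOk 0 ₂ nop) τ (λ υ → Same σ υ × reg υ rOk ≡ bit (v ∧ b))
        branch τ p ok false x = if-zero x (triple (_ , refl , same-trans p (same-refl refl refl refl refl (λ j → refl)) , become-false v))
        branch τ p ok true  x = if-suc x (triple (_ , refl , same-trans p (same-refl refl refl refl refl (λ j → refl)) , keep-true v ok))
        ask : ∀ τ → Same σ τ → reg τ rOk ≡ bit v → (∀ i → i ℕ.< length l → mem τ (n ℕ.+ i) ≡ colour l i) →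
          Triple G (query rX rN rH ⨾ ifZero rX ₁ const rOk 0 ₂ nop) τ (λ υ → Same σ υ × reg υ rOk ≡ bit (v ∧ edge G (image (lookup φ) e)))
        ask τ p ok cell = straight refl (branch _ (same-trans p (same-refl refl refl refl refl (λ j → refl))) ok _
          (cong (λ S → bit (edge G S)) (trans (cong listed read) (listed-entries e))))
          where
          s′ = setting-keeps (keeps p) s
          read : applyUpTo (λ i → mem τ (reg τ rN ℕ.+ i)) (reg τ rH) ≡ l
          read rewrite vertices s′ | arity s′ = trans (cong (applyUpTo _) (sym length-l)) (index-applyUpTo _ l cell)

      test-all : Test (testAll es) (good χ γ φ)
      test-all = test-⨾ (test-each testColour _ test-colour (allFin h))
        (test-⨾ (test-each (λ i → each (testDistinct i) (allFin h)) _
                  (λ i → test-each (testDistinct i) _ (test-distinct i) (allFin h)) (allFin h))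
                (test-each testEdge _ test-edge es))

open HoareLogic

-- Exhaustive search for a copy in one colour class

module CopySearch where

  open Keeps
  open Same
  open Setting
  open Triple

  module Scanning {n h : ℕ} (G : Hypergraph n) (es : List (Subset h)) (act : Cmd) (w : Vec (Fin n) h → List ℕ)
    (χ : ℕ → ℕ) (γ : ℕ) where

    open Tests h
    open Search G es

    Acting : Set
    Acting = ∀ φ σ → Setting n h χ γ σ → Holding φ σ → Triple G act σ λ τ →
      Keeps σ τ × out τ ≡ out σ ++ w φ × reg τ rFound ≡ reg σ rFound × (∀ j → reg τ (rTuple j) ≡ reg σ (rTuple j))

    Found : List ℕ → State → Set
    Found o τ = Σ Tuple λ φ → good χ γ φ ≡ true × reg τ rFound ≡ 1 × out τ ≡ o ++ w φ

    Missed : List ℕ → (Tuple → Set) → State → Set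
    Missed o C τ = reg τ rFound ≡ 0 × out τ ≡ o × (∀ ψ → C ψ → good χ γ ψ ≡ false)

    module Run (acting : Acting) (σ₀ : State) (setting : Setting n h χ γ σ₀) where

      -- C collects the tuples examined so far.
      Searched : (Tuple → Set) → State → Set
      Searched C τ = Keeps σ₀ τ × (Found (out σ₀) τ ⊎ Missed (out σ₀) C τ)

      searched-mono : ∀ {C D : Tuple → Set} τ → (∀ ψ → D ψ → C ψ) → Searched C τ → Searched D τ
      searched-mono τ D⊆C (k , inj₁ found) = k , inj₁ found
      searched-mono τ D⊆C (k , inj₂ (f , o , none)) = k , inj₂ (f , o , λ ψ d → none ψ (D⊆C ψ d))

      searched-tick : ∀ {C} τ → Searched C τ → Searched C (tick 1 τ)
      searched-tick τ (k , f) = keeps-trans k (keeps-refl refl refl) , f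

      Agree : ℕ → State → Tuple → Set
      Agree m σ ψ = ∀ (j : Fin h) → m ℕ.≤ toℕ j → reg σ (rTuple (toℕ j)) ≡ toℕ (lookup ψ j)

      Bounded : ℕ → State → Set
      Bounded m σ = ∀ (j : Fin h) → m ℕ.≤ toℕ j → reg σ (rTuple (toℕ j)) ℕ.< n

      TuplesKept : ℕ → State → State → Set
      TuplesKept m σ τ = ∀ j → m ℕ.≤ j → reg τ (rTuple j) ≡ reg σ (rTuple j)

      -- At level 0 the registers determine all positions, so `Agree 0 σ` holds for the single tuple
      -- `φ₀`, and one execution adds exactly this tuple to the examined ones.
      body-run : ∀ C σ → Bounded 0 σ → Searched C σ →
        Triple G (body es act) σ λ τ → Searched (λ ψ → C ψ ⊎ Agree 0 σ ψ) τ × TuplesKept 0 σ τ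
      body-run C σ bounded (k , found) = straight {τ = σ₁} refl
        (test-all χ γ φ₀ σ₁ (setting-keeps (keeps-trans k (keeps-refl refl refl)) setting) hold true refl ▸ λ τ (p , ok) → branch τ p _ refl ok)
        where
        σ₁ : State
        σ₁ = tick 1 (set rOk 1 σ)
        φ₀ : Tuple
        φ₀ = Vec.tabulate λ j → Fin.fromℕ< (bounded j z≤n)
        hold : Holding φ₀ σ
        hold j = sym (trans (cong toℕ (Vecₚ.lookup∘tabulate _ j)) (Finₚ.toℕ-fromℕ< (bounded j z≤n)))
        agree-φ₀ : ∀ ψ → Agree 0 σ ψ → ψ ≡ φ₀
        agree-φ₀ ψ agree = trans (sym (Vecₚ.tabulate∘lookup ψ)) (trans
          (Vecₚ.tabulate-cong λ j → Finₚ.toℕ-injective (trans (sym (agree j z≤n)) (hold j)))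
          (Vecₚ.tabulate∘lookup φ₀))
        Post : State → Set
        Post υ = Searched (λ ψ → C ψ ⊎ Agree 0 σ ψ) υ × TuplesKept 0 σ υ
        transport : ∀ τ → Same σ τ → Found (out σ₀) σ ⊎ Missed (out σ₀) C σ → Found (out σ₀) τ ⊎ Missed (out σ₀) C τ
        transport τ p (inj₁ (ψ , g , f , o)) = inj₁ (ψ , g , trans (founds p) f , trans (outs p) o)
        transport τ p (inj₂ (f , o , none))  = inj₂ (trans (founds p) f , trans (outs p) o , none)
        extend : ∀ τ → good χ γ φ₀ ≡ false → Found (out σ₀) τ ⊎ Missed (out σ₀) C τ →
                 Found (out σ₀) τ ⊎ Missed (out σ₀) (λ ψ → C ψ ⊎ Agree 0 σ ψ) τ
        extend τ bad (inj₁ f) = inj₁ f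
        extend τ bad (inj₂ (f , o , none)) = inj₂ (f , o , λ
          { ψ (inj₁ c) → none ψ c
          ; ψ (inj₂ agree) → subst (λ ψ → good χ γ ψ ≡ false) (sym (agree-φ₀ ψ agree)) bad })
        first : ∀ τ → Same σ τ → good χ γ φ₀ ≡ true → Found (out σ₀) τ ⊎ Missed (out σ₀) C τ →
          Triple G (ifZero rFound ₁ (const rFound 1 ⨾ act) ₂ nop) τ Post
        first τ p g (inj₁ (ψ , g′ , f , o)) = if-suc f (triple (_ , refl ,
          (keeps-trans k (keeps-trans (keeps p) (keeps-refl refl refl)) , inj₁ (ψ , g′ , f , o)) , λ j _ → tuples p j))
        first τ p g (inj₂ (f , o , none)) = if-zero f (straight {τ = σ₂} refl
          (weaken (λ υ (k′ , o′ , f′ , t′) →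
              (keeps-trans kσ₂ k′ , inj₁ (φ₀ , g , f′ , trans o′ (cong (_++ w φ₀) o))) , λ j _ → trans (t′ j) (tuples p j))
            (acting φ₀ σ₂ (setting-keeps kσ₂ setting) λ j → trans (tuples p (toℕ j)) (hold j))))
          where
          σ₂ : State
          σ₂ = tick 1 (set rFound 1 (tick 1 τ))
          kσ₂ : Keeps σ₀ σ₂
          kσ₂ = keeps-trans k (keeps-trans (keeps p) (keeps-refl refl refl))
        branch : ∀ τ → Same σ₁ τ → ∀ b → good χ γ φ₀ ≡ b → reg τ rOk ≡ bit b →
          Triple G (ifZero rOk ₁ nop ₂ (ifZero rFound ₁ (const rFound 1 ⨾ act) ₂ nop)) τ Post
        branch τ p₁ b eq ok = go b eq ok
          where
          p : Same σ τ
          p = same-trans (same-refl refl refl refl refl (λ j → refl)) p₁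
          go : ∀ b → good χ γ φ₀ ≡ b → reg τ rOk ≡ bit b →
            Triple G (ifZero rOk ₁ nop ₂ (ifZero rFound ₁ (const rFound 1 ⨾ act) ₂ nop)) τ Post
          go false eq ok = if-zero ok (triple (_ , refl ,
            (keeps-trans k (keeps-trans (keeps p) (keeps-refl refl refl)) , extend τ eq (transport τ p found)) , λ j _ → tuples p j))
          go true eq ok = if-suc ok (first (tick 1 τ) (same-trans p (same-refl refl refl refl refl (λ j → refl))) eq
            (transport τ p found))

      -- The enclosing loops have fixed the positions from `m` on, and the loops inside enumerate
      -- those below `m`. The invariant of the loop over position `m` adds the tuples whose entry
      -- there is below the counter.
      nest-run : ∀ m → m ℕ.≤ h → ∀ C σ → Bounded m σ → Searched C σ →
        Triple G (nest m (body es act)) σ λ τ → Searched (λ ψ → C ψ ⊎ Agree m σ ψ) τ × TuplesKept m σ τ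
      nest-run zero    m≤h C σ bounded searched = body-run C σ bounded searched
      nest-run (suc m) m<h C σ bounded searched = straight {τ = σ₁} refl (weaken finish
        (looping Invariant n vertices₁ (searched-tick σ₁ (searched-mono σ₁ (λ { ψ (inj₁ c) → c ; ψ (inj₂ ()) }) (keep₁ searched)) ,
          (update-same (reg σ) (rTuple m) 0 , kept₁)) step))
        where
        σ₁ : State
        σ₁ = tick 1 (set (rTuple m) 0 σ)
        keep₁ : Searched C σ → Searched C σ₁
        keep₁ (k , f) = keeps-trans k (keeps-refl refl refl) , f
        vertices₁ : reg σ₁ rN ≡ n
        vertices₁ = vertices (setting-keeps (proj₁ searched) setting)
        kept-update : ∀ υ x j → suc m ℕ.≤ j → (reg υ [ rTuple m ↦ x ]) (rTuple j) ≡ reg υ (rTuple j)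
        kept-update υ x j m<j = update-other (reg υ) (rTuple m) x (rTuple j)
          λ eq → ℕₚ.<⇒≢ m<j (sym (ℕₚ.+-cancelˡ-≡ 32 j m eq))
        kept₁ : TuplesKept (suc m) σ σ₁
        kept₁ = kept-update σ 0
        m′ : Fin h
        m′ = Fin.fromℕ< m<h
        toℕ-m′ : toℕ m′ ≡ m
        toℕ-m′ = Finₚ.toℕ-fromℕ< m<h
        Up-to : ℕ → Tuple → Set
        Up-to i ψ = C ψ ⊎ (Agree (suc m) σ ψ × toℕ (lookup ψ m′) ℕ.< i)
        Invariant : ℕ → State → Set
        Invariant i τ = Searched (λ ψ → C ψ ⊎ (Agree (suc m) σ ψ × toℕ (lookup ψ m′) ℕ.< i)) τ ×
          (reg τ (rTuple m) ≡ i × TuplesKept (suc m) σ τ)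
        finish : ∀ τ → Invariant n τ → Searched (λ ψ → C ψ ⊎ Agree (suc m) σ ψ) τ × TuplesKept (suc m) σ τ
        finish τ (s , _ , kept) = searched-mono τ (λ
          { ψ (inj₁ c) → inj₁ c ; ψ (inj₂ agree) → inj₂ (agree , Finₚ.toℕ<n (lookup ψ m′)) }) s , kept
        step : ∀ i τ → i ℕ.< n → Invariant i τ →
          Triple G (nest m (body es act) ⨾ add (rTuple m) (rTuple m) rOne) (tick 1 τ) (Invariant (suc i))
        step i τ i<n (s , at-m , kept) =
          nest-run m (ℕₚ.<⇒≤ m<h) (Up-to i) (tick 1 τ) bounded′ (searched-tick τ s) ▸
          λ υ (s′ , kept′) → triple (_ , refl
            , searched-mono _ (λ { ψ (inj₁ c) → inj₁ (inj₁ c) ; ψ (inj₂ (agree , j<)) → next ψ agree j< })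
                (keeps-trans (proj₁ s′) (keeps-refl refl refl) , proj₂ s′)
            , (trans (update-same (reg υ) (rTuple m) _) (trans (cong₂ ℕ._+_ (trans (kept′ m ℕₚ.≤-refl) at-m)
                  (one (setting-keeps (proj₁ s′) setting))) (ℕₚ.+-comm i 1))
              , λ j m<j → trans (kept-update υ _ j m<j) (trans (kept′ j (ℕₚ.<⇒≤ m<j)) (kept j m<j))))
          where
          value : ∀ j (P : ℕ → Set) → m ℕ.≤ j → (suc m ℕ.≤ j → P (reg σ (rTuple j))) → (m ≡ j → P i) → P (reg τ (rTuple j))
          value j P m≤j above exact with ℕₚ.m≤n⇒m<n∨m≡n m≤j
          ... | inj₁ m<j  = subst P (sym (kept j m<j)) (above m<j)
          ... | inj₂ refl = subst P (sym at-m) (exact refl)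
          bounded′ : Bounded m (tick 1 τ)
          bounded′ j m≤j = value (toℕ j) (ℕ._< n) m≤j (bounded j) (λ _ → i<n)
          next : ∀ ψ → Agree (suc m) σ ψ → toℕ (lookup ψ m′) ℕ.< suc i → Up-to i ψ ⊎ Agree m (tick 1 τ) ψ
          next ψ agree (s≤s j≤i) with ℕₚ.m≤n⇒m<n∨m≡n j≤i
          ... | inj₁ j<i = inj₁ (inj₂ (agree , j<i))
          ... | inj₂ j≡i = inj₂ λ j m≤j → value (toℕ j) (_≡ toℕ (lookup ψ j)) m≤j (agree j)
                  (λ m≡j → trans (sym j≡i) (cong (λ j → toℕ (lookup ψ j)) (Finₚ.toℕ-injective (trans toℕ-m′ m≡j))))

    -- At m = h the relation `Agree` constrains no position, so a miss rules out every tuple.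
    scan-run : Acting → ∀ σ → Setting n h χ γ σ → Triple G (scan es act) σ λ τ →
      Keeps σ τ × (Found (out σ) τ ⊎ Missed (out σ) (λ _ → ⊤) τ)
    scan-run acting σ setting = straight {τ = σ₁} refl (weaken
        (λ τ ((k , r) , _) → keeps-trans (keeps-refl refl refl) k , [ inj₁ , (λ { (f , o , none) → inj₂ (f , o , λ ψ _ →
            none ψ (inj₂ λ j h≤j → contradiction (Finₚ.toℕ<n j) (ℕₚ.≤⇒≯ h≤j))) }) ]′ r)
        (nest-run h ℕₚ.≤-refl (λ _ → ⊥) σ₁ (λ j h≤j → contradiction (Finₚ.toℕ<n j) (ℕₚ.≤⇒≯ h≤j))
          (keeps-refl refl refl , inj₂ (refl , refl , λ ψ ()))))
      where
      σ₁ : State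
      σ₁ = tick 1 (set rFound 0 σ)
      open Run acting σ₁ (setting-keeps (keeps-refl refl refl) setting)

open CopySearch

-- Copies of H as injective tuples of vertices

module Copies where

  T⇒≡ : ∀ {b} → T b → b ≡ true
  T⇒≡ {true} _ = refl

  ≡⇒T : ∀ {b} → b ≡ true → T b
  ≡⇒T refl = tt

  ∧-true : ∀ a {b} → a ∧ b ≡ true → a ≡ true × b ≡ true
  ∧-true true eq = refl , eq

  all-true⁻ : ∀ {A : Set} (p : A → Bool) {xs} → all p xs ≡ true → ∀ {x} → x ∈ xs → p x ≡ true
  all-true⁻ p {xs} eq x∈ = T⇒≡ (All.lookup (Allₚ.all⁺ p xs (≡⇒T eq)) x∈)

  all-true⁺ : ∀ {A : Set} (p : A → Bool) xs → (∀ x → x ∈ xs → p x ≡ true) → all p xs ≡ true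
  all-true⁺ p xs h = T⇒≡ (Allₚ.all⁻ p (All.tabulate λ x∈ → ≡⇒T (h _ x∈)))

  any-true⁺ : ∀ {A : Set} (p : A → Bool) {xs x} → x ∈ xs → p x ≡ true → any p xs ≡ true
  any-true⁺ p x∈ eq = T⇒≡ (Anyₚ.any⁺ p (Any.map (λ { refl → ≡⇒T eq }) x∈))

  any-true⁻ : ∀ {A : Set} (p : A → Bool) xs → any p xs ≡ true → ∃ λ x → x ∈ xs × p x ≡ true
  any-true⁻ p xs eq = find (Any.map T⇒≡ (Anyₚ.any⁻ p xs (≡⇒T eq)))

  ∈-subsets : ∀ {n} (e : Subset n) → e ∈ subsets n
  ∈-subsets Vec.[]           = here refl
  ∈-subsets (false Vec.∷ e) = ∈-++⁺ˡ (∈-map⁺ _ (∈-subsets e))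
  ∈-subsets (true  Vec.∷ e) = ∈-++⁺ʳ _ (∈-map⁺ _ (∈-subsets e))

  ∈-family⁺ : ∀ {n} (p : Subset n → Bool) {e} → p e ≡ true → e ∈ family p
  ∈-family⁺ p eq = ∈-filter⁺ (T? ∘ p) (∈-subsets _) (≡⇒T eq)

  ∈-family⁻ : ∀ {n} (p : Subset n → Bool) {e} → e ∈ family p → p e ≡ true
  ∈-family⁻ p e∈ = T⇒≡ (proj₂ (∈-filter⁻ (T? ∘ p) {xs = subsets _} e∈))

  ∈-image⁺ : ∀ {h n} (f : Fin h → Fin n) {e i} → i ∈ˢ e → f i ∈ˢ image f e
  ∈-image⁺ f {e} {i} i∈e = Vecₚ.lookup⇒[]= (f i) (image f e)
    (trans (Vecₚ.lookup∘tabulate _ (f i)) (dec-true (Finₚ.any? λ j → (j ∈? e) ×-dec (f j Finₚ.≟ f i)) (i , i∈e , refl)))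

  ∈-image⁻ : ∀ {h n} (f : Fin h → Fin n) {e v} → v ∈ˢ image f e → ∃ λ i → i ∈ˢ e × f i ≡ v
  ∈-image⁻ f {e} {v} v∈ with Finₚ.any? (λ j → (j ∈? e) ×-dec (f j Finₚ.≟ v))
                           | trans (sym (Vecₚ.lookup∘tabulate (λ v → does (Finₚ.any? λ j → (j ∈? e) ×-dec (f j Finₚ.≟ v))) v)) (Vecₚ.[]=⇒lookup v∈)
  ... | yes found | _  = found
  ... | no _      | ()

  image-cong : ∀ {h n} {f g : Fin h → Fin n} → (∀ i → f i ≡ g i) → ∀ e → image f e ≡ image g e
  image-cong {f = f} {g} f≡g e = ⊆-antisym (incl f g f≡g) (incl g f λ i → sym (f≡g i))
    where
    incl : ∀ f g → (∀ i → f i ≡ g i) → image f e ⊆ image g e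
    incl f g f≡g v∈ with ∈-image⁻ f v∈
    ... | i , i∈e , refl = subst (_∈ˢ image g e) (sym (f≡g i)) (∈-image⁺ g i∈e)

  image-injective : ∀ {h n} (f : Fin h → Fin n) → Injective _≡_ _≡_ f → ∀ {e e′} → image f e ≡ image f e′ → e ≡ e′
  image-injective f inj eq = ⊆-antisym (incl eq) (incl (sym eq))
    where
    incl : ∀ {e e′} → image f e ≡ image f e′ → e ⊆ e′
    incl {e′ = e′} eq i∈e with ∈-image⁻ f (subst (f _ ∈ˢ_) eq (∈-image⁺ f i∈e))
    ... | j , j∈e′ , fj≡fi = subst (_∈ˢ e′) (inj fj≡fi) j∈e′

  tuples : ∀ n h → List (Vec (Fin n) h)
  tuples n zero    = Vec.[] ∷ []
  tuples n (suc h) = concatMap (λ v → map (v Vec.∷_) (tuples n h)) (allFin n)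

  ∈-tuples : ∀ {n h} (t : Vec (Fin n) h) → t ∈ tuples n h
  ∈-tuples Vec.[]       = here refl
  ∈-tuples (v Vec.∷ t) = ∈-concatMap⁺ _ (Any.map (λ { refl → ∈-map⁺ _ (∈-tuples t) }) (∈-allFin v))

  module Classes {n h : ℕ} (G : Hypergraph n) (es : List (Subset h)) where

    open Search G es

    record Good (χ : ℕ → ℕ) (γ : ℕ) (f : Fin h → Fin n) : Set where
      field
        coloured : ∀ i → χ (toℕ (f i)) ≡ γ
        distinct : Injective _≡_ _≡_ f
        present  : ∀ {e} → e ∈ es → edge G (image f e) ≡ true

    good⁻ : ∀ {χ γ} t → good χ γ t ≡ true → Good χ γ (lookup t)
    good⁻ {χ} {γ} t eq with ∧-true (all _ (allFin h)) eq
    ... | cs , rest with ∧-true (all _ (allFin h)) rest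
    ... | ds , ps = record
      { coloured = λ i → ≡ᵇ⇒≡ _ γ (all-true⁻ _ cs (∈-allFin i))
      ; distinct = λ {i} {j} → dist i j
      ; present  = all-true⁻ _ ps }
      where
      dist : ∀ i j → lookup t i ≡ lookup t j → i ≡ j
      dist i j same with i Finₚ.≟ j | all-true⁻ _ (all-true⁻ _ ds (∈-allFin i)) (∈-allFin j)
      ... | yes i≡j | _  = i≡j
      ... | no _    | ne rewrite same | ≡ᵇ-refl (toℕ (lookup t j)) = contradiction ne λ ()

    good⁺ : ∀ {χ γ} t → Good χ γ (lookup t) → good χ γ t ≡ true
    good⁺ {χ} {γ} t g = cong₂ _∧_ (all-true⁺ _ (allFin h) λ i _ → trans (cong (ℕ._≡ᵇ γ) (coloured i)) (≡ᵇ-refl γ))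
      (cong₂ _∧_ (all-true⁺ _ (allFin h) λ i _ → all-true⁺ _ (allFin h) λ j _ → dist i j)
                 (all-true⁺ _ es λ e e∈ → present e∈))
      where
      open Good g
      dist : ∀ i j → does (i Finₚ.≟ j) ∨ not (toℕ (lookup t i) ℕ.≡ᵇ toℕ (lookup t j)) ≡ true
      dist i j with i Finₚ.≟ j
      ... | yes _  = refl
      ... | no i≢j with toℕ (lookup t i) ℕ.≡ᵇ toℕ (lookup t j) in eq
      ...   | false = refl
      ...   | true  = contradiction (distinct (Finₚ.toℕ-injective (≡ᵇ⇒≡ _ _ eq))) i≢j

    has : (ℕ → ℕ) → ℕ → Bool
    has χ γ = any (good χ γ) (tuples n h)

    has⁺ : ∀ {χ γ} t → good χ γ t ≡ true → has χ γ ≡ true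
    has⁺ t = any-true⁺ _ (∈-tuples t)

    has⁻ : ∀ {χ γ} → has χ γ ≡ true → ∃ λ t → good χ γ t ≡ true
    has⁻ {χ} {γ} eq = let t , _ , g = any-true⁻ (good χ γ) (tuples n h) eq in t , g

    has-false : ∀ {χ γ} → (∀ t → good χ γ t ≡ false) → has χ γ ≡ false
    has-false {χ} {γ} none with has χ γ in eq
    ... | false = refl
    ... | true  = let t , g = has⁻ {χ} {γ} eq in contradiction (trans (sym g) (none t)) λ ()

  module _ {h n : ℕ} {H : Hypergraph h} {G : Hypergraph n} where

    onto-⊆ : ∀ (A : Copy H G) {v} → v ∈ˢ verts (proj₁ A) → ∃ λ i → φ (proj₂ A) i ≡ v
    onto-⊆ A v∈ = let i , _ , eq = ∈-image⁻ (φ (proj₂ A)) (subst (_ ∈ˢ_) (sym (onto (proj₂ A))) v∈) in i , eq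

    φ-∈ : ∀ (A : Copy H G) i → φ (proj₂ A) i ∈ˢ verts (proj₁ A)
    φ-∈ A i = subst (φ (proj₂ A) i ∈ˢ_) (onto (proj₂ A)) (∈-image⁺ (φ (proj₂ A)) ∈⊤)

    copy-edges : ∀ (A : Copy H G) {e} → edge H e ≡ true → edge G (image (φ (proj₂ A)) e) ≡ true
    copy-edges (S , A) {e} He = proj₂ (edges⊆ S (image (φ A) e) (trans (edges-iso A e) He))

    module _ (f : Fin h → Fin n) (inj : Injective _≡_ _≡_ f)
      (present : ∀ {e} → e ∈ family (edge H) → edge G (image f e) ≡ true) where

      private
        isImage : Subset n → Subset h → Bool
        isImage g e = does (Vecₚ.≡-dec Boolₚ._≟_ g (image f e))

        isImage⁻ : ∀ {g e} → isImage g e ≡ true → g ≡ image f e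
        isImage⁻ {g} {e} eq with Vecₚ.≡-dec Boolₚ._≟_ g (image f e)
        ... | yes g≡ = g≡

      -- Not the induced subgraph: its hyperedges are exactly the images of those of `H`, as
      -- `edges-iso` demands, while `G` may have more on the same vertices.
      embedding : Copy H G
      embedding = record { verts = image f full ; edges = λ g → any (isImage g) (family (edge H)) ; edges⊆ = within }
                , record { φ = f ; injective = inj ; onto = refl ; edges-iso = iso }
        where
        within : ∀ g → any (isImage g) (family (edge H)) ≡ true → g ⊆ image f full × edge G g ≡ true
        within g eq with any-true⁻ (isImage g) (family (edge H)) eq
        ... | e , e∈ , is with isImage⁻ {g} {e} is
        ... | refl = (λ v∈ → let i , _ , fi≡v = ∈-image⁻ f v∈ in subst (_∈ˢ image f full) fi≡v (∈-image⁺ f ∈⊤)) , present e∈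
        iso : ∀ e → any (isImage (image f e)) (family (edge H)) ≡ edge H e
        iso e = bool-≡ to λ He → ≡⇒T (any-true⁺ _ (∈-family⁺ (edge H) (T⇒≡ He)) (dec-true (Vecₚ.≡-dec Boolₚ._≟_ (image f e) (image f e)) refl))
          where
          to : T (any (isImage (image f e)) (family (edge H))) → T (edge H e)
          to t with any-true⁻ (isImage (image f e)) (family (edge H)) (T⇒≡ t)
          ... | e′ , e′∈ , is rewrite image-injective f inj (isImage⁻ {image f e} {e′} is) = ≡⇒T (∈-family⁻ (edge H) e′∈)

      embedding-verts : ∀ {v} → v ∈ˢ verts (proj₁ embedding) → ∃ λ i → f i ≡ v
      embedding-verts v∈ = let i , _ , eq = ∈-image⁻ f v∈ in i , eq

    Coloured : (ℕ → ℕ) → ℕ → Copy H G → Set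
    Coloured χ γ A = ∀ {v} → v ∈ˢ verts (proj₁ A) → χ (toℕ v) ≡ γ

    coloured-disjoint : ∀ {χ γ δ} (A B : Copy H G) → γ ≢ δ → Coloured χ γ A → Coloured χ δ B → Disjoint A B
    coloured-disjoint A B γ≢δ cA cB (v , v∈) =
      let v∈A , v∈B = x∈p∩q⁻ _ _ v∈ in γ≢δ (trans (sym (cA v∈A)) (cB v∈B))

    copy-good : ∀ {es χ γ} (A : Copy H G) → (∀ {e} → e ∈ es → edge H e ≡ true) → Coloured χ γ A →
                Classes.has G es χ γ ≡ true
    copy-good {es} {χ} {γ} A es⊆ cA = has⁺ {χ} {γ} (Vec.tabulate (φ (proj₂ A))) (good⁺ {χ} {γ} (Vec.tabulate (φ (proj₂ A))) record
      { coloured = λ i → cA (subst (_∈ˢ verts (proj₁ A)) (sym (at i)) (φ-∈ A i))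
      ; distinct = λ {i} {j} eq → injective (proj₂ A) (trans (sym (at i)) (trans eq (at j)))
      ; present  = λ {e} e∈ → trans (cong (edge G) (image-cong at e)) (copy-edges A (es⊆ e∈)) })
      where
      open Classes G es
      at : ∀ i → lookup (Vec.tabulate (φ (proj₂ A))) i ≡ φ (proj₂ A) i
      at = Vecₚ.lookup∘tabulate (φ (proj₂ A))

open Copies

-- The decoder and the packing that it writes

module DecoderRun where

  open Keeps
  open Same
  open Setting
  open Triple

  emitTuple : ℕ → Cmd
  emitTuple h = each (λ (j : Fin h) → emit (rTuple (toℕ j))) (allFin h)

  -- The decoder does not receive k, so it goes through the classes 0, ..., n - 1. They include the
  -- classes below k, since a packing of k copies with h ≥ 1 needs k ≤ n.
  decoderProgram : ∀ {h} → Hypergraph h → Cmd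
  decoderProgram {h} H = const rOne 1 ⨾ const rH h ⨾
    loop rN (Tests.scan h (family (edge H)) (emitTuple h) ⨾ add rClass rClass rOne)

  start-mem : ∀ a b xs v → mem (start a b xs) v ≡ colour xs v
  start-mem a b []       v       = refl
  start-mem a b (x ∷ xs) zero    = refl
  start-mem a b (x ∷ xs) (suc v) = start-mem a b xs v

  tally-snoc : ∀ has m γ → tally has (suc m) γ ≡ tally has m γ ℕ.+ bit (has (γ ℕ.+ m))
  tally-snoc has zero    γ rewrite ℕₚ.+-identityʳ γ = ℕₚ.+-identityʳ _
  tally-snoc has (suc m) γ = trans (cong (bit (has γ) ℕ.+_) (trans (tally-snoc has m (suc γ))
    (cong (λ z → tally has m (suc γ) ℕ.+ bit (has z)) (sym (ℕₚ.+-suc γ m))))) (sym (ℕₚ.+-assoc (bit (has γ)) _ _))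

  module Decoding {h n : ℕ} (H : Hypergraph h) (G : Hypergraph n) (χ : ℕ → ℕ) where

    es : List (Subset h)
    es = family (edge H)

    open Tests h
    open Search G es
    open Classes G es

    word : Vec (Fin n) h → List ℕ
    word t = map (λ j → toℕ (lookup t j)) (allFin h)

    acting : ∀ γ → Scanning.Acting G es (emitTuple h) word χ γ
    acting γ t σ s hold = weaken (λ τ (k , o , f , t′) → k , o , f , t′) (go (allFin h) σ hold)
      where
      go : ∀ xs σ → Holding t σ → Triple G (each (λ (j : Fin h) → emit (rTuple (toℕ j))) xs) σ λ τ →
        Keeps σ τ × out τ ≡ out σ ++ map (λ j → toℕ (lookup t j)) xs × reg τ rFound ≡ reg σ rFound ×
        (∀ j → reg τ (rTuple j) ≡ reg σ (rTuple j))
      go []       σ hold = triple (_ , refl , keeps-refl refl refl , sym (Listₚ.++-identityʳ (out σ)) , refl , λ j → refl)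
      go (x ∷ xs) σ hold = straight {τ = σ₁} refl (weaken
        (λ τ (k , o , f , t′) → keeps-trans (keeps-refl refl refl) k
          , trans o (trans (Listₚ.++-assoc (out σ) _ _) (cong (λ z → out σ ++ z ∷ map (λ j → toℕ (lookup t j)) xs) (hold x)))
          , f , t′)
        (go xs σ₁ hold))
        where
        σ₁ : State
        σ₁ = tick 1 (record σ { out = out σ ++ reg σ (rTuple (toℕ x)) ∷ [] })

    -- Remembers that a collected copy lies in an earlier class, which makes it disjoint from the
    -- copy found next.
    Below : ℕ → Copy H G → Set
    Below γ A = Σ ℕ λ δ → δ ℕ.< γ × Coloured χ δ A

    record Collected (γ : ℕ) (τ : State) : Set where
      field
        setting  : Setting n h χ γ τ
        copies   : List (Copy H G)
        disjoint : AllPairs Disjoint copies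
        below    : All (Below γ) copies
        written  : out τ ≡ concatMap (λ A → tabulate (toℕ ∘ φ (proj₂ A))) copies
        number   : length copies ≡ tally (has χ) γ 0

    copyOf : ∀ {γ} t → good χ γ t ≡ true → Copy H G
    copyOf {γ} t g = embedding (lookup t) distinct present
      where open Good (good⁻ {χ} {γ} t g)

    copyOf-coloured : ∀ {γ} t (g : good χ γ t ≡ true) → Coloured χ γ (copyOf {γ} t g)
    copyOf-coloured {γ} t g v∈ with embedding-verts {H = H} {G = G} (lookup t) distinct present v∈
      where open Good (good⁻ {χ} {γ} t g)
    ... | i , refl = Good.coloured (good⁻ {χ} {γ} t g) i

    open Collected

    class-step : ∀ γ σ → Collected γ σ →
      Triple G (scan es (emitTuple h) ⨾ add rClass rClass rOne) σ (Collected (suc γ))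
    class-step γ σ c = Scanning.scan-run G es (emitTuple h) word χ γ (acting γ) σ (setting c) ▸ λ τ (k , r) →
      triple (_ , refl , collect τ k r)
      where
      advance : ∀ {τ} → Keeps σ τ → Setting n h χ (suc γ) (tick 1 (set rClass (reg τ rClass ℕ.+ reg τ rOne) τ))
      advance k = record { vertices = vertices s ; arity = arity s ; one = one s ; zeroed = zeroed s
                         ; class = trans (cong₂ ℕ._+_ (class s) (one s)) (ℕₚ.+-comm γ 1) ; colours = colours s }
        where s = setting-keeps k (setting c)
      below-suc : ∀ {A} → Below γ A → Below (suc γ) A
      below-suc (δ , δ<γ , cA) = δ , ℕₚ.m<n⇒m<1+n δ<γ , cA
      collect : ∀ τ → Keeps σ τ →
        Scanning.Found G es (emitTuple h) word χ γ (out σ) τ ⊎ Scanning.Missed G es (emitTuple h) word χ γ (out σ) (λ _ → ⊤) τ →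
        Collected (suc γ) (tick 1 (set rClass (reg τ rClass ℕ.+ reg τ rOne) τ))
      collect τ k (inj₁ (t , g , _ , o)) = record
        { setting  = advance k
        ; copies   = copies c ++ A ∷ []
        ; disjoint = AllPairsₚ.++⁺ (disjoint c) ([] ∷ []) (All.map (λ { {B} (δ , δ<γ , cB) →
                       coloured-disjoint {χ = χ} B A (ℕₚ.<⇒≢ δ<γ) cB (copyOf-coloured {γ} t g) ∷ [] }) (below c))
        ; below    = Allₚ.++⁺ (All.map (λ {B} → below-suc {B}) (below c)) ((γ , ℕₚ.≤-refl , copyOf-coloured {γ} t g) ∷ [])
        ; written  = trans o (trans (cong₂ _++_ (written c) word-A) (sym (Listₚ.concatMap-++ _ (copies c) (A ∷ []))))
        ; number   = trans (Listₚ.length-++ (copies c)) (trans (cong₂ ℕ._+_ (number c) (cong bit (sym (has⁺ {χ} {γ} t g))))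
                       (sym (tally-snoc (has χ) γ 0))) }
        where
        A = copyOf {γ} t g
        word-A : word t ≡ tabulate (toℕ ∘ lookup t) ++ []
        word-A = trans (Listₚ.map-tabulate (λ j → j) (λ j → toℕ (lookup t j))) (sym (Listₚ.++-identityʳ _))
      collect τ k (inj₂ (_ , o , none)) = record
        { setting  = advance k
        ; copies   = copies c
        ; disjoint = disjoint c
        ; below    = All.map (λ {B} → below-suc {B}) (below c)
        ; written  = trans o (written c)
        ; number   = trans (number c) (trans (sym (ℕₚ.+-identityʳ _)) (trans
                       (cong (λ b → tally (has χ) γ 0 ℕ.+ bit b) (sym (has-false {χ} {γ} λ t → none t tt)))
                       (sym (tally-snoc (has χ) γ 0)))) }

  module _ {h n : ℕ} (H : Hypergraph h) (G : Hypergraph n) (C : Rep) where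

    open Decoding H G (colour C)
    open Classes G (family (edge H))
    open Collected

    private
      Outcome : State → Set
      Outcome τ = Σ (Packing H G) λ S → out τ ≡ encoding S × val S ≡ tally (has (colour C)) n 0

    decoder-run : Triple G (decoderProgram H) (start n (length C) C) Outcome
    decoder-run = straight {τ = σ₁} refl (straight {τ = σ₂} refl (weaken
      (λ τ c → (copies c , disjoint c) , written c , number c)
      (looping Collected n refl collected₂ λ i τ _ c → class-step i (tick 1 τ) (ticked c))))
      where
      σ₁ σ₂ : State
      σ₁ = tick 1 (set rOne 1 (start n (length C) C))
      σ₂ = tick 1 (set rH h σ₁)
      ticked : ∀ {γ τ} → Collected γ τ → Collected γ (tick 1 τ)
      ticked c = record { setting = setting-keeps (keeps-refl refl refl) (setting c) ; copies = copies c ; disjoint = disjoint c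
                        ; below = below c ; written = written c ; number = number c }
      collected₂ : Collected 0 (tick 1 σ₂)
      collected₂ = record
        { setting  = record { vertices = refl ; arity = refl ; one = refl ; zeroed = refl ; class = refl
                            ; colours = λ v _ → start-mem n (length C) C v }
        ; copies   = [] ; disjoint = [] ; below = [] ; written = refl ; number = refl }

  -- Used in two ways: it counts the vertices covered by a packing, and for h ≥ 1 it recovers the
  -- number of copies from the written output.
  length-encoding : ∀ {h n} {H : Hypergraph h} {G : Hypergraph n} (S : List (Copy H G)) →
    length (concatMap (λ A → tabulate (toℕ ∘ φ (proj₂ A))) S) ≡ length S ℕ.* h
  length-encoding []      = refl
  length-encoding (A ∷ S) = trans (Listₚ.length-++ (tabulate (toℕ ∘ φ (proj₂ A))))
    (cong₂ ℕ._+_ (Listₚ.length-tabulate (toℕ ∘ φ (proj₂ A))) (length-encoding S))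

  -- The value is required for every proof `q`, so it does not matter which packing the validity
  -- proof supplies for an output.
  𝔼-attach : ∀ {A : Set} {P : A → Set} {f : Σ A P → ℚ} {c} (r : Rand A) (p : Always P r) →
             Always (λ a → ∀ q → f (a , q) ≡ c) r → 𝔼 f (attach r p) ≡ c
  𝔼-attach (ret a)    p       e       = e p
  𝔼-attach {f = f} {c} (toss l r) (p , q) (d , e) rewrite 𝔼-attach {f = f} l p d | 𝔼-attach {f = f} r q e =
    solve 1 (λ c → con ½ :* (c :+ c) := c) refl c

open DecoderRun

-- The encoder program as a simulation of the sampling experiment

module EncoderRun where

  open Keeps
  open Same
  open Setting
  open Triple

  -- A coupling that uses the same coins on both sides: the trees have equal shape and related
  -- leaves. Expectations of related observables then agree without any computation of
  -- probabilities.
  data Rel {A B : Set} (R : A → B → Set) : Rand A → Rand B → Set where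
    ret  : ∀ {a b} → R a b → Rel R (ret a) (ret b)
    toss : ∀ {l l′ r r′} → Rel R l l′ → Rel R r r′ → Rel R (toss l r) (toss l′ r′)

  Rel-bind : ∀ {A A′ B B′ : Set} {R : A → A′ → Set} {Q : B → B′ → Set} {r x f g} →
             Rel R r x → (∀ a b → R a b → Rel Q (f a) (g b)) → Rel Q (r >>= f) (x >>= g)
  Rel-bind (ret p)    k = k _ _ p
  Rel-bind (toss p q) k = toss (Rel-bind p k) (Rel-bind q k)

  Rel-det : ∀ {B : Set} {R Q : State → B → Set} {r x} {f : State → Rand State} →
            Rel R r x → (∀ τ b → R τ b → Det (λ υ → Q υ b) (f τ)) → Rel Q (r >>= f) x
  Rel-det {Q = Q} {f = f} (ret {b = b} p) k with k _ b p
  ... | υ , eq , q = subst (λ r → Rel Q r (ret b)) (sym eq) (ret q)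
  Rel-det (toss p q) k = toss (Rel-det p k) (Rel-det q k)

  Rel-map : ∀ {A B B′ : Set} {R : A → B → Set} {Q : A → B′ → Set} {g : B → B′} {r x} →
            (∀ a b → R a b → Q a (g b)) → Rel R r x → Rel Q r (mapR g x)
  Rel-map f (ret p)    = ret (f _ _ p)
  Rel-map f (toss p q) = toss (Rel-map f p) (Rel-map f q)

  Rel-weaken : ∀ {A B : Set} {R Q : A → B → Set} {r x} → (∀ a b → R a b → Q a b) → Rel R r x → Rel Q r x
  Rel-weaken f (ret p)    = ret (f _ _ p)
  Rel-weaken f (toss p q) = toss (Rel-weaken f p) (Rel-weaken f q)

  Rel-assoc : ∀ {A B C D : Set} {Q : C → D → Set} (r : Rand A) {f : A → Rand B} {g : B → Rand C} {x} →
              Rel Q (r >>= λ a → f a >>= g) x → Rel Q ((r >>= f) >>= g) x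
  Rel-assoc (ret a)    p          = p
  Rel-assoc (toss l r) (toss p q) = toss (Rel-assoc l p) (Rel-assoc r q)

  Rel-𝔼 : ∀ {A B : Set} {f : A → ℚ} {g : B → ℚ} {r x} → Rel (λ a b → f a ≡ g b) r x → 𝔼 f r ≡ 𝔼 g x
  Rel-𝔼 (ret p)    = p
  Rel-𝔼 (toss p q) = cong₂ (λ x y → ½ * (x + y)) (Rel-𝔼 p) (Rel-𝔼 q)

  record Sim {n} {B : Set} (G : Hypergraph n) (c : Cmd) (σ : State) (R : State → B → Set) (x : Rand B) : Set where
    constructor sim
    field
      rel : Rel R (run G c σ) x

  open Sim

  Det-Rel : ∀ {B : Set} {P : State → Set} {R : State → B → Set} {r f x} →
            Det P r → (∀ τ → P τ → Rel R (f τ) x) → Rel R (r >>= f) x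
  Det-Rel (τ , refl , p) k = k τ p

  module _ {n} {G : Hypergraph n} where

    infixl 1 _▸ˢ_ _▸ᵗ_

    _▸ˢ_ : ∀ {B C : Set} {c d σ} {R : State → B → Set} {Q : State → C → Set} {x g} →
           Sim G c σ R x → (∀ τ b → R τ b → Sim G d τ Q (g b)) → Sim G (c ⨾ d) σ Q (x >>= g)
    sim p ▸ˢ k = sim (Rel-bind p λ τ b r → rel (k τ b r))

    _▸ᵗ_ : ∀ {B : Set} {c d σ} {R Q : State → B → Set} {x} →
           Sim G c σ R x → (∀ τ b → R τ b → Triple G d τ (λ υ → Q υ b)) → Sim G (c ⨾ d) σ Q x
    sim p ▸ᵗ k = sim (Rel-det p λ τ b r → det (k τ b r))

    after : ∀ {B : Set} {c d σ P} {Q : State → B → Set} {x} →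
            Triple G c σ P → (∀ τ → P τ → Sim G d τ Q x) → Sim G (c ⨾ d) σ Q x
    after (triple p) k = sim (Det-Rel p λ τ q → rel (k τ q))

    straightˢ : ∀ {B : Set} {c d σ τ} {Q : State → B → Set} {x} → run G c σ ≡ ret τ → Sim G d τ Q x → Sim G (c ⨾ d) σ Q x
    straightˢ {τ = τ} eq (sim p) = sim (Det-Rel {P = _≡ τ} (τ , eq , refl) λ { _ refl → p })

    if-zeroˢ : ∀ {B : Set} {Q : State → B → Set} {r c d σ x} → reg σ r ≡ 0 → Sim G c (tick 1 σ) Q x → Sim G (ifZero r ₁ c ₂ d) σ Q x
    if-zeroˢ {Q = Q} {σ = σ} {x} eq (sim t) = sim (subst (λ r → Rel Q r x) (sym (run-ifZero σ eq)) t)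

    if-sucˢ : ∀ {B : Set} {Q : State → B → Set} {r c d σ x y} → reg σ r ≡ suc y → Sim G d (tick 1 σ) Q x → Sim G (ifZero r ₁ c ₂ d) σ Q x
    if-sucˢ {Q = Q} {σ = σ} {x} eq (sim t) = sim (subst (λ r → Rel Q r x) (sym (run-ifSuc σ eq)) t)

    determined : ∀ {B : Set} {c σ} {Q : State → B → Set} {b} → Triple G c σ (λ τ → Q τ b) → Sim G c σ Q (ret b)
    determined {Q = Q} {b} (triple (τ , eq , q)) = sim (subst (λ r → Rel Q r (ret b)) (sym eq) (ret q))

  -- The empty hyperedge bears on all classes at once, so testing it would let d jump by k between
  -- neighbours. The encoder leaves it out; the decoder tests it, which changes nothing as soon as
  -- `G` contains some copy (`complete-copy`).
  nonemptyEdges : ∀ {h} → Hypergraph h → List (Subset h)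
  nonemptyEdges H = filterᵇ (λ e → does (nonempty? e)) (family (edge H))

  tosses : Reg → Cmd
  tosses r = loop r (coin rX ⨾ ifZero rX ₁ const rAcc 0 ₂ nop)

  generateColour generate output : Cmd
  generateColour = const rCol 0 ⨾ loop rB (coin rX ⨾ add rCol rCol rCol ⨾ add rCol rCol rX)
  generate = const rV 0 ⨾ loop rN (generateColour ⨾ store rV rCol ⨾ add rV rV rOne)
  output   = const rV 0 ⨾ loop rN (load rCol rV ⨾ emit rCol ⨾ add rV rV rOne)

  examine : ∀ {h} → Hypergraph h → Cmd
  examine {h} H = Tests.scan h (nonemptyEdges H) nop ⨾
    ifZero rFound ₁ (ifZero rStrict ₁ tosses rP ₂ const rAcc 0) ₂ nop

  -- One subtraction covers all cases. After the fallback `rAcc` and `rFlag` are both 1 (the rounds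
  -- were idle), after failure both are 0, and either way a fresh colouring is drawn; after an
  -- acceptance the difference is 1 and the sample stays.
  finishing : Cmd
  finishing = sub rAcc rAcc rFlag ⨾ ifZero rAcc ₁ generate ₂ nop

  attempt select main : ∀ {h} → Hypergraph h → Cmd
  attempt H = const rAcc 1 ⨾ const rClass 0 ⨾ loop rK (examine H ⨾ add rClass rClass rOne)
  select H = loop rT (ifZero rAcc ₁ (generate ⨾ attempt H) ₂ nop) ⨾ finishing
  main H = const rAcc 1 ⨾ tosses rL ⨾ add rFlag rAcc rZero ⨾ select H ⨾ output

  module Sampling {h n : ℕ} (H : Hypergraph h) (G : Hypergraph n) (k b T t L s : ℕ) where

    es : List (Subset h)
    es = nonemptyEdges H

    open Tests h
    open Search G es
    open Classes G es

    settings : List ℕ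
    settings = n ∷ k ∷ h ∷ b ∷ T ∷ t ∷ L ∷ 1 ∷ s ∷ 0 ∷ []

    record Ready (f : ℕ) (σ : State) : Set where
      field
        fixed : take 10 (view σ) ≡ settings
        flag  : reg σ rFlag ≡ f
        empty : out σ ≡ []

      val-at : ∀ i → colour (take 10 (view σ)) i ≡ colour settings i
      val-at i = cong (λ l → colour l i) fixed

    open Ready

    ready-copy : ∀ {f σ τ} → take 11 (view τ) ≡ take 11 (view σ) → out τ ≡ out σ → Ready f σ → Ready f τ
    ready-copy v o r = record
      { fixed = trans (cong (take 10) v) (fixed r) ; flag = trans (cong (λ l → colour l 10) v) (flag r) ; empty = trans o (empty r) }

    Painted : (ℕ → ℕ) → State → Set
    Painted χ σ = ∀ v → v ℕ.< n → mem σ v ≡ χ v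

    toss-body bits-body colour-body examine-body : State → Rand State
    toss-body τ = run G (coin rX ⨾ ifZero rX ₁ const rAcc 0 ₂ nop) (tick 1 τ)
    bits-body τ = run G (coin rX ⨾ add rCol rCol rCol ⨾ add rCol rCol rX) (tick 1 τ)
    colour-body τ = run G (generateColour ⨾ store rV rCol ⨾ add rV rV rOne) (tick 1 τ)

    examine-body τ = run G (examine H ⨾ add rClass rClass rOne) (tick 1 τ)

    Unchanged : State → State → Set
    Unchanged σ τ = take 11 (view τ) ≡ take 11 (view σ) × reg τ rClass ≡ reg σ rClass × mem τ ≡ mem σ × out τ ≡ out σ

    tosses-rel : ∀ m σ a → reg σ rAcc ≡ bit a →
      Rel (λ τ a → Unchanged σ τ × reg τ rAcc ≡ bit a) (iterate m toss-body σ) (heads m a)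
    tosses-rel zero    σ a acc = ret ((refl , refl , refl , refl) , acc)
    tosses-rel (suc m) σ a acc = toss (tosses-rel m _ false refl) (tosses-rel m _ a acc)

    tosses-sim : ∀ {f} r m σ a → reg σ r ≡ m → Ready f σ → reg σ rAcc ≡ bit a →
      Sim G (tosses r) σ (λ τ a → Ready f τ × reg τ rClass ≡ reg σ rClass × mem τ ≡ mem σ × reg τ rAcc ≡ bit a) (heads m a)
    tosses-sim r m σ a refl ready acc = sim (Rel-weaken
      (λ τ a ((v , c , μ , o) , acc) → ready-copy v o ready , c , μ , acc) (tosses-rel m (tick 1 σ) a acc))

    bits-rel : ∀ m σ c → reg σ rCol ≡ c →
      Rel (λ τ c → take 11 (view τ) ≡ take 11 (view σ) × mem τ ≡ mem σ × out τ ≡ out σ × reg τ rV ≡ reg σ rV × reg τ rCol ≡ c)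
        (iterate m bits-body σ) (bits m c)
    bits-rel zero    σ c refl = ret (refl , refl , refl , refl , refl)
    bits-rel (suc m) σ c refl = toss (bits-rel m _ _ refl) (bits-rel m _ _ refl)

    colouring-rel : ∀ {f} m σ → Ready f σ →
      Rel (λ τ cs → Ready f τ × length cs ≡ m × (∀ u → u ℕ.< reg σ rV → mem τ u ≡ mem σ u) ×
                    (∀ i → i ℕ.< m → mem τ (reg σ rV ℕ.+ i) ≡ colour cs i))
        (iterate m colour-body σ) (colouring b m)
    colouring-rel zero    σ ready = ret (ready , refl , (λ u u< → refl) , λ i ())
    colouring-rel {f} (suc m) σ ready = Rel-bind (rel colour-sim) λ τ c (ready′ , next , low , cell) →
      Rel-map (λ υ cs (ready″ , len , low′ , cells′) → ready″ , cong suc len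
        , (λ u u< → trans (low′ u (subst (u ℕ.<_) (sym next) (ℕₚ.m<n⇒m<1+n u<))) (low u u<))
        , λ { zero i< → trans (low′ _ (subst (reg σ rV ℕ.+ 0 ℕ.<_) (sym next) (s≤s (ℕₚ.≤-reflexive (ℕₚ.+-identityʳ _))))) cell
            ; (suc i) (s≤s i<) → trans (cong (mem υ) (trans (ℕₚ.+-suc (reg σ rV) i) (cong (ℕ._+ i) (sym next)))) (cells′ i i<) })
        (colouring-rel m τ ready′)
      where
      σ₁ : State
      σ₁ = tick 1 (set rCol 0 (tick 1 σ))
      bits-sim : Sim G generateColour (tick 1 σ)
        (λ τ c → take 11 (view τ) ≡ take 11 (view σ) × mem τ ≡ mem σ × out τ ≡ out σ × reg τ rV ≡ reg σ rV × reg τ rCol ≡ c) (bits b 0)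
      bits-sim = straightˢ {τ = σ₁} refl (sim (subst (λ m → Rel _ (iterate m bits-body (tick 1 σ₁)) (bits b 0)) (sym (val-at ready 3))
        (bits-rel b (tick 1 σ₁) 0 refl)))
      colour-sim : Sim G (generateColour ⨾ store rV rCol ⨾ add rV rV rOne) (tick 1 σ)
        (λ τ c → Ready f τ × reg τ rV ≡ suc (reg σ rV) × (∀ u → u ℕ.< reg σ rV → mem τ u ≡ mem σ u) × mem τ (reg σ rV ℕ.+ 0) ≡ c) (bits b 0)
      colour-sim = bits-sim ▸ᵗ λ τ c (v , μ , o , rv , rc) → triple (_ , refl
        , ready-copy v o ready
        , trans (cong₂ ℕ._+_ rv (trans (cong (λ l → colour l 7) v) (val-at ready 7))) (ℕₚ.+-comm _ 1)
        , (λ u u< → trans (update-other (mem τ) (reg τ rV) (reg τ rCol) u (ℕₚ.<⇒≢ (subst (u ℕ.<_) (sym rv) u<))) (cong (λ m → m u) μ))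
        , trans (cong (mem τ [ reg τ rV ↦ reg τ rCol ]) (trans (ℕₚ.+-identityʳ _) (sym rv))) (trans (update-same (mem τ) (reg τ rV) (reg τ rCol)) rc))

    generate-sim : ∀ {f} σ → Ready f σ →
      Sim G generate σ (λ τ cs → Ready f τ × length cs ≡ n × Painted (colour cs) τ) (colouring b n)
    generate-sim {f} σ ready = straightˢ {τ = σ₁} refl (sim (subst (λ m → Rel _ (iterate m colour-body (tick 1 σ₁)) (colouring b n)) (sym (val-at ready 0))
      (Rel-weaken (λ τ cs (ready′ , len , _ , cells) → ready′ , len , cells) (colouring-rel n (tick 1 σ₁) (ready-copy refl refl ready)))))
      where
      σ₁ : State
      σ₁ = tick 1 (set rV 0 σ)

    acting : ∀ χ γ → Scanning.Acting G es nop (λ _ → []) χ γ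
    acting χ γ t σ s hold = triple (_ , refl , keeps-refl refl refl , sym (Listₚ.++-identityʳ (out σ)) , refl , λ j → refl)

    module _ {f : ℕ} (χ : ℕ → ℕ) where

      record Attempting (γ : ℕ) (a : Bool) (σ : State) : Set where
        field
          ready    : Ready f σ
          painted  : Painted χ σ
          accepted : reg σ rAcc ≡ bit a
          current  : reg σ rClass ≡ γ

      open Attempting

      scan-sim : ∀ γ a σ → Attempting γ a σ →
        Triple G (scan es nop) σ λ τ → Attempting γ a τ × reg τ rFound ≡ bit (has χ γ)
      scan-sim γ a σ att = weaken (λ τ (k , r) → moved τ k r , found τ r)
        (Scanning.scan-run G es nop (λ _ → []) χ γ (acting χ γ) σ setting)
        where
        setting : Setting n h χ γ σ
        setting = record { vertices = val-at (ready att) 0 ; arity = val-at (ready att) 2 ; one = val-at (ready att) 7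
                         ; zeroed = val-at (ready att) 9 ; class = current att ; colours = painted att }
        Outcome : State → Set
        Outcome τ = Scanning.Found G es nop (λ _ → []) χ γ (out σ) τ ⊎ Scanning.Missed G es nop (λ _ → []) χ γ (out σ) (λ _ → ⊤) τ
        silent : ∀ τ → Outcome τ → out τ ≡ out σ
        silent τ (inj₁ (_ , _ , _ , o)) = trans o (Listₚ.++-identityʳ (out σ))
        silent τ (inj₂ (_ , o , _))     = o
        moved : ∀ τ → Keeps σ τ → Outcome τ → Attempting γ a τ
        moved τ k r = record
          { ready    = ready-copy (cong (take 11) (views k)) (silent τ r) (ready att)
          ; painted  = λ v v<n → trans (cells k v (subst (v ℕ.<_) (sym (val-at (ready att) 0)) v<n)) (painted att v v<n)
          ; accepted = trans (at k 11) (accepted att)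
          ; current  = trans (at k 12) (current att) }
        found : ∀ τ → Outcome τ → reg τ rFound ≡ bit (has χ γ)
        found τ (inj₁ (t , g , r , _))    = trans r (cong bit (sym (has⁺ {χ} {γ} t g)))
        found τ (inj₂ (r , _ , none)) = trans r (cong bit (sym (has-false {χ} {γ} λ t → none t tt)))

      examine-sim : ∀ γ a σ → Attempting γ a σ →
        Sim G (examine H) σ (λ τ a → Attempting γ a τ) (if has χ γ then ret a else penalty s t a)
      examine-sim γ a σ att = after (scan-sim γ a σ att) λ τ (att′ , found) → branch τ att′ _ found
        where
        copy : ∀ {σ τ a b} → Attempting γ a σ → take 11 (view τ) ≡ take 11 (view σ) → reg τ rClass ≡ reg σ rClass →
          mem τ ≡ mem σ → out τ ≡ out σ → reg τ rAcc ≡ bit b → Attempting γ b τ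
        copy att v c μ o acc = record { ready = ready-copy v o (ready att) ; painted = λ u u<n → trans (cong (λ m → m u) μ) (painted att u u<n)
                                      ; accepted = acc ; current = trans c (current att) }
        punish : ∀ τ → Attempting γ a τ → ∀ s′ → reg τ rStrict ≡ s′ →
          Sim G (ifZero rStrict ₁ tosses rP ₂ const rAcc 0) τ (λ τ a → Attempting γ a τ) (penalty s′ t a)
        punish τ att zero strict = if-zeroˢ strict (sim (Rel-weaken
          (λ υ b (r , c , μ , acc) → record { ready = r ; painted = λ u u<n → trans (cong (λ m → m u) μ) (painted att u u<n)
                                            ; accepted = acc ; current = trans c (current att) })
          (rel (tosses-sim rP t (tick 1 τ) a (val-at (ready att) 5) (ready-copy refl refl (ready att)) (accepted att)))))
        punish τ att (suc s′) strict = if-sucˢ strict (determined (triple (_ , refl , copy att refl refl refl refl refl)))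
        branch : ∀ τ → Attempting γ a τ → ∀ b → reg τ rFound ≡ bit b →
          Sim G (ifZero rFound ₁ (ifZero rStrict ₁ tosses rP ₂ const rAcc 0) ₂ nop) τ (λ τ a → Attempting γ a τ)
            (if b then ret a else penalty s t a)
        branch τ att true  found = if-sucˢ found (determined (triple (_ , refl , copy att refl refl refl refl (accepted att))))
        branch τ att false found = if-zeroˢ found (punish (tick 1 τ) (copy att refl refl refl refl (accepted att)) s (val-at (ready att) 8))

      accept-rel : ∀ m γ a σ → Attempting γ a σ →
        Rel (λ τ a → Attempting (γ ℕ.+ m) a τ)
          (iterate m examine-body σ) (accept s t (has χ) m γ a)
      accept-rel zero    γ a σ att = ret (subst (λ γ → Attempting γ a σ) (sym (ℕₚ.+-identityʳ γ)) att)
      accept-rel (suc m) γ a σ att = Rel-bind (rel step)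
        λ τ b att′ → subst (λ δ → Rel (λ υ c → Attempting δ c υ) (iterate m examine-body τ) (accept s t (has χ) m (suc γ) b)) (sym (ℕₚ.+-suc γ m))
          (accept-rel m (suc γ) b τ att′)
        where
        ticked : Attempting γ a (tick 1 σ)
        ticked = record { ready = ready-copy refl refl (ready att) ; painted = painted att ; accepted = accepted att ; current = current att }
        next : ∀ τ b → Attempting γ b τ → Attempting (suc γ) b (tick 1 (set rClass (reg τ rClass ℕ.+ reg τ rOne) τ))
        next τ b att = record { ready = ready-copy refl refl (ready att) ; painted = painted att ; accepted = accepted att
                              ; current = trans (cong₂ ℕ._+_ (current att) (val-at (ready att) 7)) (ℕₚ.+-comm γ 1) }
        step : Sim G (examine H ⨾ add rClass rClass rOne) (tick 1 σ) (λ τ a → Attempting (suc γ) a τ)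
          (if has χ γ then ret a else penalty s t a)
        step = examine-sim γ a (tick 1 σ) ticked ▸ᵗ λ τ b att′ → triple (_ , refl , next τ b att′)

      attempt-sim : ∀ σ → Ready f σ → Painted χ σ →
        Sim G (attempt H) σ (λ τ a → Ready f τ × Painted χ τ × reg τ rAcc ≡ bit a) (accept s t (has χ) k 0 true)
      attempt-sim σ r p = straightˢ {τ = σ₁} refl (straightˢ {τ = σ₂} refl (sim
        (subst (λ m → Rel _ (iterate m examine-body (tick 1 σ₂)) (accept s t (has χ) k 0 true)) (sym (val-at r 1))
          (Rel-weaken (λ τ a att → ready att , painted att , accepted att)
            (accept-rel k 0 true (tick 1 σ₂) record { ready = ready-copy refl refl r ; painted = p ; accepted = refl ; current = refl })))))
        where
        σ₁ σ₂ : State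
        σ₁ = tick 1 (set rAcc 1 σ)
        σ₂ = tick 1 (set rClass 0 σ₁)

    open Selection {X = List ℕ} (colouring b n)

    acceptance : List ℕ → Rand Bool
    acceptance cs = accept s t (has (colour cs)) k 0 true

    round : State → Rand State
    round τ = run G (ifZero rAcc ₁ (generate ⨾ attempt H) ₂ nop) (tick 1 τ)

    finish : State → Rand State
    finish = run G finishing

    Coloured-by : ℕ → State → List ℕ → Set
    Coloured-by f τ cs = Ready f τ × length cs ≡ n × Painted (colour cs) τ

    finish-empty : ∀ {f} σ → Ready f σ → reg σ rAcc ≡ f → Sim G finishing σ (Coloured-by f) (colouring b n)
    finish-empty {f} σ r acc = straightˢ {τ = σ₁} refl (if-zeroˢ (trans (cong₂ ℕ._∸_ acc (flag r)) (ℕₚ.n∸n≡0 f))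
      (generate-sim (tick 1 σ₁) (ready-copy refl refl r)))
      where
      σ₁ : State
      σ₁ = tick 1 (set rAcc (reg σ rAcc ℕ.∸ reg σ rFlag) σ)

    finish-accepted : ∀ σ cs → Coloured-by 0 σ cs → reg σ rAcc ≡ 1 → Sim G finishing σ (Coloured-by 0) (ret cs)
    finish-accepted σ cs (r , len , p) acc =
      straightˢ {τ = tick 1 (set rAcc (reg σ rAcc ℕ.∸ reg σ rFlag) σ)} refl (if-sucˢ (cong₂ ℕ._∸_ acc (flag r))
        (determined (triple (_ , refl , ready-copy refl refl r , len , p))))

    idle : ∀ m σ → reg σ rAcc ≡ 1 → Det (λ τ → Unchanged σ τ × reg τ rAcc ≡ 1) (iterate m round σ)
    idle zero    σ acc = σ , refl , (refl , refl , refl , refl) , acc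
    idle (suc m) σ acc = det {σ = tick 1 σ} (if-suc {c = generate ⨾ attempt H} {d = nop} acc
        (triple {P = λ τ → Unchanged σ τ × reg τ rAcc ≡ 1} (_ , refl , (refl , refl , refl , refl) , acc))) ▹
      λ τ ((v , c , μ , o) , acc′) → Det-map (λ υ ((v′ , c′ , μ′ , o′) , acc″) →
        (trans v′ v , trans c′ c , trans μ′ μ , trans o′ o) , acc″) (idle m τ acc′)

    keep-sample : ∀ m σ cs → Coloured-by 0 σ cs → reg σ rAcc ≡ 1 → Rel (Coloured-by 0) (iterate m round σ >>= finish) (ret cs)
    keep-sample m σ cs (r , len , p) acc = Det-Rel (idle m σ acc) λ τ ((v , c , μ , o) , acc′) →
      rel (finish-accepted τ cs (ready-copy v o r , len , λ u u<n → trans (cong (λ m → m u) μ) (p u u<n)) acc′)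

    -- The induction needs the loop together with `finishing`: when no round is left, it is
    -- `finishing` that draws the sample of `tries acceptance zero`.
    tries-rel : ∀ m σ → Ready 0 σ → reg σ rAcc ≡ 0 → Rel (Coloured-by 0) (iterate m round σ >>= finish) (tries acceptance m)
    tries-rel zero    σ r acc = rel (finish-empty σ r acc)
    tries-rel (suc m) σ r acc = Rel-assoc (round σ) (subst (λ z → Rel (Coloured-by 0) (z >>= λ τ → iterate m round τ >>= finish) (tries acceptance (suc m)))
      (sym (run-ifZero (tick 1 σ) acc))
      (Rel-assoc (run G generate (tick 1 (tick 1 σ))) (Rel-bind (rel (generate-sim (tick 1 (tick 1 σ)) (ready-copy refl refl r)))
        λ τ cs (r′ , len , p) → Rel-bind (rel (attempt-sim (colour cs) τ r′ p)) λ υ a (r″ , p′ , acc′) → continue υ cs a (r″ , len , p′) acc′)))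
      where
      continue : ∀ υ cs a → Coloured-by 0 υ cs → reg υ rAcc ≡ bit a →
        Rel (Coloured-by 0) (iterate m round υ >>= finish) (if a then ret cs else tries acceptance m)
      continue υ cs true  c acc = keep-sample m υ cs c acc
      continue υ cs false c acc = tries-rel m υ (proj₁ c) acc

    select-sim : ∀ a σ → Ready (bit a) σ → reg σ rAcc ≡ bit a →
      Sim G (select H) σ (Coloured-by (bit a)) (if a then colouring b n else tries acceptance T)
    select-sim false σ r acc = sim (subst (λ m → Rel (Coloured-by 0) (iterate m round (tick 1 σ) >>= finish) (tries acceptance T)) (sym (val-at r 4))
      (tries-rel T (tick 1 σ) (ready-copy refl refl r) acc))
    select-sim true σ r acc = sim (Det-Rel (idle (reg σ rT) (tick 1 σ) acc) λ τ ((v , c , μ , o) , acc′) →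
      rel (finish-empty τ (ready-copy v o r) acc′))

    output-run : ∀ {f} σ cs → Ready f σ → length cs ≡ n → Painted (colour cs) σ → Triple G output σ λ τ → out τ ≡ cs
    output-run {f} σ cs r len p = straight {τ = σ₁} refl (weaken (λ τ (o , _) → trans o take-all)
      (looping Invariant n (val-at r 0) (empty r , refl , refl , val-at r 7) step))
      where
      σ₁ : State
      σ₁ = tick 1 (set rV 0 σ)
      Invariant : ℕ → State → Set
      Invariant i τ = out τ ≡ take i cs × reg τ rV ≡ i × mem τ ≡ mem σ × reg τ rOne ≡ 1
      take-all : take n cs ≡ cs
      take-all = subst (λ m → take m cs ≡ cs) len (Listₚ.take-all (length cs) cs ℕₚ.≤-refl)
      take-snoc : ∀ i (cs : List ℕ) → i ℕ.< length cs → take i cs ++ colour cs i ∷ [] ≡ take (suc i) cs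
      take-snoc zero    (c ∷ cs) i<       = refl
      take-snoc (suc i) (c ∷ cs) (s≤s i<) = cong (c ∷_) (take-snoc i cs i<)
      step : ∀ i τ → i ℕ.< n → Invariant i τ → Triple G (load rCol rV ⨾ emit rCol ⨾ add rV rV rOne) (tick 1 τ) (Invariant (suc i))
      step i τ i<n (o , v , μ , one) = triple (_ , refl
        , trans (cong₂ (λ l c → l ++ c ∷ []) o (trans (cong₂ (λ m a → m a) μ v) (p i i<n))) (take-snoc i cs (subst (i ℕ.<_) (sym len) i<n))
        , trans (cong₂ ℕ._+_ v one) (ℕₚ.+-comm i 1) , μ , one)

    main-sim : ∀ σ → take 10 (view σ) ≡ settings → out σ ≡ [] →
      Sim G (main H) σ (λ τ cs → out τ ≡ cs) (mechanism acceptance L T)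
    main-sim σ fixed empty = straightˢ {τ = σ₁} refl (tosses-sim rL L σ₁ true (val-at ready₁ 6) ready₁ refl ▸ˢ
      λ τ a (r , _ , _ , acc) → straightˢ {τ = tick 1 (set rFlag (reg τ rAcc ℕ.+ reg τ rZero) τ)} refl
        (select-sim a (tick 1 (set rFlag (reg τ rAcc ℕ.+ reg τ rZero) τ)) (flagged τ a r acc) acc ▸ᵗ λ υ cs (r′ , len , p) → output-run υ cs r′ len p))
      where
      σ₁ : State
      σ₁ = tick 1 (set rAcc 1 σ)
      ready₁ : Ready (reg σ rFlag) σ₁
      ready₁ = record { fixed = fixed ; flag = refl ; empty = empty }
      flagged : ∀ τ a → Ready (reg σ rFlag) τ → reg τ rAcc ≡ bit a → Ready (bit a) (tick 1 (set rFlag (reg τ rAcc ℕ.+ reg τ rZero) τ))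
      flagged τ a r acc = record { fixed = Ready.fixed r ; flag = trans (cong₂ ℕ._+_ acc (val-at r 9)) (ℕₚ.+-identityʳ _) ; empty = Ready.empty r }

open EncoderRun

-- A static bound on running time, and its orders of growth

module RunningTime where

  open Triple
  open Sim

  -- Both branches of a conditional are counted, so the bound depends only on `ρ`, which bounds the
  -- loop counts and query lengths, and not on the course of the run.
  time : (Reg → ℕ) → Cmd → ℕ
  time ρ (c ⨾ d)            = time ρ c ℕ.+ time ρ d
  time ρ (query r s t)      = suc (ρ t)
  time ρ (ifZero r ₁ c ₂ d) = suc (time ρ c ℕ.+ time ρ d)
  time ρ (loop r c)         = suc (ρ r ℕ.* suc (time ρ c))
  time ρ _                  = 1

  -- The registers below q are not written and govern all loops and queries.
  Governed : ℕ → Cmd → Set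
  Governed q (c ⨾ d)            = Governed q c × Governed q d
  Governed q (const r x)        = T (q ℕ.≤ᵇ r)
  Governed q (add r s t)        = T (q ℕ.≤ᵇ r)
  Governed q (sub r s t)        = T (q ℕ.≤ᵇ r)
  Governed q (load r s)         = T (q ℕ.≤ᵇ r)
  Governed q (store r s)        = ⊤
  Governed q (coin r)           = T (q ℕ.≤ᵇ r)
  Governed q (emit r)           = ⊤
  Governed q (query r s t)      = T (q ℕ.≤ᵇ r) × T (t ℕ.<ᵇ q)
  Governed q (ifZero r ₁ c ₂ d) = Governed q c × Governed q d
  Governed q (loop r c)         = T (r ℕ.<ᵇ q) × Governed q c

  module _ {n} (G : Hypergraph n) (q : ℕ) (ρ : Reg → ℕ) where

    Under : State → Set
    Under σ = ∀ r → r ℕ.< q → reg σ r ℕ.≤ ρ r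

    record Within (t : ℕ) (σ τ : State) : Set where
      constructor _,ʷ_
      field
        ticks : clock τ ℕ.≤ clock σ ℕ.+ t
        under : Under τ

    open Within public

    private
      under-set : ∀ σ r x → T (q ℕ.≤ᵇ r) → Under σ → Under (set r x σ)
      under-set σ r x q≤r under r′ r′<q = subst (ℕ._≤ ρ r′)
        (sym (update-other (reg σ) r x r′ (ℕₚ.<⇒≢ (ℕₚ.<-≤-trans r′<q (ℕₚ.≤ᵇ⇒≤ q r q≤r))))) (under r′ r′<q)

      chain : ∀ {a b c s t} → a ℕ.≤ b ℕ.+ t → b ℕ.≤ c ℕ.+ s → a ℕ.≤ c ℕ.+ (s ℕ.+ t)
      chain {a} {b} {c} {s} {t} p q = ℕₚ.≤-trans p (ℕₚ.≤-trans (ℕₚ.+-monoˡ-≤ t q) (ℕₚ.≤-reflexive (ℕₚ.+-assoc c s t)))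

      within-trans : ∀ {s t σ τ υ} → Within s σ τ → Within t τ υ → Within (s ℕ.+ t) σ υ
      within-trans {s} {t} (p ,ʷ _) (p′ ,ʷ u) = chain {s = s} {t} p′ p ,ʷ u

      within-weaken : ∀ {s t σ τ} → s ℕ.≤ t → Within s σ τ → Within t σ τ
      within-weaken {σ = σ} s≤t (p ,ʷ u) = ℕₚ.≤-trans p (ℕₚ.+-monoʳ-≤ (clock σ) s≤t) ,ʷ u

      one-tick : ∀ {t σ τ} → Under σ → Within t (tick 1 σ) τ → Within (suc t) σ τ
      one-tick {t} {σ} u w = within-trans {1} {t} {σ} {tick 1 σ} (ℕₚ.≤-refl ,ʷ u) w

    time-sound : ∀ c σ → Governed q c → Under σ → Always (Within (time ρ c) σ) (run G c σ)

    iterate-sound : ∀ c m σ → Governed q c → Under σ →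
      Always (Within (m ℕ.* suc (time ρ c)) σ) (iterate m (λ τ → run G c (tick 1 τ)) σ)
    iterate-sound c zero    σ g u = ℕₚ.≤-reflexive (sym (ℕₚ.+-identityʳ _)) ,ʷ u
    iterate-sound c (suc m) σ g u = Always-bind (run G c (tick 1 σ)) (time-sound c (tick 1 σ) g u) λ τ w →
      Always-map (λ υ w′ → within-trans (one-tick u w) w′) (iterate m _ τ) (iterate-sound c m τ g (under w))

    time-sound (c ⨾ d) σ (g , g′) u = Always-bind (run G c σ) (time-sound c σ g u) λ τ w →
      Always-map (λ υ w′ → within-trans w w′) (run G d τ) (time-sound d τ g′ (under w))
    time-sound (const r x) σ g u = ℕₚ.≤-refl ,ʷ under-set σ r x g u
    time-sound (add r s t) σ g u = ℕₚ.≤-refl ,ʷ under-set σ r _ g u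
    time-sound (sub r s t) σ g u = ℕₚ.≤-refl ,ʷ under-set σ r _ g u
    time-sound (load r s)  σ g u = ℕₚ.≤-refl ,ʷ under-set σ r _ g u
    time-sound (store r s) σ g u = ℕₚ.≤-refl ,ʷ u
    time-sound (coin r)    σ g u = (ℕₚ.≤-refl ,ʷ under-set σ r 0 g u) , (ℕₚ.≤-refl ,ʷ under-set σ r 1 g u)
    time-sound (emit r)    σ g u = ℕₚ.≤-refl ,ʷ u
    time-sound (query r s t) σ (g , t<q) u =
      ℕₚ.+-monoʳ-≤ (clock σ) (s≤s (u t (ℕₚ.<ᵇ⇒< t q t<q))) ,ʷ under-set σ r _ g u
    time-sound (ifZero r ₁ c ₂ d) σ (g , g′) u = branch (reg σ r) refl
      where
      branch : ∀ x → reg σ r ≡ x → Always (Within (suc (time ρ c ℕ.+ time ρ d)) σ) (run G (ifZero r ₁ c ₂ d) σ)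
      branch zero    eq = subst (Always _) (sym (run-ifZero σ eq)) (Always-map
        (λ τ w → within-weaken (s≤s (ℕₚ.m≤m+n (time ρ c) (time ρ d))) (one-tick u w)) (run G c (tick 1 σ)) (time-sound c (tick 1 σ) g u))
      branch (suc x) eq = subst (Always _) (sym (run-ifSuc σ eq)) (Always-map
        (λ τ w → within-weaken (s≤s (ℕₚ.m≤n+m (time ρ d) (time ρ c))) (one-tick u w)) (run G d (tick 1 σ)) (time-sound d (tick 1 σ) g′ u))
    time-sound (loop r c) σ (r<q , g) u = Always-map
      (λ τ w → within-weaken (s≤s (ℕₚ.*-monoˡ-≤ (suc (time ρ c)) (u r (ℕₚ.<ᵇ⇒< r q r<q)))) (one-tick u w))
      (iterate (reg σ r) _ (tick 1 σ)) (iterate-sound c (reg σ r) (tick 1 σ) g u)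

  Triple-Always : ∀ {n} {G : Hypergraph n} {c σ P Q} → Triple G c σ P → Always Q (run G c σ) → Triple G c σ (λ τ → P τ × Q τ)
  Triple-Always {Q = Q} (triple (τ , eq , p)) q = triple (τ , eq , p , subst (Always Q) eq q)

  Governed-each : ∀ q {X : Set} {c : X → Cmd} → T (q ℕ.≤ᵇ rX) → (∀ x → Governed q (c x)) → ∀ xs → Governed q (each c xs)
  Governed-each q ok g []       = ok
  Governed-each q ok g (x ∷ xs) = g x , Governed-each q ok g xs

  module _ (h : ℕ) where

    open Tests h

    governed-scan : ∀ q → T (rH ℕ.<ᵇ q) → T (q ℕ.≤ᵇ rOk) → ∀ es act → Governed q act → Governed q (scan es act)
    governed-scan q h<q q≤ es act g = least 11 _ , governed-nest h
      where
      least : ∀ r → T (9 ℕ.<ᵇ r) → T (q ℕ.≤ᵇ r)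
      least r r≥ = ℕₚ.≤⇒≤ᵇ (ℕₚ.≤-trans (ℕₚ.≤ᵇ⇒≤ q rOk q≤) (ℕₚ.<ᵇ⇒< 9 r r≥))
      required-equal : Governed q requireEqual
      required-equal = (least 12 _ , least 13 _ , least 12 _) , least 12 _ , least 10 _
      required-distinct : Governed q requireDistinct
      required-distinct = (least 12 _ , least 13 _ , least 12 _) , least 10 _ , least 12 _
      governed-distinct : ∀ i j → Governed q (testDistinct i j)
      governed-distinct i j with does (i Finₚ.≟ j)
      ... | true  = least 12 _
      ... | false = least 14 _ , least 13 _ , required-distinct
      n<q : T (0 ℕ.<ᵇ q)
      n<q = ℕₚ.<⇒<ᵇ (ℕₚ.≤-<-trans z≤n (ℕₚ.<ᵇ⇒< rH q h<q))
      governed-edge : ∀ e → Governed q (testEdge e)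
      governed-edge e = least 14 _ , Governed-each q (least 12 _) (λ i → tt , least 14 _) (allFin h) , (least 12 _ , h<q) , least 10 _ , least 12 _
      governed-body : Governed q (body es act)
      governed-body = least 10 _
        , (Governed-each q (least 12 _) (λ j → least 14 _ , least 13 _ , required-equal) (allFin h)
          , Governed-each q (least 12 _) (λ i → Governed-each q (least 12 _) (governed-distinct i) (allFin h)) (allFin h)
          , Governed-each q (least 12 _) governed-edge es)
        , least 12 _ , (least 11 _ , g) , least 12 _
      governed-nest : ∀ m → Governed q (nest m (body es act))
      governed-nest zero    = governed-body
      governed-nest (suc m) = least (rTuple m) tt , n<q , governed-nest m , least (rTuple m) tt

    -- The quantities that govern the running time, of which n, k and
    -- (1 + L) 2^(khb) are the independent ones.
    record Sizes : Set where
      field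
        n k b R t L : ℕ
      bulk : ℕ
      bulk = suc L ℕ.* 2 ℕ.^ (k ℕ.* (h ℕ.* b))
      field
        k≥1 : 1 ℕ.≤ k
        b≤k : b ℕ.≤ k
        t≤  : t ℕ.≤ (2 ℕ.* h ℕ.+ 8) ℕ.* (k ℕ.* k)
        R≤  : R ℕ.≤ bulk

    open Sizes

    capacity : Sizes → Reg → ℕ
    capacity e r = colour (n e ∷ k e ∷ h ∷ b e ∷ R e ∷ t e ∷ L e ∷ []) r

    monomial : ℕ → ℕ → ℕ → Sizes → ℕ
    monomial i j l e = suc (n e) ℕ.^ i ℕ.* (k e ℕ.^ j ℕ.* bulk e ℕ.^ l)

    bulk≥1 : ∀ e → 1 ℕ.≤ bulk e
    bulk≥1 e = ℕₚ.*-mono-≤ (s≤s {n = L e} z≤n) (ℕₚ.m^n>0 2 (k e ℕ.* (h ℕ.* b e)))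

    pow-≥1 : ∀ {x} → 1 ℕ.≤ x → ∀ i → 1 ℕ.≤ x ℕ.^ i
    pow-≥1 x≥1 zero    = s≤s z≤n
    pow-≥1 x≥1 (suc i) = ℕₚ.*-mono-≤ x≥1 (pow-≥1 x≥1 i)

    pow-mono-exp : ∀ {x} → 1 ℕ.≤ x → ∀ {i j} → i ℕ.≤ j → x ℕ.^ i ℕ.≤ x ℕ.^ j
    pow-mono-exp {x} x≥1 {j = j} z≤n = pow-≥1 x≥1 j
    pow-mono-exp {x} x≥1 (s≤s i≤j) = ℕₚ.*-monoʳ-≤ x (pow-mono-exp x≥1 i≤j)

    monomial-mono : ∀ {i i′ j j′ l l′} → i ℕ.≤ i′ → j ℕ.≤ j′ → l ℕ.≤ l′ → ∀ e → monomial i j l e ℕ.≤ monomial i′ j′ l′ e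
    monomial-mono i≤ j≤ l≤ e = ℕₚ.*-mono-≤ (pow-mono-exp (s≤s z≤n) i≤)
      (ℕₚ.*-mono-≤ (pow-mono-exp (k≥1 e) j≤) (pow-mono-exp (bulk≥1 e) l≤))

    monomial≥1 : ∀ i j l e → 1 ℕ.≤ monomial i j l e
    monomial≥1 i j l e = ℕₚ.*-mono-≤ (pow-≥1 {suc (n e)} (s≤s z≤n) i) (ℕₚ.*-mono-≤ (pow-≥1 (k≥1 e) j) (pow-≥1 (bulk≥1 e) l))

    monomial-* : ∀ i j l i′ j′ l′ e → monomial i j l e ℕ.* monomial i′ j′ l′ e ≡ monomial (i ℕ.+ i′) (j ℕ.+ j′) (l ℕ.+ l′) e
    monomial-* i j l i′ j′ l′ e rewrite ℕₚ.^-distribˡ-+-* (suc (n e)) i i′ | ℕₚ.^-distribˡ-+-* (k e) j j′ | ℕₚ.^-distribˡ-+-* (bulk e) l l′ =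
      trans (ℕₚ.[m*n]*[o*p]≡[m*o]*[n*p] (suc (n e) ℕ.^ i) _ (suc (n e) ℕ.^ i′) _)
        (cong (suc (n e) ℕ.^ i ℕ.* suc (n e) ℕ.^ i′ ℕ.*_) (ℕₚ.[m*n]*[o*p]≡[m*o]*[n*p] (k e ℕ.^ j) _ (k e ℕ.^ j′) _))

    -- The `factor` comes before the quantification over `Sizes`: it is the constant of an O-bound,
    -- uniform in all sizes.
    record Order (f : Sizes → ℕ) (i j l : ℕ) : Set where
      constructor order
      field
        factor : ℕ
        bound  : ∀ e → f e ℕ.≤ factor ℕ.* monomial i j l e

    open Order

    record Cost (c : Cmd) (i j l : ℕ) : Set where
      constructor cost≤
      field
        costs : Order (λ e → time (capacity e) c) i j l

    open Cost

    raise : ∀ {f i i′ j j′ l l′} → i ℕ.≤ i′ → j ℕ.≤ j′ → l ℕ.≤ l′ → Order f i j l → Order f i′ j′ l′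
    raise i≤ j≤ l≤ (order a p) = order a λ e → ℕₚ.≤-trans (p e) (ℕₚ.*-monoʳ-≤ a (monomial-mono i≤ j≤ l≤ e))

    constant : ∀ {f} c → (∀ e → f e ℕ.≤ c) → Order f 0 0 0
    constant c p = order c λ e → ℕₚ.≤-trans (p e) (ℕₚ.≤-reflexive (sym (ℕₚ.*-identityʳ c)))

    sum-order : ∀ {f g i i′ j j′ l l′} → Order f i j l → Order g i′ j′ l′ →
                Order (λ e → f e ℕ.+ g e) (i ℕ.⊔ i′) (j ℕ.⊔ j′) (l ℕ.⊔ l′)
    sum-order {i = i} {i′} {j} {j′} {l} {l′} p q = order (factor p ℕ.+ factor q) λ e →
      ℕₚ.≤-trans (ℕₚ.+-mono-≤ (bound p′ e) (bound q′ e)) (ℕₚ.≤-reflexive (sym (ℕₚ.*-distribʳ-+ _ (factor p) (factor q))))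
      where
      p′ = raise (ℕₚ.m≤m⊔n i i′) (ℕₚ.m≤m⊔n j j′) (ℕₚ.m≤m⊔n l l′) p
      q′ = raise (ℕₚ.m≤n⊔m i i′) (ℕₚ.m≤n⊔m j j′) (ℕₚ.m≤n⊔m l l′) q

    product-order : ∀ {f g i i′ j j′ l l′} → Order f i j l → Order g i′ j′ l′ →
                    Order (λ e → f e ℕ.* g e) (i ℕ.+ i′) (j ℕ.+ j′) (l ℕ.+ l′)
    product-order {i = i} {i′} {j} {j′} {l} {l′} (order a p) (order a′ p′) = order (a ℕ.* a′) λ e →
      ℕₚ.≤-trans (ℕₚ.*-mono-≤ (p e) (p′ e)) (ℕₚ.≤-reflexive (trans (ℕₚ.[m*n]*[o*p]≡[m*o]*[n*p] a _ a′ _)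
        (cong (a ℕ.* a′ ℕ.*_) (monomial-* i j l i′ j′ l′ e))))

    suc-order : ∀ {f i j l} → Order f i j l → Order (λ e → suc (f e)) i j l
    suc-order {i = i} {j} {l} (order a p) = order (suc a) λ e → ℕₚ.+-mono-≤ (monomial≥1 i j l e) (p e)

    infixr 5 _⨾ᶜ_

    _⨾ᶜ_ : ∀ {c d i i′ j j′ l l′} → Cost c i j l → Cost d i′ j′ l′ → Cost (c ⨾ d) (i ℕ.⊔ i′) (j ℕ.⊔ j′) (l ℕ.⊔ l′)
    cost≤ p ⨾ᶜ cost≤ q = cost≤ (sum-order p q)

    1ᶜ : ∀ {c} → (∀ {e} → time (capacity e) c ≡ 1) → Cost c 0 0 0
    1ᶜ eq = cost≤ (constant 1 λ e → ℕₚ.≤-reflexive (eq {e}))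

    ifᶜ : ∀ {r c d i i′ j j′ l l′} → Cost c i j l → Cost d i′ j′ l′ → Cost (ifZero r ₁ c ₂ d) (i ℕ.⊔ i′) (j ℕ.⊔ j′) (l ℕ.⊔ l′)
    ifᶜ (cost≤ p) (cost≤ q) = cost≤ (suc-order (sum-order p q))

    loopᶜ : ∀ {r c i i′ j j′ l l′} → Order (λ e → capacity e r) i j l → Cost c i′ j′ l′ → Cost (loop r c) (i ℕ.+ i′) (j ℕ.+ j′) (l ℕ.+ l′)
    loopᶜ p (cost≤ q) = cost≤ (suc-order (product-order p (suc-order q)))

    eachᶜ : ∀ {X : Set} {c : X → Cmd} B → (∀ x e → time (capacity e) (c x) ℕ.≤ B) → ∀ xs e →
            time (capacity e) (each c xs) ℕ.≤ suc (length xs ℕ.* B)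
    eachᶜ B p []       e = s≤s z≤n
    eachᶜ B p (x ∷ xs) e = ℕₚ.≤-trans (ℕₚ.+-mono-≤ (p x e) (eachᶜ B p xs e)) (ℕₚ.≤-reflexive (ℕₚ.+-suc B _))

    order-n : Order n 1 0 0
    order-n = order 1 λ e → ℕₚ.≤-trans (ℕₚ.n≤1+n (n e)) (ℕₚ.≤-reflexive
      (sym (trans (ℕₚ.+-identityʳ _) (trans (ℕₚ.*-identityʳ _) (ℕₚ.*-identityʳ _)))))

    order-k : Order k 0 1 0
    order-k = order 1 λ e → ℕₚ.≤-reflexive (sym (trans (ℕₚ.+-identityʳ _) (trans (ℕₚ.+-identityʳ _) (trans (ℕₚ.*-identityʳ _) (ℕₚ.*-identityʳ _)))))

    order-b : Order b 0 1 0
    order-b = order (factor order-k) λ e → ℕₚ.≤-trans (b≤k e) (bound order-k e)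

    order-t : Order t 0 2 0
    order-t = order (2 ℕ.* h ℕ.+ 8) λ e → ℕₚ.≤-trans (t≤ e) (ℕₚ.*-monoʳ-≤ (2 ℕ.* h ℕ.+ 8) (ℕₚ.≤-reflexive
      (sym (trans (ℕₚ.+-identityʳ _) (trans (ℕₚ.*-identityʳ _) (cong (k e ℕ.*_) (ℕₚ.*-identityʳ _)))))))

    order-bulk : Order bulk 0 0 1
    order-bulk = order 1 λ e → ℕₚ.≤-reflexive (sym (trans (ℕₚ.+-identityʳ _) (trans (ℕₚ.+-identityʳ _) (trans (ℕₚ.+-identityʳ _) (ℕₚ.*-identityʳ _)))))

    order-R : Order R 0 0 1
    order-R = order (factor order-bulk) λ e → ℕₚ.≤-trans (R≤ e) (bound order-bulk e)

    order-L : Order L 0 0 1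
    order-L = order (factor order-bulk) λ e → ℕₚ.≤-trans (ℕₚ.≤-trans (ℕₚ.n≤1+n (L e)) (ℕₚ.m≤m*n (suc (L e)) _ {{ℕ.>-nonZero (ℕₚ.m^n>0 2 (k e ℕ.* (h ℕ.* b e)))}})) (bound order-bulk e)

    module _ (es : List (Subset h)) (act : Cmd) (a : ℕ) (act-time : ∀ e → time (capacity e) act ℕ.≤ a) where

      private
        distinct-time : ∀ i j e → time (capacity e) (testDistinct i j) ℕ.≤ 8
        distinct-time i j e with does (i Finₚ.≟ j)
        ... | true  = s≤s z≤n
        ... | false = ℕₚ.≤-refl

        edge-time : ∀ e′ e → time (capacity e) (testEdge e′) ℕ.≤ 1 ℕ.+ (suc (length (allFin h) ℕ.* 2) ℕ.+ (suc h ℕ.+ 3))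
        edge-time e′ e = ℕₚ.+-monoʳ-≤ 1 (ℕₚ.+-monoˡ-≤ _ (eachᶜ 2 (λ x e → ℕₚ.≤-refl) (allFin h) e))

        c₁ c₂ c₃ : ℕ
        c₁ = suc (length (allFin h) ℕ.* 8)
        c₂ = suc (length (allFin h) ℕ.* c₁)
        c₃ = suc (length es ℕ.* (1 ℕ.+ (suc (length (allFin h) ℕ.* 2) ℕ.+ (suc h ℕ.+ 3))))

        testAll-time : ∀ e → time (capacity e) (testAll es) ℕ.≤ c₁ ℕ.+ (c₂ ℕ.+ c₃)
        testAll-time e = ℕₚ.+-mono-≤ (eachᶜ 8 (λ j e → ℕₚ.≤-refl) (allFin h) e)
          (ℕₚ.+-mono-≤ (eachᶜ c₁ (λ i e → eachᶜ 8 (distinct-time i) (allFin h) e) (allFin h) e)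
                       (eachᶜ _ edge-time es e))

      body-cost : Cost (body es act) 0 0 0
      body-cost = 1ᶜ refl ⨾ᶜ cost≤ (constant _ testAll-time) ⨾ᶜ ifᶜ (1ᶜ refl) (ifᶜ (1ᶜ refl ⨾ᶜ cost≤ (constant a act-time)) (1ᶜ refl))

      nest-cost : ∀ m → Cost (nest m (body es act)) m 0 0
      nest-cost zero    = body-cost
      nest-cost (suc m) = cost≤ (raise (ℕₚ.≤-reflexive (cong suc (ℕₚ.⊔-identityʳ m))) ℕₚ.≤-refl ℕₚ.≤-refl
        (costs step))
        where
        step : Cost (nest (suc m) (body es act)) (suc (m ℕ.⊔ 0)) 0 0
        step = 1ᶜ refl ⨾ᶜ loopᶜ order-n (nest-cost m ⨾ᶜ 1ᶜ refl)

      scan-cost : Cost (scan es act) h 0 0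
      scan-cost = 1ᶜ refl ⨾ᶜ nest-cost h

open RunningTime

-- Computing the parameters of the sampler on the machine

module Preparation where

  open Triple
  open Sim

  -- lg k is the number of bits of the colours, the least b with k ≤ 2^b.
  lg : ℕ → ℕ
  lg zero    = 0
  lg (suc i) = if 2 ℕ.^ lg i ℕ.≤ᵇ i then suc (lg i) else lg i

  lg-upper : ∀ i → i ℕ.≤ 2 ℕ.^ lg i
  lg-upper zero    = z≤n
  lg-upper (suc i) with 2 ℕ.^ lg i ℕ.≤ᵇ i in eq
  ... | true  = ℕₚ.+-mono-≤ (ℕₚ.m^n>0 2 (lg i)) (ℕₚ.≤-trans (lg-upper i) (ℕₚ.m≤m+n _ 0))
  ... | false = ℕₚ.≰⇒> λ p → subst T eq (ℕₚ.≤⇒≤ᵇ p)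

  lg-lower : ∀ i → 2 ℕ.^ lg (suc i) ℕ.≤ suc (i ℕ.+ i)
  lg-lower zero    = ℕₚ.≤-refl
  lg-lower (suc i) with 2 ℕ.^ lg (suc i) ℕ.≤ᵇ suc i in eq
  ... | true  = let p = ℕₚ.≤ᵇ⇒≤ (2 ℕ.^ lg (suc i)) (suc i) (subst T (sym eq) tt) in
        ℕₚ.≤-trans (ℕₚ.+-mono-≤ p (ℕₚ.≤-trans (ℕₚ.≤-reflexive (ℕₚ.+-identityʳ _)) p)) (ℕₚ.n≤1+n _)
  ... | false = ℕₚ.≤-trans (lg-lower i) (s≤s (ℕₚ.+-mono-≤ (ℕₚ.n≤1+n i) (ℕₚ.n≤1+n i)))

  lg≤ : ∀ i → lg i ℕ.≤ i
  lg≤ zero    = z≤n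
  lg≤ (suc i) with 2 ℕ.^ lg i ℕ.≤ᵇ i
  ... | true  = s≤s (lg≤ i)
  ... | false = ℕₚ.m≤n⇒m≤1+n (lg≤ i)

  -- With `rV` holding i and `rPow` holding 2^(lg i), the truncated difference is 0 exactly when
  -- 2^(lg i) ≤ i, so each round performs one step of the recursion of `lg`.
  widen setWidth : Cmd
  widen = sub rX rPow rV ⨾ ifZero rX ₁ (add rPow rPow rPow ⨾ add rB rB rOne) ₂ nop
  setWidth = const rPow 1 ⨾ loop rK (widen ⨾ add rV rV rOne)

  double : Cmd
  double = add rSum rSum rB ⨾ loop rB (add rT rT rT)

  -- The numbers `t₀` and `L` come from ε and are compiled in; k and b are known only at run time,
  -- so khb is accumulated in `rSum` by repeated addition, and `rT` is doubled along with it.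
  -- `rStrict` is positive exactly when t₀ > 8 + 2khb, and `rP` becomes min(t₀, 8 + 2khb), so that
  -- the static time bound stays free of ε even for the branch with the tosses.
  setRounds : ℕ → ℕ → Cmd
  setRounds t₀ L = const rL L ⨾ const rT L ⨾ loop rK (loop rH double) ⨾
    const rStrict (t₀ ℕ.∸ 8) ⨾ sub rStrict rStrict rSum ⨾ sub rStrict rStrict rSum ⨾
    const rP t₀ ⨾ sub rP rP rStrict

  encoderProgram : ∀ {h} → Hypergraph h → ℕ → ℕ → Cmd
  encoderProgram {h} H t₀ L = const rOne 1 ⨾ const rH h ⨾ setWidth ⨾ setRounds t₀ L ⨾ main H

  module Setup {h n : ℕ} (G : Hypergraph n) (k : ℕ) where

    otherRegs steadyRegs : State → List ℕ
    otherRegs σ = reg σ rN ∷ reg σ rK ∷ reg σ rH ∷ reg σ rT ∷ reg σ rP ∷ reg σ rL ∷ reg σ rOne ∷ reg σ rStrict ∷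
      reg σ rZero ∷ reg σ rSum ∷ []
    steadyRegs σ = reg σ rN ∷ reg σ rK ∷ reg σ rH ∷ reg σ rB ∷ reg σ rL ∷ reg σ rOne ∷ reg σ rZero ∷ []

    record Widening (i j : ℕ) (σ : State) : Set where
      field
        others  : otherRegs σ ≡ n ∷ k ∷ h ∷ 0 ∷ 0 ∷ 0 ∷ 1 ∷ 0 ∷ 0 ∷ 0 ∷ []
        counter : reg σ rV ≡ i
        width   : reg σ rB ≡ lg j
        power   : reg σ rPow ≡ 2 ℕ.^ lg j
        empty   : out σ ≡ []

    open Widening

    widen-run : ∀ i σ → Widening i i σ → Triple G widen σ (Widening i (suc i))
    widen-run i σ w = straight {τ = σ₁} refl (branch (2 ℕ.^ lg i ℕ.≤ᵇ i) refl)
      where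
      σ₁ : State
      σ₁ = tick 1 (set rX (reg σ rPow ℕ.∸ reg σ rV) σ)
      gap : reg σ₁ rX ≡ 2 ℕ.^ lg i ℕ.∸ i
      gap = cong₂ ℕ._∸_ (power w) (counter w)
      branch : ∀ b → (2 ℕ.^ lg i ℕ.≤ᵇ i) ≡ b →
        Triple G (ifZero rX ₁ (add rPow rPow rPow ⨾ add rB rB rOne) ₂ nop) σ₁ (Widening i (suc i))
      branch true eq = if-zero (trans gap (ℕₚ.m≤n⇒m∸n≡0 (ℕₚ.≤ᵇ⇒≤ (2 ℕ.^ lg i) i (subst T (sym eq) tt)))) (triple (_ , refl , record
        { others = others w ; counter = counter w ; empty = empty w
        ; width = trans (cong₂ ℕ._+_ (width w) (cong (λ l → colour l 6) (others w))) (trans (ℕₚ.+-comm (lg i) 1) lg-suc)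
        ; power = trans (cong₂ ℕ._+_ (power w) (power w)) (trans (cong (2 ℕ.^ lg i ℕ.+_) (sym (ℕₚ.+-identityʳ _))) (cong (2 ℕ.^_) lg-suc)) }))
        where
        lg-suc : suc (lg i) ≡ lg (suc i)
        lg-suc = cong (λ b → if b then suc (lg i) else lg i) (sym eq)
      branch false eq = if-suc (trans gap (positive _ (ℕₚ.m<n⇒0<n∸m {i} {2 ℕ.^ lg i} (ℕₚ.≰⇒> λ p → subst T eq (ℕₚ.≤⇒≤ᵇ p))))) (triple (_ , refl , record
        { others = others w ; counter = counter w ; empty = empty w
        ; width = trans (width w) lg-suc ; power = trans (power w) (cong (2 ℕ.^_) lg-suc) }))
        where
        lg-suc : lg i ≡ lg (suc i)
        lg-suc = cong (λ b → if b then suc (lg i) else lg i) (sym eq)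
        positive : ∀ x → 0 ℕ.< x → x ≡ suc (ℕ.pred x)
        positive (suc x) _ = refl

    width-run : ∀ σ → take 10 (view σ) ≡ n ∷ k ∷ h ∷ 0 ∷ 0 ∷ 0 ∷ 0 ∷ 1 ∷ 0 ∷ 0 ∷ [] → reg σ rV ≡ 0 → reg σ rSum ≡ 0 → out σ ≡ [] →
      Triple G setWidth σ (Widening k k)
    width-run σ fixed v s o = straight {τ = σ₁} refl (looping (λ i → Widening i i) k (at 1) initial λ i τ _ w →
        widen-run i (tick 1 τ) (ticked w) ▸ λ υ w′ → triple (_ , refl , record
          { others = others w′ ; counter = trans (cong₂ ℕ._+_ (counter w′) (cong (λ l → colour l 6) (others w′))) (ℕₚ.+-comm i 1)
          ; width = width w′ ; power = power w′ ; empty = empty w′ }))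
      where
      σ₁ : State
      σ₁ = tick 1 (set rPow 1 σ)
      at : ∀ i → colour (take 10 (view σ)) i ≡ colour (n ∷ k ∷ h ∷ 0 ∷ 0 ∷ 0 ∷ 0 ∷ 1 ∷ 0 ∷ 0 ∷ []) i
      at i = cong (λ l → colour l i) fixed
      ticked : ∀ {i τ} → Widening i i τ → Widening i i (tick 1 τ)
      ticked w = record { others = others w ; counter = counter w ; width = width w ; power = power w ; empty = empty w }
      initial : Widening 0 0 (tick 1 σ₁)
      initial = record
        { others = cong₂ (λ l x → colour l 0 ∷ colour l 1 ∷ colour l 2 ∷ colour l 4 ∷ colour l 5 ∷ colour l 6 ∷ colour l 7 ∷ colour l 8 ∷ colour l 9 ∷ x ∷ []) fixed s
        ; counter = v ; width = at 3 ; power = refl ; empty = o }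

    -- Two exponents, because `double` first adds b to `rSum` and then lets `rT` catch up by b
    -- doublings; outside it they coincide.
    record Doubling (b L x y : ℕ) (σ : State) : Set where
      field
        steady : steadyRegs σ ≡ n ∷ k ∷ h ∷ b ∷ L ∷ 1 ∷ 0 ∷ []
        bulk   : reg σ rSum ≡ x
        rounds : reg σ rT ≡ L ℕ.* 2 ℕ.^ y
        silent : out σ ≡ []

      other : ∀ i → colour (steadyRegs σ) i ≡ colour (n ∷ k ∷ h ∷ b ∷ L ∷ 1 ∷ 0 ∷ []) i
      other i = cong (λ l → colour l i) steady

    doubling-tick : ∀ {b L x y τ} → Doubling b L x y τ → Doubling b L x y (tick 1 τ)
    doubling-tick d = record
      { steady = Doubling.steady d ; bulk = Doubling.bulk d ; rounds = Doubling.rounds d ; silent = Doubling.silent d }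

    double-run : ∀ b L x σ → Doubling b L x x σ → Triple G double σ (Doubling b L (x ℕ.+ b) (x ℕ.+ b))
    double-run b L x σ d = straight {τ = σ₁} refl
      (looping (λ i → Doubling b L (x ℕ.+ b) (x ℕ.+ i)) b (other d 3)
        (doubling-tick (record { steady = steady d ; bulk = cong₂ ℕ._+_ (bulk d) (other d 3)
          ; rounds = trans (rounds d) (cong (λ y → L ℕ.* 2 ℕ.^ y) (sym (ℕₚ.+-identityʳ x))) ; silent = silent d }))
        λ i τ _ d → triple (_ , refl , record { steady = steady d ; bulk = bulk d ; silent = silent d
          ; rounds = trans (cong₂ ℕ._+_ (rounds d) (rounds d)) (grow i) }))
      where
      open Doubling
      σ₁ : State
      σ₁ = tick 1 (set rSum (reg σ rSum ℕ.+ reg σ rB) σ)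
      grow : ∀ i → L ℕ.* 2 ℕ.^ (x ℕ.+ i) ℕ.+ L ℕ.* 2 ℕ.^ (x ℕ.+ i) ≡ L ℕ.* 2 ℕ.^ (x ℕ.+ suc i)
      grow i rewrite ℕₚ.+-suc x i | ℕₚ.+-identityʳ (2 ℕ.^ (x ℕ.+ i)) = sym (ℕₚ.*-distribˡ-+ L _ _)

    doubles-run : ∀ b L m c {r} x σ → (∀ y → ∀ τ → Doubling b L y y τ → Triple G c τ (Doubling b L (y ℕ.+ m) (y ℕ.+ m))) →
      ∀ N → reg σ r ≡ N → Doubling b L x x σ → Triple G (loop r c) σ (Doubling b L (x ℕ.+ N ℕ.* m) (x ℕ.+ N ℕ.* m))
    doubles-run b L m c x σ step N eq d = looping (λ i → Doubling b L (x ℕ.+ i ℕ.* m) (x ℕ.+ i ℕ.* m)) N eq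
      (doubling-tick (subst (λ y → Doubling b L y y σ) (sym (ℕₚ.+-identityʳ x)) d))
      λ i τ _ d → weaken (λ υ → subst (λ y → Doubling b L y y υ)
          (trans (ℕₚ.+-assoc x (i ℕ.* m) m) (cong (x ℕ.+_) (ℕₚ.+-comm (i ℕ.* m) m)))) (step _ (tick 1 τ) (doubling-tick d))

    rounds-run : ∀ t₀ L σ → Widening k k σ → let B = k ℕ.* (h ℕ.* lg k) ; s = t₀ ℕ.∸ 8 ℕ.∸ B ℕ.∸ B in
      Triple G (setRounds t₀ L) σ λ τ → out τ ≡ [] ×
        take 10 (view τ) ≡ n ∷ k ∷ h ∷ lg k ∷ L ℕ.* 2 ℕ.^ B ∷ t₀ ℕ.∸ s ∷ L ∷ 1 ∷ s ∷ 0 ∷ []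
    rounds-run t₀ L σ w = straight {τ = σ₁} refl (straight {τ = σ₂} refl
      (doubles-run (lg k) L (h ℕ.* lg k) (loop rH double) 0 σ₂
        (λ y τ d → doubles-run (lg k) L (lg k) double y τ (double-run (lg k) L) h (Doubling.other d 2) d)
        k (Doubling.other initial 1) initial ▸ λ τ d → triple (_ , refl , Doubling.silent d , settings τ d)))
      where
      B s : ℕ
      B = k ℕ.* (h ℕ.* lg k)
      s = t₀ ℕ.∸ 8 ℕ.∸ B ℕ.∸ B
      σ₁ σ₂ : State
      σ₁ = tick 1 (set rL L σ)
      σ₂ = tick 1 (set rT L σ₁)
      initial : Doubling (lg k) L 0 0 σ₂
      initial = record
        { steady = cong₂ (λ l x → colour l 0 ∷ colour l 1 ∷ colour l 2 ∷ x ∷ L ∷ colour l 6 ∷ colour l 8 ∷ []) (others w) (width w)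
        ; bulk = cong (λ l → colour l 9) (others w) ; rounds = sym (ℕₚ.*-identityʳ L) ; silent = empty w }
      settings : ∀ τ → Doubling (lg k) L B B τ → let s′ = t₀ ℕ.∸ 8 ℕ.∸ reg τ rSum ℕ.∸ reg τ rSum in
        reg τ rN ∷ reg τ rK ∷ reg τ rH ∷ reg τ rB ∷ reg τ rT ∷ t₀ ℕ.∸ s′ ∷ reg τ rL ∷ reg τ rOne ∷ s′ ∷ reg τ rZero ∷ []
          ≡ n ∷ k ∷ h ∷ lg k ∷ L ℕ.* 2 ℕ.^ B ∷ t₀ ℕ.∸ s ∷ L ∷ 1 ∷ s ∷ 0 ∷ []
      settings τ d = trans (cong (list (reg τ rSum) (reg τ rT)) (Doubling.steady d))
        (cong₂ (λ x r → list x r (n ∷ k ∷ h ∷ lg k ∷ L ∷ 1 ∷ 0 ∷ [])) (Doubling.bulk d) (Doubling.rounds d))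
        where
        list : ℕ → ℕ → List ℕ → List ℕ
        list x r l = colour l 0 ∷ colour l 1 ∷ colour l 2 ∷ colour l 3 ∷ r ∷ t₀ ℕ.∸ (t₀ ℕ.∸ 8 ℕ.∸ x ℕ.∸ x) ∷
          colour l 4 ∷ colour l 5 ∷ (t₀ ℕ.∸ 8 ℕ.∸ x ℕ.∸ x) ∷ colour l 6 ∷ []

open Preparation

-- Running times of the encoder and the decoder

module ProgramCosts where

  open Triple
  open Sim

  module Costs {h : ℕ} (H : Hypergraph h) where

    open Sizes
    open Order
    open Cost

    private
      1c : ∀ {c} → (∀ {e} → time (capacity h e) c ≡ 1) → Cost h c 0 0 0
      1c = 1ᶜ h

      up : ∀ {c i i′ j j′ l l′} → i ℕ.≤ i′ → j ℕ.≤ j′ → l ℕ.≤ l′ → Cost h c i j l → Cost h c i′ j′ l′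
      up i≤ j≤ l≤ (cost≤ p) = cost≤ (raise h i≤ j≤ l≤ p)

      infixr 5 _⨟_
      _⨟_ : ∀ {c d i i′ j j′ l l′} → Cost h c i j l → Cost h d i′ j′ l′ → Cost h (c ⨾ d) (i ℕ.⊔ i′) (j ℕ.⊔ j′) (l ℕ.⊔ l′)
      _⨟_ = _⨾ᶜ_ h

      h⊔0≤h : h ℕ.⊔ 0 ℕ.≤ h
      h⊔0≤h = ℕₚ.⊔-lub ℕₚ.≤-refl z≤n

    tosses-cost : ∀ {r i j l} → Order h (λ e → capacity h e r) i j l → Cost h (tosses r) (i ℕ.+ 0) (j ℕ.+ 0) (l ℕ.+ 0)
    tosses-cost p = loopᶜ h p (1c refl ⨟ ifᶜ h (1c refl) (1c refl))

    examine-cost : Cost h (examine H) h 2 0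
    examine-cost = up h⊔0≤h ℕₚ.≤-refl ℕₚ.≤-refl
      (scan-cost h (nonemptyEdges H) nop 1 (λ e → ℕₚ.≤-refl) ⨟
       ifᶜ h (ifᶜ h (tosses-cost (order-t h)) (1c refl)) (1c refl))

    attempt-cost : Cost h (attempt H) h 3 0
    attempt-cost = up h⊔0≤h ℕₚ.≤-refl ℕₚ.≤-refl
      (1c refl ⨟ 1c refl ⨟ loopᶜ h (order-k h) (examine-cost ⨟ 1c refl))

    generate-cost : Cost h generate 1 1 0
    generate-cost = 1c refl ⨟ loopᶜ h (order-n h)
      ((1c refl ⨟ loopᶜ h (order-b h) (1c refl ⨟ 1c refl ⨟ 1c refl)) ⨟ 1c refl ⨟ 1c refl)

    output-cost : Cost h output 1 0 0
    output-cost = 1c refl ⨟ loopᶜ h (order-n h) (1c refl ⨟ 1c refl ⨟ 1c refl)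

    1⊔h≤ : 1 ℕ.⊔ h ℕ.≤ suc h
    1⊔h≤ = ℕₚ.⊔-lub (s≤s z≤n) (ℕₚ.n≤1+n h)

    round-cost : Cost h (ifZero rAcc ₁ (generate ⨾ attempt H) ₂ nop) (suc h) 3 0
    round-cost = up (ℕₚ.⊔-lub 1⊔h≤ z≤n) ℕₚ.≤-refl ℕₚ.≤-refl (ifᶜ h (generate-cost ⨟ attempt-cost) (1c refl))

    select-cost : Cost h (select H) (suc h) 3 1
    select-cost = up (ℕₚ.⊔-lub ℕₚ.≤-refl (s≤s z≤n)) ℕₚ.≤-refl ℕₚ.≤-refl
      (loopᶜ h (order-R h) round-cost ⨟ 1c refl ⨟ ifᶜ h generate-cost (1c refl))

    main-cost : Cost h (main H) (suc h) 3 1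
    main-cost = up (ℕₚ.⊔-lub ℕₚ.≤-refl (s≤s z≤n)) ℕₚ.≤-refl ℕₚ.≤-refl
      (1c refl ⨟ tosses-cost (order-L h) ⨟ 1c refl ⨟ select-cost ⨟ output-cost)

    width-cost : Cost h setWidth 0 1 0
    width-cost = 1c refl ⨟ loopᶜ h (order-k h) ((1c refl ⨟ ifᶜ h (1c refl ⨟ 1c refl) (1c refl)) ⨟ 1c refl)

    rounds-cost : ∀ t₀ L → Cost h (setRounds t₀ L) 0 2 0
    rounds-cost t₀ L = 1c refl ⨟ 1c refl ⨟
      loopᶜ h (order-k h) (loopᶜ h (constant h h λ e → ℕₚ.≤-refl) (1c refl ⨟ loopᶜ h (order-b h) (1c refl))) ⨟
      1c refl ⨟ 1c refl ⨟ 1c refl ⨟ 1c refl ⨟ 1c refl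

    encoder-cost : ∀ t₀ L → Cost h (encoderProgram H t₀ L) (suc h) 3 1
    encoder-cost t₀ L = 1c refl ⨟ 1c refl ⨟ width-cost ⨟ rounds-cost t₀ L ⨟ main-cost

    decoder-cost : Cost h (decoderProgram H) (suc h) 0 0
    decoder-cost = up (s≤s h⊔0≤h) ℕₚ.≤-refl ℕₚ.≤-refl
      (1c refl ⨟ 1c refl ⨟ loopᶜ h (order-n h)
        (scan-cost h (family (edge H)) (emitTuple h) (suc (length (allFin h) ℕ.* 1)) (eachᶜ h 1 (λ j e → ℕₚ.≤-refl) (allFin h)) ⨟ 1c refl))

    -- The constant of the theorem must not depend on ε, hence the dummy arguments. The factor
    -- computed by `encoder-cost` is the same for all `t₀` and `L`, so the bound for the actual ones
    -- has this factor by mere evaluation.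
    encoderFactor : ℕ
    encoderFactor = factor (costs (encoder-cost 0 0))

    decoderFactor : ℕ
    decoderFactor = factor (costs decoder-cost)

    module _ {n : ℕ} (G : Hypergraph n) where

      module _ (k t₀ L : ℕ) (k≥1 : 1 ℕ.≤ k) where

        B s : ℕ
        B = k ℕ.* (h ℕ.* lg k)
        s = t₀ ℕ.∸ 8 ℕ.∸ B ℕ.∸ B

        B≤ : B ℕ.≤ h ℕ.* (k ℕ.* k)
        B≤ = ℕₚ.≤-trans (ℕₚ.*-monoʳ-≤ k (ℕₚ.*-monoʳ-≤ h (lg≤ k))) (ℕₚ.≤-reflexive
          (trans (sym (ℕₚ.*-assoc k h k)) (trans (cong (ℕ._* k) (ℕₚ.*-comm k h)) (ℕₚ.*-assoc h k k))))

        t₀∸s≤ : t₀ ℕ.∸ s ℕ.≤ 8 ℕ.+ B ℕ.+ B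
        t₀∸s≤ = ℕₚ.m≤n+o⇒m∸n≤o t₀ s (ℕₚ.≤-trans split (ℕₚ.≤-reflexive (ℕₚ.+-comm (8 ℕ.+ B ℕ.+ B) s)))
          where
          step : ∀ a b → a ℕ.≤ b ℕ.+ (a ℕ.∸ b)
          step a b = ℕₚ.m≤n+m∸n a b
          split : t₀ ℕ.≤ 8 ℕ.+ B ℕ.+ B ℕ.+ s
          split = ℕₚ.≤-trans (step t₀ 8) (ℕₚ.≤-trans (ℕₚ.+-monoʳ-≤ 8 (ℕₚ.≤-trans (step (t₀ ℕ.∸ 8) B)
            (ℕₚ.+-monoʳ-≤ B (step (t₀ ℕ.∸ 8 ℕ.∸ B) B)))) (ℕₚ.≤-reflexive
              (trans (sym (ℕₚ.+-assoc 8 B _)) (sym (ℕₚ.+-assoc (8 ℕ.+ B) B s)))))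

        sizes : Sizes h
        sizes = record
          { n = n ; k = k ; b = lg k ; R = L ℕ.* 2 ℕ.^ B ; t = t₀ ℕ.∸ s ; L = L ; k≥1 = k≥1 ; b≤k = lg≤ k
          ; t≤ = ℕₚ.≤-trans t₀∸s≤ (ℕₚ.≤-trans (ℕₚ.+-mono-≤ (ℕₚ.+-monoʳ-≤ 8 B≤) B≤) collect)
          ; R≤ = ℕₚ.*-monoˡ-≤ (2 ℕ.^ B) (ℕₚ.n≤1+n L) }
          where
          K = k ℕ.* k
          collect : 8 ℕ.+ h ℕ.* K ℕ.+ h ℕ.* K ℕ.≤ (2 ℕ.* h ℕ.+ 8) ℕ.* K
          collect = ℕₚ.≤-trans (ℕₚ.+-monoˡ-≤ (h ℕ.* K) (ℕₚ.+-monoˡ-≤ (h ℕ.* K) (ℕₚ.m≤m*n 8 K {{ℕ.>-nonZero (ℕₚ.*-mono-≤ k≥1 k≥1)}})))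
            (ℕₚ.≤-reflexive (eq h K))
            where
            eq : ∀ h K → 8 ℕ.* K ℕ.+ h ℕ.* K ℕ.+ h ℕ.* K ≡ (2 ℕ.* h ℕ.+ 8) ℕ.* K
            eq = ℕ-Ring.solve 2 (λ h K → ℕ-Ring.con 8 ℕ-Ring.:* K ℕ-Ring.:+ h ℕ-Ring.:* K ℕ-Ring.:+ h ℕ-Ring.:* K ℕ-Ring.:= (ℕ-Ring.con 2 ℕ-Ring.:* h ℕ-Ring.:+ ℕ-Ring.con 8) ℕ-Ring.:* K) refl

        settings : List ℕ
        settings = n ∷ k ∷ h ∷ lg k ∷ L ℕ.* 2 ℕ.^ B ∷ t₀ ℕ.∸ s ∷ L ∷ 1 ∷ s ∷ 0 ∷ []

        σ₁ σ₂ : State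
        σ₁ = tick 1 (set rOne 1 (start n k []))
        σ₂ = tick 1 (set rH h σ₁)

        Prepared : State → Set
        Prepared τ = (out τ ≡ [] × take 10 (view τ) ≡ settings) ×
          clock τ ℕ.≤ 2 ℕ.+ (time (capacity h sizes) setWidth ℕ.+ time (capacity h sizes) (setRounds t₀ L))

        -- A governing register must not be written, so the time is bounded in stages: `setWidth`
        -- writes register 3 and is governed by those below 3, `setRounds` writes 4, 5 and 6 and is
        -- governed by those below 4; only `main` can use all seven.
        prepare : Triple G (setWidth ⨾ setRounds t₀ L) σ₂ Prepared
        prepare = Triple-Always (Setup.width-run G k σ₂ refl refl refl refl) (time-sound G 3 (capacity h sizes) setWidth σ₂ width-governed under₂) ▸
          λ τ (w , c) → weaken (λ υ (p , c′) → p , clocks τ υ c c′) (Triple-Always (Setup.rounds-run G k t₀ L τ w)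
            (time-sound G 4 (capacity h sizes) (setRounds t₀ L) τ rounds-governed (under₃ τ w)))
          where
          width-governed : Governed 3 setWidth
          width-governed = tt , tt , (tt , (tt , tt) , tt) , tt
          rounds-governed : Governed 4 (setRounds t₀ L)
          rounds-governed = tt , tt , (tt , tt , tt , tt , tt) , tt , tt , tt , tt , tt
          under₂ : ∀ r → r ℕ.< 3 → reg σ₂ r ℕ.≤ capacity h sizes r
          under₂ 0 _ = ℕₚ.≤-refl
          under₂ 1 _ = ℕₚ.≤-refl
          under₂ 2 _ = ℕₚ.≤-refl
          under₂ (suc (suc (suc r))) (s≤s (s≤s (s≤s ())))
          under₃ : ∀ τ → Setup.Widening G k k k τ → ∀ r → r ℕ.< 4 → reg τ r ℕ.≤ capacity h sizes r
          under₃ τ w 0 _ = ℕₚ.≤-reflexive (cong (λ l → colour l 0) (Setup.Widening.others w))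
          under₃ τ w 1 _ = ℕₚ.≤-reflexive (cong (λ l → colour l 1) (Setup.Widening.others w))
          under₃ τ w 2 _ = ℕₚ.≤-reflexive (cong (λ l → colour l 2) (Setup.Widening.others w))
          under₃ τ w 3 _ = ℕₚ.≤-reflexive (Setup.Widening.width w)
          under₃ τ w (suc (suc (suc (suc r)))) (s≤s (s≤s (s≤s (s≤s ()))))
          clocks : ∀ τ υ → Within G 3 (capacity h sizes) (time (capacity h sizes) setWidth) σ₂ τ →
            Within G 4 (capacity h sizes) (time (capacity h sizes) (setRounds t₀ L)) τ υ →
            clock υ ℕ.≤ 2 ℕ.+ (time (capacity h sizes) setWidth ℕ.+ time (capacity h sizes) (setRounds t₀ L))
          clocks τ υ c c′ = ℕₚ.≤-trans (ticks c′) (ℕₚ.≤-trans (ℕₚ.+-monoˡ-≤ _ (ticks c)) (ℕₚ.≤-reflexive (ℕₚ.+-assoc 2 (time (capacity h sizes) setWidth) _)))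

        open Sampling H G k (lg k) (L ℕ.* 2 ℕ.^ B) (t₀ ℕ.∸ s) L s using (acceptance; main-sim)

        private
          regroup : ∀ {A : Set} {R : State → A → Set} {x} →
            Rel R (run G (setWidth ⨾ setRounds t₀ L) σ₂ >>= run G (main H)) x → Rel R (run G (encoderProgram H t₀ L) (start n k [])) x
          regroup p = unassoc (run G setWidth σ₂) p
            where
            unassoc : ∀ {A B C D : Set} {Q : C → D → Set} (r : Rand A) {f : A → Rand B} {g : B → Rand C} {x} →
              Rel Q ((r >>= f) >>= g) x → Rel Q (r >>= λ a → f a >>= g) x
            unassoc (ret a)    p          = p
            unassoc (toss l r) (toss p q) = toss (unassoc l p) (unassoc r q)

        encoder-sim : Rel (λ τ cs → out τ ≡ cs) (run G (encoderProgram H t₀ L) (start n k []))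
          (Selection.mechanism (colouring (lg k) n) acceptance L (L ℕ.* 2 ℕ.^ B))
        encoder-sim = regroup (Det-Rel (det prepare) λ τ ((empty , fixed) , _) → rel (main-sim τ fixed empty))

        encoder-time : Always (λ τ → clock τ ℕ.≤ encoderFactor ℕ.* monomial h (suc h) 3 1 sizes) (run G (encoderProgram H t₀ L) (start n k []))
        encoder-time = unassoc-Always (run G setWidth σ₂) (Det-Always (det prepare) λ τ ((_ , fixed) , c) →
          Always-map (λ υ w → ℕₚ.≤-trans (ticks w) (ℕₚ.≤-trans (ℕₚ.+-monoˡ-≤ _ c) (ℕₚ.≤-trans (ℕₚ.≤-reflexive
              (cong (2 ℕ.+_) (ℕₚ.+-assoc (time (capacity h sizes) setWidth) _ _))) (bound (costs (encoder-cost t₀ L)) sizes))))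
            (run G (main H) τ) (time-sound G 7 (capacity h sizes) (main H) τ main-governed (settled τ fixed)))
          where
          unassoc-Always : ∀ {A B C : Set} {P : C → Set} (r : Rand A) {f : A → Rand B} {g : B → Rand C} →
            Always P ((r >>= f) >>= g) → Always P (r >>= λ a → f a >>= g)
          unassoc-Always (ret a)    p       = p
          unassoc-Always (toss l r) (p , q) = unassoc-Always l p , unassoc-Always r q
          Det-Always : ∀ {P : State → Set} {B : Set} {Q : B → Set} {r f} → Det P r → (∀ τ → P τ → Always Q (f τ)) → Always Q (r >>= f)
          Det-Always (τ , refl , p) k = k τ p
          generate-governed : Governed 7 generate
          generate-governed = tt , tt , (tt , tt , tt , tt , tt) , tt , tt
          tosses-governed : ∀ r → T (r ℕ.<ᵇ 7) → Governed 7 (tosses r)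
          tosses-governed r r<7 = r<7 , tt , tt , tt
          main-governed : Governed 7 (main H)
          main-governed = tt , tosses-governed rL tt , tt
            , ((tt , (generate-governed , tt , tt , tt , (governed-scan h 7 tt tt (nonemptyEdges H) nop tt
                  , (tosses-governed rP tt , tt) , tt) , tt) , tt) , tt , generate-governed , tt)
            , tt , tt , tt , tt , tt
          settled : ∀ τ → take 10 (view τ) ≡ settings → ∀ r → r ℕ.< 7 → reg τ r ℕ.≤ capacity h sizes r
          settled τ fixed 0 _ = ℕₚ.≤-reflexive (cong (λ l → colour l 0) fixed)
          settled τ fixed 1 _ = ℕₚ.≤-reflexive (cong (λ l → colour l 1) fixed)
          settled τ fixed 2 _ = ℕₚ.≤-reflexive (cong (λ l → colour l 2) fixed)
          settled τ fixed 3 _ = ℕₚ.≤-reflexive (cong (λ l → colour l 3) fixed)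
          settled τ fixed 4 _ = ℕₚ.≤-reflexive (cong (λ l → colour l 4) fixed)
          settled τ fixed 5 _ = ℕₚ.≤-reflexive (cong (λ l → colour l 5) fixed)
          settled τ fixed 6 _ = ℕₚ.≤-reflexive (cong (λ l → colour l 6) fixed)
          settled τ fixed (suc (suc (suc (suc (suc (suc (suc r))))))) (s≤s (s≤s (s≤s (s≤s (s≤s (s≤s (s≤s ())))))))

      decoder-time : ∀ C → Always (λ τ → clock τ ℕ.≤ decoderFactor ℕ.* suc n ℕ.^ suc h) (run G (decoderProgram H) (start n (length C) C))
      decoder-time C = Always-map (λ τ w → ℕₚ.≤-trans (ticks w) (ℕₚ.≤-trans (bound (costs decoder-cost) e)
          (ℕₚ.≤-reflexive (trivial decoderFactor (suc n ℕ.^ suc h)))))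
        (run G loops σ₂′) (time-sound G 3 (capacity h e) loops σ₂′ governed initial)
        where
        trivial : ∀ a x → a ℕ.* (x ℕ.* 1) ≡ a ℕ.* x
        trivial a x = cong (a ℕ.*_) (ℕₚ.*-identityʳ x)
        e : Sizes h
        -- Register 1 holds the length of `C` here; the successor ensures k ≥ 1. The value leaves no
        -- trace in the bound, where k has exponent 0.
        e = record { n = n ; k = suc (length C) ; b = 0 ; R = 0 ; t = 0 ; L = 0 ; k≥1 = s≤s z≤n ; b≤k = z≤n ; t≤ = z≤n ; R≤ = z≤n }
        loops : Cmd
        loops = loop rN (Tests.scan h (family (edge H)) (emitTuple h) ⨾ add rClass rClass rOne)
        σ₂′ : State
        σ₂′ = tick 1 (set rH h (tick 1 (set rOne 1 (start n (length C) C))))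
        governed : Governed 3 loops
        governed = tt , governed-scan h 3 tt tt (family (edge H)) (emitTuple h) (Governed-each 3 tt (λ j → tt) (allFin h)) , tt
        initial : ∀ r → r ℕ.< 3 → reg σ₂′ r ℕ.≤ capacity h e r
        initial 0 _ = ℕₚ.≤-refl
        initial 1 _ = ℕₚ.n≤1+n _
        initial 2 _ = ℕₚ.≤-refl
        initial (suc (suc (suc r))) (s≤s (s≤s (s≤s ())))

open ProgramCosts

-- Bounds for the partial sums of exp and ln

module Series where

  sumBelow-cong : ∀ m {f g : ℕ → ℚ} → (∀ i → f i ≡ g i) → sumBelow m f ≡ sumBelow m g
  sumBelow-cong zero    f≡g = refl
  sumBelow-cong (suc m) f≡g = cong₂ _+_ (sumBelow-cong m f≡g) (f≡g m)

  sumBelow-mono : ∀ m {f g : ℕ → ℚ} → (∀ i → i ℕ.< m → f i ≤ g i) → sumBelow m f ≤ sumBelow m g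
  sumBelow-mono zero    f≤g = ℚₚ.≤-refl
  sumBelow-mono (suc m) f≤g = ℚₚ.+-mono-≤ (sumBelow-mono m λ i i<m → f≤g i (ℕₚ.m<n⇒m<1+n i<m)) (f≤g m ℕₚ.≤-refl)

  sumBelow-const : ∀ m c → sumBelow m (λ _ → c) ≡ ι m * c
  sumBelow-const zero    c = trans (sym (ℚₚ.*-zeroˡ c)) (cong (_* c) (sym ι-0))
  sumBelow-const (suc m) c = trans (cong (_+ c) (sumBelow-const m c)) (trans
    (solve 2 (λ i c → i :* c :+ c := (con 1ℚ :+ i) :* c) refl (ι m) c) (cong (_* c) (sym (ι-suc m))))

  sumBelow-* : ∀ m c (f : ℕ → ℚ) → sumBelow m (λ i → c * f i) ≡ c * sumBelow m f
  sumBelow-* zero    c f = sym (ℚₚ.*-zeroʳ c)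
  sumBelow-* (suc m) c f = trans (cong (_+ c * f m) (sumBelow-* m c f)) (sym (ℚₚ.*-distribˡ-+ c _ _))

  0≤sumBelow : ∀ m {f : ℕ → ℚ} → (∀ i → 0ℚ ≤ f i) → 0ℚ ≤ sumBelow m f
  0≤sumBelow zero    0≤f = ℚₚ.≤-refl
  0≤sumBelow (suc m) 0≤f = 0≤sumBelow m 0≤f ⊕ 0≤f m

  term≤sumBelow : ∀ m {f : ℕ → ℚ} → (∀ i → 0ℚ ≤ f i) → ∀ {j} → j ℕ.< m → f j ≤ sumBelow m f
  term≤sumBelow (suc m) {f} 0≤f {j} j<1+m with ℕₚ.m≤n⇒m<n∨m≡n (ℕ.s≤s⁻¹ j<1+m)
  ... | inj₁ j<m  = ≤-by (p≤q⇒0≤q-p (term≤sumBelow m 0≤f j<m) ⊕ 0≤f m)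
                      (solve 3 (λ a b c → a :+ c := b :+ ((a :- b) :+ c)) refl (sumBelow m f) (f j) (f m))
  ... | inj₂ refl = ≤-by (0≤sumBelow m 0≤f) (ℚₚ.+-comm (sumBelow m f) (f m))

  reciprocal : ∀ i → (ℤ.+ 1 ℚ./ suc i) * ι (suc i) ≡ 1ℚ
  reciprocal i = ℚₚ.toℚᵘ-injective (ℚᵘₚ.≃-trans (ℚₚ.toℚᵘ-homo-* (ℤ.+ 1 ℚ./ suc i) (ι (suc i)))
    (ℚᵘₚ.≃-trans (ℚᵘₚ.*-cong (ℚₚ.toℚᵘ-fromℚᵘ (ℚᵘ.mkℚᵘ (ℤ.+ 1) i)) (ℚᵘₚ.≃-reflexive (toℚᵘ-ι (suc i)))) (ℚᵘ.*≡* (cross i))))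
    where
    cross : ∀ i → ℤ.+ 1 ℤ.* ℤ.+ suc i ℤ.* ℤ.+ 1 ≡ ℤ.+ 1 ℤ.* (ℤ.+ suc i ℤ.* ℤ.+ 1)
    cross i = ℤₚ.*-assoc (ℤ.+ 1) (ℤ.+ suc i) (ℤ.+ 1)

  cancel-pos : ∀ {a p q} → 0ℚ < q → a * q ≤ p * q → a ≤ p
  cancel-pos {q = q} 0<q = ℚₚ.*-cancelʳ-≤-pos q {{ℚ.positive 0<q}}

  0<ι-suc : ∀ i → 0ℚ < ι (suc i)
  0<ι-suc i = ℚₚ.<-≤-trans (ℚₚ.positive⁻¹ 1ℚ) (subst (1ℚ ≤_) (sym (ι-suc i)) (≤-by (0≤ι i) refl))

  0≤reciprocal : ∀ i → 0ℚ ≤ ℤ.+ 1 ℚ./ suc i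
  0≤reciprocal i = cancel-pos (0<ι-suc i) (subst₂ _≤_ (sym (ℚₚ.*-zeroˡ (ι (suc i)))) (sym (reciprocal i)) 0≤1)

  0≤expTerm : ∀ {x} → 0ℚ ≤ x → ∀ i → 0ℚ ≤ expTerm x i
  0≤expTerm 0≤x zero    = 0≤1
  0≤expTerm 0≤x (suc i) = 0≤expTerm 0≤x i ⊛ 0≤x ⊛ 0≤reciprocal i

  -- For i ≤ j the quotient of consecutive terms is x / i ≥ 2j / i ≥ 2.
  expTerm-lower : ∀ {x} j → ι (2 ℕ.* j) ≤ x → ∀ i → i ℕ.≤ j → ι (2 ℕ.^ i) ≤ expTerm x i
  expTerm-lower {x} j 2j≤x zero    i≤j = ℚₚ.≤-reflexive ι-1
  expTerm-lower {x} j 2j≤x (suc i) i<j = subst₂ _≤_ (trans (ℚₚ.*-comm (ι (2 ℕ.^ i)) (ι 2)) (sym (ι-* 2 (2 ℕ.^ i)))) (sym (ℚₚ.*-assoc (expTerm x i) x r))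
    (*-mono (0≤ι 2) (0≤expTerm 0≤x i) (expTerm-lower j 2j≤x i (ℕₚ.<⇒≤ i<j))
      (cancel-pos (0<ι-suc i) (subst₂ _≤_ (ι-* 2 (suc i)) (sym (trans (ℚₚ.*-assoc x r (ι (suc i)))
        (trans (cong (x *_) (reciprocal i)) (ℚₚ.*-identityʳ x)))) (ℚₚ.≤-trans (ι-mono (ℕₚ.*-monoʳ-≤ 2 i<j)) 2j≤x))))
    where
    r = ℤ.+ 1 ℚ./ suc i
    0≤x : 0ℚ ≤ x
    0≤x = ℚₚ.≤-trans (0≤ι (2 ℕ.* j)) 2j≤x

  -- The single term of index j suffices, so the partial sum only has to reach beyond j.
  exp-lower : ∀ {x} j m → ι (2 ℕ.* j) ≤ x → j ℕ.< m → ι (2 ℕ.^ j) ≤ sumBelow m (expTerm x)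
  exp-lower {x} j m 2j≤x j<m = ℚₚ.≤-trans (expTerm-lower j 2j≤x j ℕₚ.≤-refl)
    (term≤sumBelow m (0≤expTerm (ℚₚ.≤-trans (0≤ι (2 ℕ.* j)) 2j≤x)) j<m)

  ÷₀-* : ∀ p {q} → 0ℚ < q → (p ÷₀ q) * q ≡ p
  ÷₀-* p {q} 0<q with q ℚₚ.≟ 0ℚ
  ... | yes q≡0 = contradiction 0<q (ℚₚ.<-irrefl (sym q≡0))
  ... | no q≢0 = trans (ℚₚ.*-assoc p _ q) (trans (cong (p *_) (ℚₚ.*-inverseˡ q {{ℚ.≢-nonZero q≢0}})) (ℚₚ.*-identityʳ p))

  ÷₀-lower : ∀ {a p q} → 0ℚ < q → a * q ≤ p → a ≤ p ÷₀ q
  ÷₀-lower {p = p} 0<q aq≤p = cancel-pos 0<q (ℚₚ.≤-trans aq≤p (ℚₚ.≤-reflexive (sym (÷₀-* p 0<q))))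

  ÷₀-upper : ∀ {a p q} → 0ℚ < q → p ≤ a * q → p ÷₀ q ≤ a
  ÷₀-upper {p = p} 0<q p≤aq = cancel-pos 0<q (ℚₚ.≤-trans (ℚₚ.≤-reflexive (÷₀-* p 0<q)) p≤aq)

  0<1 : 0ℚ < 1ℚ
  0<1 = ℚₚ.positive⁻¹ 1ℚ

  module Riemann (m : ℕ) (y : ℚ) where

    width : ℚ
    width = (y - 1ℚ) ÷₀ ι (suc m)

    node : ℕ → ℚ
    node i = 1ℚ + ι i * width

    lnSum-nodes : lnSum (suc m) y ≡ sumBelow (suc m) (λ i → width ÷₀ node i)
    lnSum-nodes = trans (cong (λ x → sumBelow (suc m) λ i → ((y - 1ℚ) ÷₀ x) ÷₀ (1ℚ + (ℤ.+ i ℚ./ 1) * ((y - 1ℚ) ÷₀ x))) (sym (ι-def (suc m))))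
      (sumBelow-cong (suc m) λ i → cong (λ x → width ÷₀ (1ℚ + x * width)) (sym (ι-def i)))

    width-* : ι (suc m) * width ≡ y - 1ℚ
    width-* = trans (ℚₚ.*-comm _ width) (÷₀-* (y - 1ℚ) (0<ι-suc m))

    node-last : node (suc m) ≡ y
    node-last = trans (cong (1ℚ +_) width-*) (solve 1 (λ y → con 1ℚ :+ (y :- con 1ℚ) := y) refl y)

    module _ (1≤y : 1ℚ ≤ y) where

      0≤width : 0ℚ ≤ width
      0≤width = ÷₀-lower (0<ι-suc m) (subst (_≤ y - 1ℚ) (sym (ℚₚ.*-zeroˡ (ι (suc m)))) (p≤q⇒0≤q-p 1≤y))

      1≤node : ∀ i → 1ℚ ≤ node i
      1≤node i = ≤-by (0≤ι i ⊛ 0≤width) refl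

      0<node : ∀ i → 0ℚ < node i
      0<node i = ℚₚ.<-≤-trans 0<1 (1≤node i)

      0≤term : ∀ i → 0ℚ ≤ width ÷₀ node i
      0≤term i = ÷₀-lower (0<node i) (subst (_≤ width) (sym (ℚₚ.*-zeroˡ (node i))) 0≤width)

      lnSum-nonneg : 0ℚ ≤ lnSum (suc m) y
      lnSum-nonneg = subst (0ℚ ≤_) (sym lnSum-nodes) (0≤sumBelow (suc m) 0≤term)

      lnSum≤ : lnSum (suc m) y ≤ y - 1ℚ
      lnSum≤ = subst₂ _≤_ (sym lnSum-nodes) (trans (sumBelow-const (suc m) width) width-*)
        (sumBelow-mono (suc m) λ i _ → ÷₀-upper (0<node i) (subst (_≤ width * node i) (ℚₚ.*-identityʳ width) (*-monoʳ 0≤width (1≤node i))))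

      module _ (y≤m : y ≤ ι (suc m)) where

        width≤1 : width ≤ 1ℚ
        width≤1 = ÷₀-upper (0<ι-suc m) (ℚₚ.≤-trans (≤-by 0≤1 (solve 1 (λ y → y := (y :- con 1ℚ) :+ con 1ℚ) refl y))
          (subst (y ≤_) (sym (ℚₚ.*-identityˡ _)) y≤m))

        -- The piecewise linear function that equals j at 2^j lies above log₂
        -- and, on a step of the sum, grows by at most twice the term.
        Dyadic : ℕ → Set
        Dyadic i = Σ ℕ λ j → ι (2 ℕ.^ j) ≤ node i × node i ≤ ι (2 ℕ.^ suc j) ×
          ι j + node i * pow ½ j ≤ 1ℚ + (1ℚ + 1ℚ) * sumBelow i (λ i → width ÷₀ node i)

        ι-2^ : ∀ j → ι (2 ℕ.^ suc j) ≡ ι (2 ℕ.^ j) + ι (2 ℕ.^ j)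
        ι-2^ j = trans (ι-+ (2 ℕ.^ j) _) (cong (λ x → ι (2 ℕ.^ j) + ι x) (ℕₚ.+-identityʳ (2 ℕ.^ j)))

        dyadic : ∀ i → Dyadic i
        dyadic zero = 0 , ℚₚ.≤-reflexive (trans ι-1 (sym node-0)) ,
            ℚₚ.≤-trans (ℚₚ.≤-reflexive node-0) (1≤2^ 1) ,
            ℚₚ.≤-reflexive (trans (cong₂ (λ a b → a + b * 1ℚ) ι-0 node-0) refl)
          where
          node-0 : node 0 ≡ 1ℚ
          node-0 = trans (cong (λ x → 1ℚ + x * width) ι-0) (trans (cong (1ℚ +_) (ℚₚ.*-zeroˡ width)) refl)
        dyadic (suc i) with dyadic i
        ... | j , lo , hi , line = choose (ℚₚ.≤-total (node (suc i)) (ι (2 ℕ.^ suc j)))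
          where
          S = sumBelow i (λ i → width ÷₀ node i)
          τ = width ÷₀ node i
          next : node (suc i) ≡ node i + width
          next = trans (cong (λ x → 1ℚ + x * width) (ι-suc i))
            (solve 2 (λ i w → con 1ℚ :+ (con 1ℚ :+ i) :* w := (con 1ℚ :+ i :* w) :+ w) refl (ι i) width)
          line′ : ι j + node (suc i) * pow ½ j ≤ 1ℚ + (1ℚ + 1ℚ) * (S + τ)
          line′ = ≤-by (p≤q⇒0≤q-p line ⊕ 0≤term i ⊛ p≤q⇒0≤q-p steep) (trans
            (solve 6 (λ J p h S t w → con 1ℚ :+ (con 1ℚ :+ con 1ℚ) :* (S :+ t) :=
               (J :+ (p :+ t :* p) :* h) :+ ((con 1ℚ :+ (con 1ℚ :+ con 1ℚ) :* S :- (J :+ p :* h)) :+ t :* ((con 1ℚ :+ con 1ℚ) :- p :* h)))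
              refl (ι j) (node i) (pow ½ j) S τ width)
            (cong (λ w → (ι j + w * pow ½ j) + ((1ℚ + (1ℚ + 1ℚ) * S - (ι j + node i * pow ½ j)) + τ * ((1ℚ + 1ℚ) - node i * pow ½ j)))
              (trans (cong (node i +_) (÷₀-* width (0<node i))) (sym next))))
            where
            -- On this piece the slope is 2^-j, and `node i` is at most 2^(j+1), so the slope is at
            -- most 2 / `node i`.
            steep : node i * pow ½ j ≤ 1ℚ + 1ℚ
            steep = ℚₚ.≤-trans (*-monoˡ (½^≥0 j) hi) (ℚₚ.≤-reflexive (trans (cong (_* pow ½ j) (ι-2^ j))
              (trans (ℚₚ.*-distribʳ-+ (pow ½ j) (ι (2 ℕ.^ j)) (ι (2 ℕ.^ j))) (cong₂ _+_ (2^-½^ j) (2^-½^ j)))))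
          choose : node (suc i) ≤ ι (2 ℕ.^ suc j) ⊎ ι (2 ℕ.^ suc j) ≤ node (suc i) → Dyadic (suc i)
          -- Past 2^(j+1) the next, flatter piece lies below the continuation of the old one. As a
          -- step has width at most 1, no second power of two is crossed.
          choose (inj₁ below) = j , ℚₚ.≤-trans lo (≤-by 0≤width next) , below , line′
          choose (inj₂ above) = suc j , above , bounded , ℚₚ.≤-trans (≤-by (p≤q⇒0≤q-p past) (trans
              (solve 3 (λ J p h → J :+ p :* h := ((con 1ℚ :+ J) :+ p :* (con ½ :* h)) :+ (p :* (con ½ :* h) :- con 1ℚ)) refl (ι j) (node (suc i)) (pow ½ j))
              (cong (λ J → (J + node (suc i) * pow ½ (suc j)) + (node (suc i) * pow ½ (suc j) - 1ℚ)) (sym (ι-suc j))))) line′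
            where
            past : 1ℚ ≤ node (suc i) * pow ½ (suc j)
            past = subst (_≤ node (suc i) * pow ½ (suc j)) (2^-½^ (suc j)) (*-monoˡ (½^≥0 (suc j)) above)
            bounded : node (suc i) ≤ ι (2 ℕ.^ suc (suc j))
            bounded = subst₂ _≤_ (sym next) (sym (ι-2^ (suc j))) (ℚₚ.+-mono-≤ hi (ℚₚ.≤-trans width≤1 (1≤2^ (suc j))))

        -- If y lies in the dyadic piece j, then L + 1 ≤ j + 2. For j ≥ 1 the piecewise linear bound
        -- makes the sum at least j/2, and 4j ≥ j + 2; for j = 0 it makes it at least (y - 1)/2 ≥
        -- 1/4, which is why y ≥ 3/2 is assumed.
        ln-lower : ∀ L → ι 3 ≤ ι 2 * y → ι (2 ℕ.^ L) < ι 2 * y → ι (suc L) ≤ ι 8 * lnSum (suc m) y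
        ln-lower L 3≤2y 2^L<2y with dyadic (suc m)
        ... | j , lo , hi , line = subst (λ S → ι (suc L) ≤ ι 8 * S) (sym lnSum-nodes) (conclude j refl)
          where
          S = sumBelow (suc m) (λ i → width ÷₀ node i)
          L<2+j : L ℕ.< 2 ℕ.+ j
          L<2+j = ℕₚ.≰⇒> λ 2+j≤L → ℚₚ.<-irrefl refl (ℚₚ.<-≤-trans 2^L<2y (ℚₚ.≤-trans
            (*-monoʳ (0≤ι 2) (subst (_≤ ι (2 ℕ.^ suc j)) node-last hi))
            (ℚₚ.≤-trans (ℚₚ.≤-reflexive (sym (ι-* 2 (2 ℕ.^ suc j)))) (ι-mono (ℕₚ.^-monoʳ-≤ 2 2+j≤L)))))
          two : ι 2 ≡ 1ℚ + 1ℚ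
          two = trans (ι-+ 1 1) (cong₂ _+_ ι-1 ι-1)
          four : ι 4 ≡ (1ℚ + 1ℚ) + (1ℚ + 1ℚ)
          four = trans (ι-+ 2 2) (cong₂ _+_ two two)
          eight : ι 8 ≡ ι 4 * (1ℚ + 1ℚ)
          eight = trans (ι-* 4 2) (cong (ι 4 *_) two)
          scaled : ι 4 * (ι j + node (suc m) * pow ½ j - 1ℚ) ≤ ι 8 * S
          scaled = ℚₚ.≤-trans (*-monoʳ (0≤ι 4) (≤-by (p≤q⇒0≤q-p line)
            (solve 2 (λ a s → (con 1ℚ :+ con 1ℚ) :* s := (a :- con 1ℚ) :+ (con 1ℚ :+ (con 1ℚ :+ con 1ℚ) :* s :- a)) refl (ι j + node (suc m) * pow ½ j) S)))
            (ℚₚ.≤-reflexive (trans (sym (ℚₚ.*-assoc (ι 4) (1ℚ + 1ℚ) S)) (cong (_* S) (sym eight))))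
          conclude : ∀ i → i ≡ j → ι (suc L) ≤ ι 8 * S
          conclude zero refl = ℚₚ.≤-trans (ι-mono (L<2+j)) (ℚₚ.≤-trans (≤-by (0≤ι 2 ⊛ p≤q⇒0≤q-p 3≤2y) (identity y node-last)) scaled)
            where
            identity : ∀ y → node (suc m) ≡ y → ι 4 * (ι 0 + node (suc m) * 1ℚ - 1ℚ) ≡ ι 2 + ι 2 * (ι 2 * y - ι 3)
            identity y eq = trans (cong₂ (λ a b → ι 4 * (a + b * 1ℚ - 1ℚ)) ι-0 eq) (trans (cong (_* (0ℚ + y * 1ℚ - 1ℚ)) four)
              (trans (solve 1 (λ y → ((con 1ℚ :+ con 1ℚ) :+ (con 1ℚ :+ con 1ℚ)) :* (con 0ℚ :+ y :* con 1ℚ :- con 1ℚ) :=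
                  (con 1ℚ :+ con 1ℚ) :+ (con 1ℚ :+ con 1ℚ) :* ((con 1ℚ :+ con 1ℚ) :* y :- (con 1ℚ :+ (con 1ℚ :+ con 1ℚ)))) refl y)
                (cong₂ (λ a b → a + a * (a * y - b)) (sym two) (sym (trans (ι-suc 2) (cong (1ℚ +_) two))))))
          conclude (suc i) refl = ℚₚ.≤-trans (ι-mono (ℕₚ.≤-trans L<2+j enough)) (ℚₚ.≤-trans
              (ℚₚ.≤-trans (ℚₚ.≤-reflexive (ι-* 4 j)) (*-monoʳ (0≤ι 4) (≤-by (p≤q⇒0≤q-p reached)
                (solve 2 (λ a b → a :+ b :- con 1ℚ := a :+ (b :- con 1ℚ)) refl (ι j) (node (suc m) * pow ½ j))))) scaled)
            where
            reached : 1ℚ ≤ node (suc m) * pow ½ j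
            reached = subst (_≤ node (suc m) * pow ½ j) (2^-½^ j) (*-monoˡ (½^≥0 j) lo)
            enough : 2 ℕ.+ suc i ℕ.≤ 4 ℕ.* suc i
            enough = ℕₚ.≤-trans (ℕₚ.+-monoˡ-≤ (suc i) (ℕₚ.≤-trans (ℕₚ.n≤1+n 2) (ℕₚ.m≤m*n 3 (suc i))))
              (ℕₚ.≤-reflexive (ℕₚ.+-comm (3 ℕ.* suc i) (suc i)))

open Series

-- Iterated logarithms near 1, and the approximation ratio

module Approximations where

  2ℚ 4ℚ 8ℚ : ℚ
  2ℚ = 1ℚ + 1ℚ
  4ℚ = 2ℚ + 2ℚ
  8ℚ = 4ℚ + 4ℚ

  ι-2 : ι 2 ≡ 2ℚ
  ι-2 = trans (ι-+ 1 1) (cong₂ _+_ ι-1 ι-1)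

  ι-4 : ι 4 ≡ 4ℚ
  ι-4 = trans (ι-+ 2 2) (cong₂ _+_ ι-2 ι-2)

  ι-8 : ι 8 ≡ 8ℚ
  ι-8 = trans (ι-+ 4 4) (cong₂ _+_ ι-4 ι-4)

  module Logarithms (m : ℕ) (1≤m : 1 ℕ.≤ m) where

    ln2 : ℚ
    ln2 = lnSum (suc m) 2ℚ

    private
      1≤2 : 1ℚ ≤ 2ℚ
      1≤2 = ≤-by 0≤1 refl

      mesh : ℚ
      mesh = Riemann.width m 2ℚ

      mesh-* : ι (suc m) * mesh ≡ 1ℚ
      mesh-* = trans (Riemann.width-* m 2ℚ) refl

      0≤mesh : 0ℚ ≤ mesh
      0≤mesh = Riemann.0≤width m 2ℚ 1≤2

      width-scaled : ∀ y → Riemann.width m y ≡ (y - 1ℚ) * mesh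
      width-scaled y = begin
        Riemann.width m y                        ≡⟨ sym (ℚₚ.*-identityʳ _) ⟩
        Riemann.width m y * 1ℚ                   ≡⟨ cong (Riemann.width m y *_) (sym mesh-*) ⟩
        Riemann.width m y * (ι (suc m) * mesh)
          ≡⟨ solve 3 (λ w i u → w :* (i :* u) := i :* w :* u) refl (Riemann.width m y) (ι (suc m)) mesh ⟩
        ι (suc m) * Riemann.width m y * mesh     ≡⟨ cong (_* mesh) (Riemann.width-* m y) ⟩
        (y - 1ℚ) * mesh ∎
        where open ≡-Reasoning

    ln2≤1 : ln2 ≤ 1ℚ
    ln2≤1 = Riemann.lnSum≤ m 2ℚ 1≤2

    2≤8ln2 : 2ℚ ≤ 8ℚ * ln2
    2≤8ln2 = subst₂ _≤_ ι-2 (cong (_* ln2) ι-8) (Riemann.ln-lower m 2ℚ 1≤2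
      (subst (_≤ ι (suc m)) ι-2 (ι-mono (s≤s 1≤m))) 1
      (subst (ι 3 ≤_) (trans (ι-* 2 2) (cong (ι 2 *_) ι-2)) (ι-mono (ℕₚ.n≤1+n 3)))
      (subst₂ _<_ (sym ι-2) (cong (_* 2ℚ) (sym ι-2)) (ℚₚ.≤-<-trans (ℚₚ.≤-reflexive (sym (ℚₚ.+-identityʳ 2ℚ)))
        (ℚₚ.+-monoʳ-< 2ℚ (ℚₚ.positive⁻¹ 2ℚ)))))

    0<ln2 : 0ℚ < ln2
    0<ln2 = ℚₚ.≰⇒> λ ln2≤0 → ℚₚ.<-irrefl refl (ℚₚ.<-≤-trans (ℚₚ.positive⁻¹ 2ℚ)
      (ℚₚ.≤-trans 2≤8ln2 (subst (8ℚ * ln2 ≤_) (ℚₚ.*-zeroʳ 8ℚ) (*-monoʳ (ℚₚ.<⇒≤ (ℚₚ.positive⁻¹ 8ℚ)) ln2≤0))))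

    -- By concavity of the logarithm.
    log₂-lower : ∀ {u} v → 0ℚ ≤ u → u ≤ 1ℚ → u ≤ v → u ≤ lnSum (suc m) (1ℚ + v) ÷₀ ln2
    log₂-lower {u} v 0≤u u≤1 u≤v = ÷₀-lower 0<ln2 (subst₂ _≤_
      (trans (sumBelow-* (suc m) u _) (cong (u *_) (sym (Riemann.lnSum-nodes m 2ℚ))))
      (sym (Riemann.lnSum-nodes m (1ℚ + v)))
      (sumBelow-mono (suc m) λ i _ → ÷₀-lower (Riemann.0<node m (1ℚ + v) 1≤1+v i) (pointwise i)))
      where
      0≤v : 0ℚ ≤ v
      0≤v = ℚₚ.≤-trans 0≤u u≤v
      1≤1+v : 1ℚ ≤ 1ℚ + v
      1≤1+v = ≤-by 0≤v refl
      pointwise : ∀ i → u * (mesh ÷₀ Riemann.node m 2ℚ i) * (1ℚ + ι i * Riemann.width m (1ℚ + v)) ≤ Riemann.width m (1ℚ + v)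
      pointwise i = subst (λ w → u * τ * (1ℚ + ι i * w) ≤ w) (sym width-v)
        (≤-by (Riemann.0≤term m 2ℚ 1≤2 i ⊛ (p≤q⇒0≤q-p u≤v ⊕ 0≤ι i ⊛ 0≤mesh ⊛ 0≤v ⊛ p≤q⇒0≤q-p u≤1))
          (trans (cong (v *_) (sym (÷₀-* mesh (Riemann.0<node m 2ℚ 1≤2 i))))
            (solve 5 (λ u v t i w → v :* (t :* (con 1ℚ :+ i :* w)) :=
                u :* t :* (con 1ℚ :+ i :* (v :* w)) :+ t :* ((v :- u) :+ i :* w :* v :* (con 1ℚ :- u)))
              refl u v τ (ι i) mesh)))
        where
        τ = mesh ÷₀ Riemann.node m 2ℚ i
        width-v : Riemann.width m (1ℚ + v) ≡ v * mesh
        width-v = trans (width-scaled (1ℚ + v)) (cong (_* mesh) (solve 1 (λ v → con 1ℚ :+ v :- con 1ℚ := v) refl v))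

    -- All nodes are at least ½ and the step is at least -δ times the mesh, so each of the terms is
    -- at least -2δ times the mesh.
    lnSum-near-one : ∀ {δ} z → 0ℚ ≤ δ → δ ≤ ½ → 1ℚ - δ ≤ z → - (2ℚ * δ) ≤ lnSum (suc m) z
    lnSum-near-one {δ} z 0≤δ δ≤½ z≥ = subst₂ _≤_ total (sym (Riemann.lnSum-nodes m z))
      (sumBelow-mono (suc m) λ i i< → ÷₀-lower (0<node i (ℕₚ.<⇒≤ i<))
        (≤-by (slack ⊕ 0≤δ ⊛ 0≤mesh ⊛ (0≤½⁻ i (ℕₚ.<⇒≤ i<) ⊕ 0≤½⁻ i (ℕₚ.<⇒≤ i<)))
          (solve 4 (λ w d u n → w := (:- ((con 1ℚ :+ con 1ℚ) :* d)) :* u :* n :+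
             ((w :+ d :* u) :+ d :* u :* ((n :- con ½) :+ (n :- con ½)))) refl w δ mesh (Riemann.node m z i))))
      where
      w = Riemann.width m z
      total : sumBelow (suc m) (λ _ → (- (2ℚ * δ)) * mesh) ≡ - (2ℚ * δ)
      total = trans (sumBelow-const (suc m) _) (trans
        (solve 3 (λ i d u → i :* (d :* u) := d :* (i :* u)) refl (ι (suc m)) (- (2ℚ * δ)) mesh)
        (trans (cong ((- (2ℚ * δ)) *_) mesh-*) (ℚₚ.*-identityʳ _)))
      slack : 0ℚ ≤ w + δ * mesh
      slack = subst (0ℚ ≤_) (sym (trans (cong (_+ δ * mesh) (width-scaled z))
        (solve 3 (λ z d u → (z :- con 1ℚ) :* u :+ d :* u := (z :- (con 1ℚ :- d)) :* u) refl z δ mesh)))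
        (p≤q⇒0≤q-p z≥ ⊛ 0≤mesh)
      ιu≤1 : ∀ i → i ℕ.≤ suc m → ι i * mesh ≤ 1ℚ
      ιu≤1 i i≤ = subst (ι i * mesh ≤_) mesh-* (*-monoˡ 0≤mesh (ι-mono i≤))
      0≤½⁻ : ∀ i → i ℕ.≤ suc m → 0ℚ ≤ Riemann.node m z i - ½
      0≤½⁻ i i≤ = subst (0ℚ ≤_) (solve 4 (λ d i u w → (con ½ :- d) :+ d :* (con 1ℚ :- i :* u) :+ i :* (w :+ d :* u)
          := con 1ℚ :+ i :* w :- con ½) refl δ (ι i) mesh w)
        (p≤q⇒0≤q-p δ≤½ ⊕ 0≤δ ⊛ p≤q⇒0≤q-p (ιu≤1 i i≤) ⊕ 0≤ι i ⊛ slack)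
      0<node : ∀ i → i ℕ.≤ suc m → 0ℚ < Riemann.node m z i
      0<node i i≤ = ℚₚ.<-≤-trans (ℚₚ.positive⁻¹ ½) (≤-by (0≤½⁻ i i≤) (solve 1 (λ n → n := con ½ :+ (n :- con ½)) refl (Riemann.node m z i)))

    -- ε ≥ 1 holds only in the limit: the rationals representing ε may lie slightly below 1, where
    -- log₂ log₂ (1 + ε) is negative. This limits the damage.
    log-log-lower : ∀ {δ} v → 0ℚ ≤ δ → δ ≤ ½ → 1ℚ - δ ≤ v →
      - (8ℚ * δ) ≤ lnSum (suc m) (lnSum (suc m) (1ℚ + v) ÷₀ ln2) ÷₀ ln2
    log-log-lower {δ} v 0≤δ δ≤½ v≥ = ÷₀-lower 0<ln2 (ℚₚ.≤-trans
      (≤-by (0≤δ ⊛ p≤q⇒0≤q-p 2≤8ln2) (solve 2 (λ d l → :- ((con 2ℚ) :* d) := (:- ((con 8ℚ) :* d)) :* l :+ d :* (con 8ℚ :* l :- con 2ℚ)) refl δ ln2))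
      (lnSum-near-one _ 0≤δ δ≤½ (log₂-lower v (p≤q⇒0≤q-p (ℚₚ.≤-trans δ≤½ ½≤1)) (≤-by 0≤δ
        (solve 1 (λ d → con 1ℚ := (con 1ℚ :- d) :+ d) refl δ)) v≥)))

    log₂-dominates : ∀ y → 1ℚ ≤ y → lnSum (suc m) y ≤ lnSum (suc m) y ÷₀ ln2
    log₂-dominates y 1≤y = ÷₀-lower 0<ln2 (subst (lnSum (suc m) y * ln2 ≤_) (ℚₚ.*-identityʳ _)
      (*-monoʳ (Riemann.lnSum-nonneg m y 1≤y) ln2≤1))

  -- λ, μ and e stand for log₂ k, log₂ log₂ (1 + ε) and ε; E is the expected value.
  ratio-bound : ∀ {E λ′ μ e} h k b t → 1 ℕ.≤ k → 1 ℕ.≤ b → ½ ≤ e → e ≤ ι (4 ℕ.* t ℕ.+ 6) →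
    ι (suc b) ≤ 8ℚ * λ′ → - 1ℚ ≤ 8ℚ * μ → 0ℚ ≤ E →
    ι t * ι k - (ι (k ℕ.* (h ℕ.* b)) + 1ℚ + 2ℚ * ι k) ≤ ι t * E →
    ∀ c → 8 ℕ.* (4 ℕ.* h ℕ.+ 18) ℕ.≤ c →
    (1ℚ - ι c * ((λ′ + μ ÷₀ ι k) ÷₀ e)) * ι k ≤ E
  ratio-bound {E} {λ′} {μ} {e} h (suc k) (suc b) t 1≤k 1≤b ½≤e e≤ b≤λ μ≥ 0≤E tE c c≥ =
    ≤-by (p≤q⇒0≤q-p (ℚₚ.≤-trans small (*-monoˡ 0≤Xk (ι-mono c≥))))
      (solve 4 (λ E c X k → E := (con 1ℚ :- c :* X) :* k :+ (c :* (X :* k) :- (k :- E))) refl E (ι c) X K)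
    where
    K = ι (suc k)
    b′ = ι (suc b)
    X = (λ′ + μ ÷₀ K) ÷₀ e
    0<e : 0ℚ < e
    0<e = ℚₚ.<-≤-trans (ℚₚ.positive⁻¹ ½) ½≤e
    1≤K : 1ℚ ≤ K
    1≤K = subst (_≤ K) ι-1 (ι-mono (s≤s (z≤n {k})))
    1≤b′ : 1ℚ ≤ b′
    1≤b′ = subst (_≤ b′) ι-1 (ι-mono (s≤s (z≤n {b})))
    Xke : X * K * e ≡ λ′ * K + μ
    Xke = trans (solve 3 (λ x k e → x :* k :* e := x :* e :* k) refl X K e)
      (trans (cong (_* K) (÷₀-* (λ′ + μ ÷₀ K) 0<e)) (trans (ℚₚ.*-distribʳ-+ K λ′ (μ ÷₀ K)) (cong (λ′ * K +_) (÷₀-* μ (0<ι-suc k)))))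
    -- The spare 1 in b + 1 ≤ 8λ, multiplied by K ≥ 1, absorbs the possibly negative 8μ ≥ -1.
    bk≤ : b′ * K ≤ 8ℚ * (X * K * e)
    bk≤ = subst (b′ * K ≤_) (cong (8ℚ *_) (sym Xke)) (≤-by
      ((p≤q⇒0≤q-p b≤λ ⊛ 0≤ι (suc k) ⊕ p≤q⇒0≤q-p μ≥) ⊕ p≤q⇒0≤q-p 1≤K)
      (trans (solve 4 (λ l K m b → con 8ℚ :* (l :* K :+ m) := b :* K :+
          ((con 8ℚ :* l :- (con 1ℚ :+ b)) :* K :+ (con 8ℚ :* m :- (:- con 1ℚ)) :+ (K :- con 1ℚ))) refl λ′ K μ b′)
        (cong (λ z → b′ * K + ((8ℚ * λ′ - z) * K + (8ℚ * μ - (- 1ℚ)) + (K - 1ℚ))) (sym (ι-suc (suc b))))))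
    0≤Xke : 0ℚ ≤ 8ℚ * (X * K * e)
    0≤Xke = ℚₚ.≤-trans (0≤ι (suc b) ⊛ 0≤ι (suc k)) bk≤
    0≤Xk : 0ℚ ≤ X * K
    0≤Xk = cancel-pos 0<e (subst (_≤ X * K * e) (sym (ℚₚ.*-zeroˡ e)) (ℚₚ.*-cancelˡ-≤-pos 8ℚ
      (subst (_≤ 8ℚ * (X * K * e)) (sym (ℚₚ.*-zeroʳ 8ℚ)) 0≤Xke)))
    D = ι (4 ℕ.* t ℕ.+ 6)
    D≡ : D ≡ 4ℚ * ι t + (4ℚ + 2ℚ)
    D≡ = trans (ι-+ (4 ℕ.* t) 6) (cong₂ _+_ (trans (ι-* 4 t) (cong (_* ι t) ι-4)) (trans (ι-+ 4 2) (cong₂ _+_ ι-4 ι-2)))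
    h′ = ι h
    H≡ : ι (8 ℕ.* (4 ℕ.* h ℕ.+ 18)) ≡ 8ℚ * (4ℚ * h′ + (8ℚ + 8ℚ + 2ℚ))
    H≡ = trans (ι-* 8 (4 ℕ.* h ℕ.+ 18)) (cong₂ _*_ ι-8 (trans (ι-+ (4 ℕ.* h) 18) (cong₂ _+_
      (trans (ι-* 4 h) (cong (_* h′) ι-4)) (trans (ι-+ 16 2) (cong₂ _+_ (trans (ι-+ 8 8) (cong₂ _+_ ι-8 ι-8)) ι-2)))))
    B≡ : ι (suc k ℕ.* (h ℕ.* suc b)) ≡ K * (h′ * b′)
    B≡ = trans (ι-* (suc k) (h ℕ.* suc b)) (cong (K *_) (ι-* h (suc b)))
    scaled : (K - E) * D ≤ ι (8 ℕ.* (4 ℕ.* h ℕ.+ 18)) * (X * K) * D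
    scaled = ℚₚ.≤-trans deficit (ℚₚ.≤-trans
      (*-monoʳ (0≤4h18) (ℚₚ.≤-trans bk≤ (*-monoʳ (ℚₚ.<⇒≤ (ℚₚ.positive⁻¹ 8ℚ)) (*-monoʳ 0≤Xk e≤))))
      (ℚₚ.≤-reflexive (trans (solve 3 (λ a x d → a :* (con 8ℚ :* (x :* d)) := con 8ℚ :* a :* x :* d) refl (4ℚ * h′ + (8ℚ + 8ℚ + 2ℚ)) (X * K) D)
        (cong (λ z → z * (X * K) * D) (sym H≡)))))
      where
      0≤4h18 : 0ℚ ≤ 4ℚ * h′ + (8ℚ + 8ℚ + 2ℚ)
      0≤4h18 = (ℚₚ.<⇒≤ (ℚₚ.positive⁻¹ 4ℚ) ⊛ 0≤ι h) ⊕ ℚₚ.<⇒≤ (ℚₚ.positive⁻¹ (8ℚ + 8ℚ + 2ℚ))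
      -- Since D = 4t + 6, the left side is at most 4(hbK + 1 + 2K) + 6K; with K ≥ 1 and b ≥ 1 the
      -- lower terms add up to (4 + 8 + 6)bK.
      deficit : (K - E) * D ≤ (4ℚ * h′ + (8ℚ + 8ℚ + 2ℚ)) * (b′ * K)
      deficit = subst (λ D → (K - E) * D ≤ (4ℚ * h′ + (8ℚ + 8ℚ + 2ℚ)) * (b′ * K)) (sym D≡) (≤-by
        (ℚₚ.<⇒≤ (ℚₚ.positive⁻¹ 4ℚ) ⊛ p≤q⇒0≤q-p (subst (λ B → ι t * K - (B + 1ℚ + 2ℚ * K) ≤ ι t * E) B≡ tE)
          ⊕ ℚₚ.<⇒≤ (ℚₚ.positive⁻¹ (4ℚ + 2ℚ)) ⊛ 0≤E
          ⊕ ℚₚ.<⇒≤ (ℚₚ.positive⁻¹ 4ℚ) ⊛ p≤q⇒0≤q-p 1≤K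
          ⊕ ℚₚ.<⇒≤ (ℚₚ.positive⁻¹ (8ℚ + 8ℚ + 2ℚ)) ⊛ (p≤q⇒0≤q-p 1≤b′ ⊛ 0≤ι (suc k)))
        (solve 5 (λ t K E h b → (con 4ℚ :* h :+ con (8ℚ + 8ℚ + 2ℚ)) :* (b :* K) :=
            (K :- E) :* (con 4ℚ :* t :+ con (4ℚ + 2ℚ)) :+
            (con 4ℚ :* (t :* E :- (t :* K :- (K :* (h :* b) :+ con 1ℚ :+ con 2ℚ :* K))) :+ con (4ℚ + 2ℚ) :* E
              :+ con 4ℚ :* (K :- con 1ℚ) :+ con (8ℚ + 8ℚ + 2ℚ) :* ((b :- con 1ℚ) :* K)))
          refl (ι t) K E h′ b′))
    small : K - E ≤ ι (8 ℕ.* (4 ℕ.* h ℕ.+ 18)) * (X * K)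
    small = cancel-pos (ℚₚ.<-≤-trans 0<e e≤) scaled

open Approximations

-- Privacy of the encoder

module Privacy where

  lg-suc≤ : ∀ i → lg (suc i) ℕ.≤ i
  lg-suc≤ zero    = z≤n
  lg-suc≤ (suc i) with 2 ℕ.^ lg (suc i) ℕ.≤ᵇ suc i
  ... | true  = s≤s (lg-suc≤ i)
  ... | false = ℕₚ.m≤n⇒m≤1+n (lg-suc≤ i)

  4*≤2^ : ∀ L → 4 ℕ.* L ℕ.≤ 2 ℕ.^ L ℕ.+ 4
  4*≤2^ 0 = z≤n
  4*≤2^ 1 = ℕₚ.m≤m+n 4 2
  4*≤2^ (suc (suc L)) = go L
    where
    go : ∀ L → 4 ℕ.* (2 ℕ.+ L) ℕ.≤ 2 ℕ.^ (2 ℕ.+ L) ℕ.+ 4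
    go zero    = ℕₚ.≤-refl
    go (suc L) = ℕₚ.≤-trans (ℕₚ.≤-reflexive (ℕₚ.*-suc 4 (2 ℕ.+ L))) (ℕₚ.≤-trans (ℕₚ.+-monoʳ-≤ 4 (go L))
      (ℕₚ.≤-trans (ℕₚ.+-monoˡ-≤ (2 ℕ.^ (2 ℕ.+ L) ℕ.+ 4) (ℕₚ.^-monoʳ-≤ 2 (ℕₚ.m≤m+n 2 L)))
        (ℕₚ.≤-reflexive (trans (sym (ℕₚ.+-assoc (2 ℕ.^ (2 ℕ.+ L)) _ 4))
          (cong (λ z → 2 ℕ.^ (2 ℕ.+ L) ℕ.+ z ℕ.+ 4) (sym (ℕₚ.+-identityʳ _)))))))

  lg-half : ∀ t → 2 ℕ.* lg (suc t) ℕ.≤ t ℕ.+ 9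
  lg-half t = ℕₚ.*-cancelˡ-≤ 2 (ℕₚ.≤-trans (ℕₚ.≤-reflexive (sym (ℕₚ.*-assoc 2 2 (lg (suc t)))))
    (ℕₚ.≤-trans (4*≤2^ (lg (suc t))) (ℕₚ.≤-trans (ℕₚ.+-monoˡ-≤ 4 (lg-lower t)) (ℕₚ.≤-trans
      (ℕₚ.m≤m+n (suc (t ℕ.+ t) ℕ.+ 4) 13) (ℕₚ.≤-reflexive (eq t))))))
    where
    eq : ∀ t → suc (t ℕ.+ t) ℕ.+ 4 ℕ.+ 13 ≡ 2 ℕ.* (t ℕ.+ 9)
    eq = ℕ-Ring.solve 1 (λ t → ℕ-Ring.con 1 ℕ-Ring.:+ (t ℕ-Ring.:+ t) ℕ-Ring.:+ ℕ-Ring.con 4 ℕ-Ring.:+ ℕ-Ring.con 13 ℕ-Ring.:= ℕ-Ring.con 2 ℕ-Ring.:* (t ℕ-Ring.:+ ℕ-Ring.con 9)) refl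

  -- In the strict regime all outcome probabilities are within a factor
  -- (1 + T) 2^L of each other.
  strict-range : ∀ t B → let L = lg (suc t) in ∀ s → t ℕ.∸ 8 ℕ.∸ B ℕ.∸ B ≡ suc s →
    suc (L ℕ.* 2 ℕ.^ B) ℕ.* 2 ℕ.^ L ℕ.≤ 2 ℕ.^ (t ℕ.+ t)
  strict-range t B s eq = ℕₚ.≤-trans (ℕₚ.*-monoˡ-≤ (2 ℕ.^ L) (ℕₚ.≤-trans
      (ℕₚ.+-monoˡ-≤ (L ℕ.* 2 ℕ.^ B) (ℕₚ.m^n>0 2 B)) (ℕₚ.*-monoˡ-≤ (2 ℕ.^ B) (n<2^n L))))
    (ℕₚ.≤-trans (ℕₚ.≤-reflexive (trans (cong (ℕ._* 2 ℕ.^ L) (sym (ℕₚ.^-distribˡ-+-* 2 L B))) (sym (ℕₚ.^-distribˡ-+-* 2 (L ℕ.+ B) L))))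
      (ℕₚ.^-monoʳ-≤ 2 exponent))
    where
    L = lg (suc t)
    -- The threshold 8 + 2B is chosen for this: the exponent 2L + B is at most t + 9 + B by
    -- `lg-half`, and the strict regime has 9 + 2B ≤ t.
    t≥ : 9 ℕ.+ (B ℕ.+ B) ℕ.≤ t
    t≥ = ℕₚ.≰⇒> λ t≤ → ℕₚ.0≢1+n (trans (sym (ℕₚ.m≤n⇒m∸n≡0 (ℕₚ.≤-trans (ℕₚ.≤-reflexive (ℕₚ.∸-+-assoc t 8 B))
      (ℕₚ.m≤n+o⇒m∸n≤o t (8 ℕ.+ B) (ℕₚ.≤-trans t≤ (ℕₚ.≤-reflexive (sym (ℕₚ.+-assoc 8 B B)))))))) eq)
    exponent : L ℕ.+ B ℕ.+ L ℕ.≤ t ℕ.+ t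
    exponent = ℕₚ.≤-trans (ℕₚ.≤-reflexive (rearrange L B)) (ℕₚ.≤-trans (ℕₚ.+-monoˡ-≤ B (lg-half t))
      (ℕₚ.≤-trans (ℕₚ.≤-reflexive (ℕₚ.+-assoc t 9 B)) (ℕₚ.+-monoʳ-≤ t (ℕₚ.≤-trans (ℕₚ.+-monoʳ-≤ 9 (ℕₚ.m≤m+n B B)) t≥))))
      where
      rearrange : ∀ L B → L ℕ.+ B ℕ.+ L ≡ 2 ℕ.* L ℕ.+ B
      rearrange = ℕ-Ring.solve 2 (λ L B → L ℕ-Ring.:+ B ℕ-Ring.:+ L ℕ-Ring.:= ℕ-Ring.con 2 ℕ-Ring.:* L ℕ-Ring.:+ B) refl

  only : ∀ {n} (p : Subset n → Bool) → length (family p) ℕ.≤ 1 → Σ (Subset n) λ e₀ → ∀ e → e ≢ e₀ → p e ≡ false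
  only {n} p short = pick (family p) short (λ e → ∈-family⁺ p)
    where
    pick : ∀ l → length l ℕ.≤ 1 → (∀ e → p e ≡ true → e ∈ l) → Σ (Subset n) λ e₀ → ∀ e → e ≢ e₀ → p e ≡ false
    pick []       _ complete = Vec.replicate n false , λ e _ → absent e (p e) refl
      where
      absent : ∀ e b → p e ≡ b → p e ≡ false
      absent e false eq = eq
      absent e true  eq with complete e eq
      ... | ()
    pick (e₀ ∷ []) _ complete = e₀ , λ e e≢ → absent e (p e) refl e≢
      where
      absent : ∀ e b → p e ≡ b → e ≢ e₀ → p e ≡ false
      absent e false eq e≢ = eq
      absent e true  eq e≢ with complete e eq
      ... | here e≡e₀ = contradiction e≡e₀ e≢
    pick (_ ∷ _ ∷ _) (s≤s ()) complete

  xor-false : ∀ a b → a xor b ≡ false → a ≡ b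
  xor-false false b eq = sym eq
  xor-false true  true eq = refl

  nonemptyEdges⁻ : ∀ {h} (H : Hypergraph h) {e} → e ∈ nonemptyEdges H → edge H e ≡ true × Nonempty e
  nonemptyEdges⁻ H {e} e∈ with ∈-filter⁻ (T? ∘ λ e → does (nonempty? e)) {xs = family (edge H)} e∈
  ... | e∈′ , ne = ∈-family⁻ (edge H) e∈′ , inhabited ne
    where
    inhabited : T (does (nonempty? e)) → Nonempty e
    inhabited t with nonempty? e
    ... | yes p = p

  -- A hyperedge only matters to the class of its vertices, and the empty
  -- hyperedge to none.
  sensitivity : ∀ {h n} (H : Hypergraph h) (G G′ : Hypergraph n) → Neighbors G G′ → ∀ χ →
    Σ ℕ λ γ₀ → ∀ γ → γ ≢ γ₀ → Classes.has G (nonemptyEdges H) χ γ ≡ Classes.has G′ (nonemptyEdges H) χ γ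
  sensitivity {h} {n} H G G′ nb χ = γ₀ , λ γ γ≢ → bool-≡
    (λ t → ≡⇒T (transfer G G′ same γ γ≢ (T⇒≡ t))) (λ t → ≡⇒T (transfer G′ G (λ e e≢ → sym (same e e≢)) γ γ≢ (T⇒≡ t)))
    where
    es = nonemptyEdges H
    differing = only (λ e → edge G e xor edge G′ e) nb
    e₀ = proj₁ differing
    same : ∀ e → e ≢ e₀ → edge G e ≡ edge G′ e
    same e e≢ = xor-false (edge G e) (edge G′ e) (proj₂ differing e e≢)
    class : Σ ℕ λ γ₀ → ∀ v → v ∈ˢ e₀ → ∀ γ → γ ≢ γ₀ → ∃ λ u → u ∈ˢ e₀ × χ (toℕ u) ≢ γ
    class with nonempty? e₀
    ... | yes (u , u∈) = χ (toℕ u) , λ _ _ γ γ≢ → u , u∈ , λ eq → γ≢ (sym eq)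
    ... | no  none     = 0 , λ v v∈ → contradiction (v , v∈) none
    γ₀ = proj₁ class
    transfer : ∀ (G G′ : Hypergraph n) → (∀ e → e ≢ e₀ → edge G e ≡ edge G′ e) → ∀ γ → γ ≢ γ₀ →
      Classes.has G es χ γ ≡ true → Classes.has G′ es χ γ ≡ true
    transfer G G′ same γ γ≢ has with Classes.has⁻ G es {χ} {γ} has
    ... | t , g = Classes.has⁺ G′ es {χ} {γ} t (Classes.good⁺ G′ es {χ} {γ} t record
        { coloured = coloured ; distinct = distinct
        ; present = λ {e} e∈ → trans (sym (same _ (avoid e e∈))) (present e∈) })
      where
      open Classes.Good (Classes.good⁻ G es {χ} {γ} t g)
      avoid : ∀ e → e ∈ es → image (lookup t) e ≢ e₀
      -- As `e` is nonempty, so is `e₀`, and it has a vertex coloured other than γ. That vertex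
      -- cannot lie in the image of a tuple coloured γ.
      avoid e e∈ eq with proj₂ (nonemptyEdges⁻ H e∈)
      ... | i , i∈e with proj₂ class (lookup t i) (subst (lookup t i ∈ˢ_) eq (∈-image⁺ (lookup t) i∈e)) γ γ≢
      ... | u , u∈ , χu≢ with ∈-image⁻ (lookup t) (subst (u ∈ˢ_) (sym eq) u∈)
      ... | j , _ , refl = χu≢ (coloured j)

  module Encoder {h : ℕ} (H : Hypergraph h) (k t₀ : ℕ) where

    B s L rounds : ℕ
    B = k ℕ.* (h ℕ.* lg k)
    s = t₀ ℕ.∸ 8 ℕ.∸ B ℕ.∸ B
    L = lg (suc t₀)
    rounds = L ℕ.* 2 ℕ.^ B

    hasCopy : ∀ {n} → Hypergraph n → List ℕ → ℕ → Bool
    hasCopy G cs = Classes.has G (nonemptyEdges H) (colour cs)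

    accepts : ∀ {n} → Hypergraph n → List ℕ → Rand Bool
    accepts G cs = accept s (t₀ ℕ.∸ s) (hasCopy G cs) k 0 true

    w : ∀ {n} → Hypergraph n → List ℕ → ℚ
    w G cs = weight s (t₀ ℕ.∸ s) (hasCopy G cs) k 0

    accepts-w : ∀ {n} (G : Hypergraph n) g cs → 𝔼 g (accepts G cs) ≡ mix (w G cs) g true
    accepts-w G g cs = 𝔼-accept g s (t₀ ℕ.∸ s) (hasCopy G cs) k 0 true

    0≤w : ∀ {n} (G : Hypergraph n) cs → 0ℚ ≤ w G cs
    0≤w G cs = 0≤weight s (t₀ ℕ.∸ s) (hasCopy G cs) k 0

    w≤1 : ∀ {n} (G : Hypergraph n) cs → w G cs ≤ 1ℚ
    w≤1 G cs = weight≤1 s (t₀ ℕ.∸ s) (hasCopy G cs) k 0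

    encoded : ∀ {n} → Hypergraph n → Rand (List ℕ)
    encoded {n} G = Selection.mechanism (colouring (lg k) n) (accepts G) L rounds

    -- Both regimes reach the factor 2^(2t₀): the soft one as the square of the weight ratio 2^t₀,
    -- with L ≤ t₀ making the fallback large enough, the strict one by `strict-range`.
    private-encoding : ∀ {n} (G G′ : Hypergraph n) → Neighbors G G′ → ∀ f → (∀ cs → 0ℚ ≤ f cs) →
      𝔼 f (encoded G) ≤ ι (2 ℕ.^ (t₀ ℕ.+ t₀)) * 𝔼 f (encoded G′)
    private-encoding {n} G G′ nb f 0≤f = regime s refl
      where
      open SelectionBounds.Pair (colouring (lg k) n) (accepts G) (accepts G′) (w G) (w G′)
        (accepts-w G) (0≤w G) (w≤1 G) (accepts-w G′) (0≤w G′) (w≤1 G′)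
      W = ι (2 ℕ.^ t₀)
      regime : ∀ s′ → s ≡ s′ → 𝔼 f (encoded G) ≤ ι (2 ℕ.^ (t₀ ℕ.+ t₀)) * 𝔼 f (encoded G′)
      regime zero eq = subst (λ V → 𝔼 f (encoded G) ≤ V * 𝔼 f (encoded G′))
        (trans (sym (ι-* (2 ℕ.^ t₀) (2 ℕ.^ t₀))) (cong ι (sym (ℕₚ.^-distribˡ-+-* 2 t₀ t₀))))
        (ratio-close L rounds 0≤f (1≤2^ t₀)
          (subst (_≤ W * pow ½ L) (2^-½^ L) (*-monoˡ (½^≥0 L) (ι-mono (ℕₚ.^-monoʳ-≤ 2 (lg-suc≤ t₀)))))
          (λ cs → close (hasCopy G cs) (hasCopy G′ cs) (sensitivity H G G′ nb (colour cs)))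
          (λ cs → close (hasCopy G′ cs) (hasCopy G cs) (let γ₀ , same = sensitivity H G G′ nb (colour cs) in γ₀ , λ γ γ≢ → sym (same γ γ≢))))
        where
        close : ∀ has has′ → (Σ ℕ λ γ₀ → ∀ γ → γ ≢ γ₀ → has γ ≡ has′ γ) →
          weight s (t₀ ℕ.∸ s) has k 0 ≤ W * weight s (t₀ ℕ.∸ s) has′ k 0
        close has has′ (γ₀ , same) = subst (λ s → weight s (t₀ ℕ.∸ s) has k 0 ≤ W * weight s (t₀ ℕ.∸ s) has′ k 0) (sym eq)
          (weight-ratio t₀ has has′ γ₀ same k 0)
      regime (suc s′) eq = ratio-bounded L rounds 0≤f (0≤ι (2 ℕ.^ (t₀ ℕ.+ t₀)))
        (subst (_≤ ι (2 ℕ.^ (t₀ ℕ.+ t₀)) * pow ½ L)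
          (trans (cong (_* pow ½ L) (ι-* (suc rounds) (2 ℕ.^ L))) (trans (ℚₚ.*-assoc (ι (suc rounds)) (ι (2 ℕ.^ L)) (pow ½ L))
            (trans (cong (ι (suc rounds) *_) (2^-½^ L)) (ℚₚ.*-identityʳ (ι (suc rounds))))))
          (*-monoˡ (½^≥0 L) (ι-mono (strict-range t₀ B s′ eq))))

open Privacy

-- Expected number of copies

module Utility where

  tally-mono : ∀ {p q} → (∀ γ → p γ ≡ true → q γ ≡ true) → ∀ m γ → tally p m γ ℕ.≤ tally q m γ
  tally-mono p⇒q zero    γ = z≤n
  tally-mono {p} {q} p⇒q (suc m) γ = ℕₚ.+-mono-≤ (bits≤ (p γ) refl) (tally-mono p⇒q m (suc γ))
    where
    bits≤ : ∀ b → p γ ≡ b → bit b ℕ.≤ bit (q γ)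
    bits≤ false eq = z≤n
    bits≤ true  eq rewrite p⇒q γ eq = ℕₚ.≤-refl

  tally-extend : ∀ p {m n} → m ℕ.≤ n → ∀ γ → tally p m γ ℕ.≤ tally p n γ
  tally-extend p z≤n       γ = z≤n
  tally-extend p (s≤s m≤n) γ = ℕₚ.+-monoʳ-≤ (bit (p γ)) (tally-extend p m≤n (suc γ))

  tally-∨ : ∀ p q m γ → tally (λ v → p v ∨ q v) m γ ℕ.≤ tally p m γ ℕ.+ tally q m γ
  tally-∨ p q zero    γ = z≤n
  tally-∨ p q (suc m) γ = ℕₚ.≤-trans (ℕₚ.+-mono-≤ (bit-∨ (p γ) (q γ)) (tally-∨ p q m (suc γ)))
    (ℕₚ.≤-reflexive (exchange (bit (p γ)) (bit (q γ)) _ _))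
    where
    bit-∨ : ∀ a b → bit (a ∨ b) ℕ.≤ bit a ℕ.+ bit b
    bit-∨ false b = ℕₚ.≤-refl
    bit-∨ true  b = s≤s z≤n
    exchange : ∀ a b c d → a ℕ.+ b ℕ.+ (c ℕ.+ d) ≡ a ℕ.+ c ℕ.+ (b ℕ.+ d)
    exchange = ℕ-Ring.solve 4 (λ a b c d → a ℕ-Ring.:+ b ℕ-Ring.:+ (c ℕ-Ring.:+ d) ℕ-Ring.:= a ℕ-Ring.:+ c ℕ-Ring.:+ (b ℕ-Ring.:+ d)) refl

  tally-none : ∀ {p} m γ → (∀ v → γ ℕ.≤ v → p v ≡ false) → tally p m γ ≡ 0
  tally-none zero    γ none = refl
  tally-none (suc m) γ none rewrite none γ ℕₚ.≤-refl = tally-none m (suc γ) λ v γ<v → none v (ℕₚ.<⇒≤ γ<v)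

  tally-single : ∀ u m γ → tally (ℕ._≡ᵇ u) m γ ℕ.≤ 1
  tally-single u zero    γ = z≤n
  tally-single u (suc m) γ with γ ℕ.≡ᵇ u in eq
  ... | false = tally-single u m (suc γ)
  ... | true  = s≤s (ℕₚ.≤-reflexive (tally-none m (suc γ) λ v γ<v → other v γ<v (v ℕ.≡ᵇ u) refl))
    where
    other : ∀ v → γ ℕ.< v → ∀ b → (v ℕ.≡ᵇ u) ≡ b → (v ℕ.≡ᵇ u) ≡ false
    other v γ<v false e = e
    other v γ<v true  e = contradiction (trans (≡ᵇ⇒≡ γ u eq) (sym (≡ᵇ⇒≡ v u e))) (ℕₚ.<⇒≢ γ<v)

  tally-listed : ∀ us m γ → tally (λ v → any (v ℕ.≡ᵇ_) us) m γ ℕ.≤ length us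
  tally-listed []       m γ = ℕₚ.≤-reflexive (tally-none m γ λ v _ → refl)
  tally-listed (u ∷ us) m γ = ℕₚ.≤-trans (tally-∨ (ℕ._≡ᵇ u) (λ v → any (v ℕ.≡ᵇ_) us) m γ)
    (ℕₚ.+-mono-≤ (tally-single u m γ) (tally-listed us m γ))

  ½^-antitone : ∀ {m n} → m ℕ.≤ n → pow ½ n ≤ pow ½ m
  ½^-antitone {m} {n} m≤n = subst (λ n → pow ½ n ≤ pow ½ m) (ℕₚ.m+[n∸m]≡n m≤n)
    (subst (_≤ pow ½ m) (sym (pow-+ ½ m (n ℕ.∸ m))) (subst (pow ½ m * pow ½ (n ℕ.∸ m) ≤_) (ℚₚ.*-identityʳ (pow ½ m))
      (*-monoʳ (½^≥0 m) (½^≤1 (n ℕ.∸ m)))))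

  module _ {h n : ℕ} {H : Hypergraph h} {G : Hypergraph n} where

    vertexList : Copy H G → List ℕ
    vertexList A = tabulate (toℕ ∘ φ (proj₂ A))

    covered : List (Copy H G) → List ℕ
    covered = concatMap vertexList

    listed-in : List ℕ → ℕ → Bool
    listed-in us v = any (v ℕ.≡ᵇ_) us

    listed-in⁺ : ∀ us v → v ∈ us → listed-in us v ≡ true
    listed-in⁺ us v v∈ = any-true⁺ (v ℕ.≡ᵇ_) v∈ (≡ᵇ-refl v)

    listed-in⁻ : ∀ us v → listed-in us v ≡ true → v ∈ us
    listed-in⁻ us v eq = let u , u∈ , v≡u = any-true⁻ (v ℕ.≡ᵇ_) us eq in subst (_∈ us) (sym (≡ᵇ⇒≡ v u v≡u)) u∈

    -- Copy number i of the packing is to be coloured i.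
    target : ℕ → List (Copy H G) → ℕ → ℕ
    target i []       v = 0
    target i (A ∷ As) v = if listed-in (vertexList A) v then i else target (suc i) As v

    target-bound : ∀ {N} → 0 ℕ.< N → ∀ i As v → i ℕ.+ length As ℕ.≤ N → target i As v ℕ.< N
    target-bound {N} 0<N i []       v i≤ = 0<N
    target-bound {N} 0<N i (A ∷ As) v i≤ with listed-in (vertexList A) v
    ... | true  = ℕₚ.<-≤-trans (ℕₚ.m<m+n i (s≤s z≤n)) i≤
    ... | false = target-bound 0<N (suc i) As v (subst (ℕ._≤ N) (ℕₚ.+-suc i (length As)) i≤)

    not-shared : ∀ A {As} → All (Disjoint A) As → ∀ {v} → v ∈ covered As → listed-in (vertexList A) v ≡ false
    not-shared A {As} disj {v} v∈ with listed-in (vertexList A) v in eq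
    ... | false = refl
    ... | true  with find (∈-concatMap⁻ vertexList {xs = As} v∈)
    ... | C , C∈ , v∈C with ∈-tabulate⁻ v∈C | ∈-tabulate⁻ (listed-in⁻ (vertexList A) v eq)
    ... | j , v≡ | i , v≡′ = contradiction (φ (proj₂ A) i , x∈p∩q⁺ (φ-∈ A i , subst (_∈ˢ verts (proj₁ C))
            (Finₚ.toℕ-injective (trans (sym v≡) v≡′)) (φ-∈ C j))) (All.lookup disj C∈)

    classes-present : ∀ χ i As → AllPairs Disjoint As →
      (∀ v → v ℕ.< n → listed-in (covered As) v ≡ true → χ v ≡ target i As v) →
      ∀ γ → i ℕ.≤ γ → γ ℕ.< i ℕ.+ length As → Classes.has G (nonemptyEdges H) χ γ ≡ true
    classes-present χ i [] disj follows γ i≤γ γ< = contradiction γ< (ℕₚ.≤⇒≯ (subst (ℕ._≤ γ) (sym (ℕₚ.+-identityʳ i)) i≤γ))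
    classes-present χ i (A ∷ As) (disj ∷ disjs) follows γ i≤γ γ< with ℕₚ.m≤n⇒m<n∨m≡n i≤γ
    ... | inj₁ i<γ  = classes-present χ (suc i) As disjs tail γ i<γ (subst (γ ℕ.<_) (ℕₚ.+-suc i (length As)) γ<)
      where
      tail : ∀ v → v ℕ.< n → listed-in (covered As) v ≡ true → χ v ≡ target (suc i) As v
      tail v v<n on = trans (follows v v<n (listed-in⁺ (covered (A ∷ As)) v (∈-++⁺ʳ (vertexList A) (listed-in⁻ (covered As) v on))))
        (cong (λ b → if b then i else target (suc i) As v) (not-shared A disj (listed-in⁻ (covered As) v on)))
    ... | inj₂ refl = copy-good {χ = χ} A (λ e∈ → proj₁ (nonemptyEdges⁻ H e∈)) coloured
      where
      coloured : Coloured χ i A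
      coloured v∈ with onto-⊆ A v∈
      ... | j , refl = trans (follows (toℕ v) (Finₚ.toℕ<n v) (listed-in⁺ (covered (A ∷ As)) (toℕ v) (∈-++⁺ˡ on)))
          (cong (λ b → if b then i else target (suc i) As (toℕ v)) (listed-in⁺ (vertexList A) (toℕ v) on))
        where
        v = φ (proj₂ A) j
        on : toℕ v ∈ vertexList A
        on = ∈-tabulate⁺ j

    -- A copy of H in G shows that G has the empty hyperedge if H does.
    complete-copy : Copy H G → ∀ {χ γ} → Classes.has G (nonemptyEdges H) χ γ ≡ true → Classes.has G (family (edge H)) χ γ ≡ true
    complete-copy A {χ} {γ} has with Classes.has⁻ G (nonemptyEdges H) {χ} {γ} has
    ... | t , g = Classes.has⁺ G (family (edge H)) {χ} {γ} t (Classes.good⁺ G (family (edge H)) {χ} {γ} t record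
          { coloured = coloured ; distinct = distinct ; present = λ {e} e∈ → all-present′ e e∈ (nonempty? e) refl })
      where
      open Classes.Good (Classes.good⁻ G (nonemptyEdges H) {χ} {γ} t g)
      empty-image : ∀ e → ¬ Nonempty e → image (lookup t) e ≡ image (φ (proj₂ A)) e
      empty-image e none = ⊆-antisym
        (λ v∈ → contradiction (let i , i∈ , _ = ∈-image⁻ (lookup t) v∈ in i , i∈) none)
        (λ v∈ → contradiction (let i , i∈ , _ = ∈-image⁻ (φ (proj₂ A)) v∈ in i , i∈) none)
      all-present′ : ∀ e → e ∈ family (edge H) → ∀ d → nonempty? e ≡ d → edge G (image (lookup t) e) ≡ true
      all-present′ e e∈ (yes _)    eq = present (∈-filter⁺ (T? ∘ λ e → does (nonempty? e)) e∈ (≡⇒T (cong does eq)))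
      all-present′ e e∈ (no none) eq = trans (cong (edge G) (empty-image e none)) (copy-edges A (∈-family⁻ (edge H) e∈))

    -- The image of one fixed vertex of `H` tells disjoint copies apart.
    packing≤n : 1 ℕ.≤ h → ∀ (As : List (Copy H G)) → AllPairs Disjoint As → length As ℕ.≤ n
    packing≤n h≥1 As disj = Finₚ.injective⇒≤ {f = λ i → leader (List.lookup As i)} (λ {i} {j} → distinct As disj i j)
      where
      leader : Copy H G → Fin n
      leader A = φ (proj₂ A) (Fin.fromℕ< h≥1)
      shared : ∀ (A C : Copy H G) → Disjoint A C → leader A ≢ leader C
      shared A C disj eq = disj (leader A , x∈p∩q⁺ (φ-∈ A (Fin.fromℕ< h≥1) , subst (_∈ˢ verts (proj₁ C)) (sym eq) (φ-∈ C (Fin.fromℕ< h≥1))))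
      distinct : ∀ As → AllPairs Disjoint As → ∀ i j → leader (List.lookup As i) ≡ leader (List.lookup As j) → i ≡ j
      distinct (A ∷ As) (d ∷ ds) Fin.zero    Fin.zero    eq = refl
      distinct (A ∷ As) (d ∷ ds) Fin.zero    (Fin.suc j) eq =
        contradiction eq (shared A (List.lookup As j) (All.lookup d (∈-lookup j)))
      distinct (A ∷ As) (d ∷ ds) (Fin.suc i) Fin.zero    eq =
        contradiction (sym eq) (shared A (List.lookup As i) (All.lookup d (∈-lookup i)))
      distinct (A ∷ As) (d ∷ ds) (Fin.suc i) (Fin.suc j) eq = cong Fin.suc (distinct As ds i j eq)

  pow-*-distrib : ∀ x y m → pow (x * y) m ≡ pow x m * pow y m
  pow-*-distrib x y zero    = refl
  pow-*-distrib x y (suc m) rewrite pow-*-distrib x y m =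
    solve 4 (λ x y p q → x :* y :* (p :* q) := x :* p :* (y :* q)) refl x y (pow x m) (pow y m)

  pow-iterate : ∀ x m n → pow x (m ℕ.* n) ≡ pow (pow x n) m
  pow-iterate x zero    n = refl
  pow-iterate x (suc m) n = trans (pow-+ x n (m ℕ.* n)) (cong (pow x n *_) (pow-iterate x m n))

  bernoulli : ∀ {a} → 0ℚ ≤ a → ∀ m → 1ℚ + ι m * a ≤ pow (1ℚ + a) m
  bernoulli {a} 0≤a zero    = ℚₚ.≤-reflexive (trans (cong (λ z → 1ℚ + z * a) ι-0) (solve 1 (λ a → con 1ℚ :+ con 0ℚ :* a := con 1ℚ) refl a))
  bernoulli {a} 0≤a (suc m) = ≤-by ((0≤1 ⊕ 0≤a) ⊛ p≤q⇒0≤q-p (bernoulli 0≤a m) ⊕ 0≤ι m ⊛ (0≤a ⊛ 0≤a))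
    (trans (solve 3 (λ a i p → (con 1ℚ :+ a) :* p := (con 1ℚ :+ (con 1ℚ :+ i) :* a) :+ ((con 1ℚ :+ a) :* (p :- (con 1ℚ :+ i :* a)) :+ i :* (a :* a)))
        refl a (ι m) (pow (1ℚ + a) m))
      (cong (λ z → (1ℚ + z * a) + ((1ℚ + a) * (pow (1ℚ + a) m - (1ℚ + ι m * a)) + ι m * (a * a))) (sym (ι-suc m))))

  -- (1 - a)^N ≤ 1/2 for N ≥ 1/a, since (1 - a)(1 + a) ≤ 1 and (1 + a)^N ≥ 2.
  failure-half : ∀ {a} N → 0ℚ ≤ a → a ≤ 1ℚ → 1ℚ ≤ ι N * a → pow (1ℚ - a) N ≤ ½
  failure-half {a} N 0≤a a≤1 1≤Na = ℚₚ.*-cancelʳ-≤-pos 2ℚ (ℚₚ.≤-trans (*-monoʳ (pow≥0 0≤1-a N) (ℚₚ.≤-trans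
      (≤-by (p≤q⇒0≤q-p 1≤Na) (solve 1 (λ x → con 1ℚ :+ x := con 2ℚ :+ (x :- con 1ℚ)) refl (ι N * a))) (bernoulli 0≤a N)))
    (subst (_≤ ½ * 2ℚ) (pow-*-distrib (1ℚ - a) (1ℚ + a) N) (pow≤1 (0≤1-a ⊛ (0≤1 ⊕ 0≤a))
      (≤-by (0≤a ⊛ 0≤a) (solve 1 (λ a → con 1ℚ := (con 1ℚ :- a) :* (con 1ℚ :+ a) :+ a :* a) refl a)) N)))
    where
    0≤1-a : 0ℚ ≤ 1ℚ - a
    0≤1-a = p≤q⇒0≤q-p a≤1

  module Accuracy {h : ℕ} (H : Hypergraph h) (k t₀ : ℕ) (k≥1 : 1 ℕ.≤ k) {n : ℕ} (G : Hypergraph n)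
    (As : List (Copy H G)) (disjoint : AllPairs Disjoint As) (k≤As : k ℕ.≤ length As) (k≤n : k ℕ.≤ n) where

    open Encoder H k t₀

    decoded : List ℕ → ℕ
    decoded cs = tally (Classes.has G (family (edge H)) (colour cs)) n 0

    value : List ℕ → ℚ
    value cs = ι (decoded cs)

    open SelectionBounds.Single (colouring (lg k) n) (accepts G) (w G) (accepts-w G) (0≤w G) (w≤1 G)
    open Selection (colouring (lg k) n) using (mean)

    private
      first : List (Copy H G)
      first = take k As

      length-first : length first ≡ k
      length-first = trans (Listₚ.length-take k As) (ℕₚ.m≤n⇒m⊓n≡m k≤As)

      a : ℚ
      a = acceptance

    -- The first k copies of the packing cover at most kh vertices, and each gets its prescribed
    -- colour with probability 2^-b; then no class is missing and the weight is 1 in either regime.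
    a≥ : pow ½ B ≤ a
    a≥ = ℚₚ.≤-trans (½^-antitone (ℕₚ.≤-trans (ℕₚ.*-monoʳ-≤ (lg k) (tally-listed (covered first) n 0)) (ℕₚ.≤-reflexive
        (trans (cong (lg k ℕ.*_) (trans (length-encoding first) (cong (ℕ._* h) length-first)))
          (trans (ℕₚ.*-comm (lg k) (k ℕ.* h)) (ℕₚ.*-assoc k h (lg k)))))))
      (colouring-hit (lg k) (λ v → any (v ℕ.≡ᵇ_) (covered first)) (target 0 first)
        (λ v → target-bound (ℕₚ.m^n>0 2 (lg k)) 0 first v (subst (ℕ._≤ 2 ℕ.^ lg k) (sym length-first) (lg-upper k)))
        n 0 (w G) (0≤w G) λ cs len ok → ℚₚ.≤-reflexive (sym (all-present s (t₀ ℕ.∸ s) (hasCopy G cs) k 0 λ i 0≤i i<k →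
          classes-present (colour cs) 0 first (AllPairsₚ.take⁺ k disjoint) ok i 0≤i (subst (i ℕ.<_) (sym length-first) i<k))))

    -- A class with a copy for the encoder has one for the decoder too, by `complete-copy`, and the
    -- decoder visits the k classes because k ≤ n.
    value≥ : ∀ cs → ι k - ι (missing (hasCopy G cs) k 0) ≤ value cs
    value≥ cs = ≤-by (p≤q⇒0≤q-p (ι-mono (ℕₚ.≤-trans (tally-mono (λ γ → complete-copy someCopy {colour cs} {γ}) k 0)
        (tally-extend (Classes.has G (family (edge H)) (colour cs)) k≤n 0))))
      (trans (solve 3 (λ v t d → v := (t :+ d :- d) :+ (v :- t)) refl (value cs) (ι found) (ι lost))
        (cong (λ z → (z - ι lost) + (value cs - ι found)) (trans (sym (ι-+ found lost)) (cong ι (tally+missing (hasCopy G cs) k 0)))))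
      where
      found = tally (hasCopy G cs) k 0
      lost = missing (hasCopy G cs) k 0
      someCopy : Copy H G
      someCopy = pick As (ℕₚ.≤-trans k≥1 k≤As)
        where
        pick : ∀ As → 1 ℕ.≤ length As → Copy H G
        pick (A ∷ _) _ = A

    private
      T₀ K B′ v x : ℚ
      T₀ = ι t₀
      K = ι k
      B′ = ι B
      v = T₀ * K - (B′ + 1ℚ)
      x = pow ½ L

    -- `weight-loss` averaged over all colourings. Its additive 2^-B is charged to the acceptance
    -- probability by `a≥`, whence B + 1 in place of B.
    promised : v * a ≤ T₀ * mean (λ cs → w G cs * value cs)
    promised = begin
      v * a                          ≤⟨ ≤-by (p≤q⇒0≤q-p a≥) (solve 5 (λ t k b a h → (t :* k :- b) :* a :- h :=
                                          (t :* k :- (b :+ con 1ℚ)) :* a :+ (a :- h)) refl T₀ K B′ a (pow ½ B)) ⟩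
      (T₀ * K - B′) * a - pow ½ B    ≡⟨ trans (𝔼-+ _ _ (colouring (lg k) n)) (cong₂ _+_ (𝔼-* (T₀ * K - B′) (w G) (colouring (lg k) n))
                                          (𝔼-const (- pow ½ B) (colouring (lg k) n))) ⟨
      mean (λ cs → (T₀ * K - B′) * w G cs - pow ½ B)                 ≤⟨ 𝔼-mono pointwise (colouring (lg k) n) ⟩
      mean (λ cs → T₀ * (w G cs * value cs))                         ≡⟨ 𝔼-* T₀ _ (colouring (lg k) n) ⟩
      T₀ * mean (λ cs → w G cs * value cs) ∎
      where
      open ℚₚ.≤-Reasoning
      pointwise : ∀ cs → (T₀ * K - B′) * w G cs - pow ½ B ≤ T₀ * (w G cs * value cs)
      pointwise cs = ≤-by (0≤ι t₀ ⊛ (0≤w G cs ⊛ p≤q⇒0≤q-p (value≥ cs)) ⊕ p≤q⇒0≤q-p (weight-loss s t₀ B (hasCopy G cs) k 0))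
        (solve 7 (λ t k b w h f d → t :* (w :* f) := ((t :* k :- b) :* w :- h) :+
            (t :* (w :* (f :- (k :- d))) :+ ((b :* w :+ h) :- t :* (d :* w)))) refl
          T₀ K B′ (w G cs) (pow ½ B) (value cs) (ι (missing (hasCopy G cs) k 0)))

    -- The fallback and the event that all attempts fail each have probability at most 2^-L ≤ 1/(1 +
    -- t₀), so each costs at most K after scaling by t₀. A negative promise `v` needs no argument
    -- beyond E ≥ 0.
    accuracy : T₀ * K - (B′ + 1ℚ + 2ℚ * K) ≤ T₀ * 𝔼 value (encoded G)
    accuracy with 0ℚ ℚₚ.≤? v
    ... | no v≱0 = ℚₚ.≤-trans (≤-by (p≤q⇒0≤q-p (ℚₚ.<⇒≤ (ℚₚ.≰⇒> v≱0)) ⊕ 0≤2 ⊛ 0≤ι k)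
            (solve 3 (λ t b k → con 0ℚ := (t :- (b :+ con 1ℚ :+ con 2ℚ :* k)) :+ ((con 0ℚ :- (t :- (b :+ con 1ℚ))) :+ con 2ℚ :* k)) refl (T₀ * K) B′ K))
          (0≤ι t₀ ⊛ 𝔼≥ (λ cs → 0≤ι (decoded cs)) (encoded G))
      where
      0≤2 : 0ℚ ≤ 2ℚ
      0≤2 = ℚₚ.<⇒≤ (ℚₚ.positive⁻¹ 2ℚ)
    ... | yes 0≤v = ℚₚ.≤-trans (≤-by
            (½^≥0 L ⊛ (0≤p ⊛ 0≤v) ⊕ p≤q⇒0≤q-p p≤x ⊛ 0≤v ⊕ (p≤q⇒0≤q-p xT≤1 ⊛ (0≤ι k ⊕ 0≤ι k))
              ⊕ ½^≥0 L ⊛ ((0≤ι B ⊕ 0≤1) ⊕ (0≤ι B ⊕ 0≤1)))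
            (solve 5 (λ t k b x p → (con 1ℚ :- x) :* ((t :* k :- (b :+ con 1ℚ)) :* (con 1ℚ :- p)) :=
                (t :* k :- (b :+ con 1ℚ :+ con 2ℚ :* k)) :+
                (x :* (p :* (t :* k :- (b :+ con 1ℚ))) :+ (x :- p) :* (t :* k :- (b :+ con 1ℚ)) :+ (con 1ℚ :- x :* t) :* (k :+ k)
                  :+ x :* ((b :+ con 1ℚ) :+ (b :+ con 1ℚ)))) refl T₀ K B′ x p))
          (mechanism≥ {value} {T₀} {v} L rounds (λ cs → 0≤ι (decoded cs)) (0≤ι t₀) promised)
      where
      p = pow (1ℚ - a) rounds
      0≤p : 0ℚ ≤ p
      0≤p = pow≥0 0≤reject rounds
      p≤x : p ≤ x
      -- The attempts form L blocks of 2^B; since 2^B a ≥ 1, each block fails with probability at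
      -- most ½.
      p≤x = subst (_≤ x) (sym (pow-iterate (1ℚ - a) L (2 ℕ.^ B))) (pow-mono (pow≥0 0≤reject (2 ℕ.^ B))
        (failure-half (2 ℕ.^ B) 0≤acceptance acceptance≤1
          (subst (_≤ ι (2 ℕ.^ B) * a) (2^-½^ B) (*-monoʳ (0≤ι (2 ℕ.^ B)) a≥))) L)
      xT≤1 : x * T₀ ≤ 1ℚ
      xT≤1 = subst (x * T₀ ≤_) (trans (ℚₚ.*-comm x (ι (2 ℕ.^ L))) (2^-½^ L))
        (*-monoʳ (½^≥0 L) (ι-mono (ℕₚ.≤-trans (ℕₚ.n≤1+n t₀) (lg-upper (suc t₀)))))

open Utility

open Triple

-- Rational bounds on ε, and estimates of constants

archimedean : ∀ q → ∃ λ N → q ≤ ι N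
archimedean q@(mkℚ (ℤ.+ a) d _) = a , ℚₚ.toℚᵘ-cancel-≤ (subst (ℚ.toℚᵘ q ℚᵘ.≤_) (sym (toℚᵘ-ι a))
  (ℚᵘ.*≤* (ℤₚ.*-monoˡ-≤-nonNeg (ℤ.+ a) (ℤ.+≤+ (s≤s (z≤n {d}))))))
archimedean q@(mkℚ ℤ.-[1+ a ] d _) = 0 , ℚₚ.≤-trans (ℚₚ.<⇒≤ (ℚₚ.negative⁻¹ q)) (0≤ι 0)

p≤∣p∣ : ∀ p → p ≤ ℚ.∣ p ∣
p≤∣p∣ p with ℚₚ.≤-total 0ℚ p
... | inj₁ 0≤p = ℚₚ.≤-reflexive (sym (ℚₚ.0≤p⇒∣p∣≡p 0≤p))
... | inj₂ p≤0 = ℚₚ.≤-trans p≤0 (ℚₚ.0≤∣p∣ p)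

ι-mono-< : ∀ {m n} → m ℕ.< n → ι m < ι n
ι-mono-< {m} m<n = ℚₚ.<-≤-trans (subst₂ _<_ (ℚₚ.+-identityˡ (ι m)) (sym (ι-suc m)) (ℚₚ.+-monoˡ-< (ι m) 0<1)) (ι-mono m<n)

-- The floor of q/4, found by descending from an integer bound; t = 0 stands in when q is negative.
quarter-floor : ∀ q → ∃ λ t → (t ≡ 0 ⊎ ι (4 ℕ.* t) ≤ q) × q ≤ ι (4 ℕ.* t ℕ.+ 4)
quarter-floor q = search (proj₁ (archimedean q)) (ℚₚ.≤-trans (proj₂ (archimedean q)) (ι-mono (ℕₚ.≤-trans (ℕₚ.m≤n*m _ 4) (ℕₚ.m≤m+n _ 4))))
  where
  search : ∀ N → q ≤ ι (4 ℕ.* N ℕ.+ 4) → ∃ λ t → (t ≡ 0 ⊎ ι (4 ℕ.* t) ≤ q) × q ≤ ι (4 ℕ.* t ℕ.+ 4)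
  search zero    q≤ = 0 , inj₁ refl , q≤
  search (suc N) q≤ with ℚₚ.≤-total (ι (4 ℕ.* suc N)) q
  ... | inj₁ ≤q  = suc N , inj₂ ≤q , q≤
  ... | inj₂ q≤′ = search N (subst (λ z → q ≤ ι z) (trans (ℕₚ.*-suc 4 N) (ℕₚ.+-comm 4 (4 ℕ.* N))) q≤′)

-- Reals have no decidable order, so t is read off one rational approximant q + 1 of ε that is off
-- by at most 1. From q to q + 2 the later approximants may vary, hence the gap 6 = 4 + 2. The bound
-- ½ replaces ε ≥ 1, which the approximants satisfy only up to a tolerance.
record Level (ε : ℝ) : Set where
  field
    t    : ℕ
    from : ℕ
    low  : ∀ m → from ℕ.≤ m → ι (4 ℕ.* t) ≤ ℝ.seq ε m
    high : ∀ m → from ℕ.≤ m → ℝ.seq ε m ≤ ι (4 ℕ.* t ℕ.+ 6)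
    half : ∀ m → from ℕ.≤ m → ½ ≤ ℝ.seq ε m

level : ∀ ε → fromℕ 1 ≤ʳ real ε → Level ε
level ε 1≤ε = record
  { t = t ; from = N ℕ.+ N′
  ; low  = λ m N≤m → low m N≤m (proj₁ (proj₂ (quarter-floor q)))
  ; high = λ m N≤m → ℚₚ.≤-trans (above m (ℕₚ.≤-trans (ℕₚ.m≤m+n N N′) N≤m)) (ℚₚ.≤-trans (ℚₚ.+-monoˡ-≤ 2ℚ (proj₂ (proj₂ (quarter-floor q))))
      (ℚₚ.≤-reflexive (trans (cong (ι (4 ℕ.* t ℕ.+ 4) +_) (sym ι-2)) (trans (sym (ι-+ (4 ℕ.* t ℕ.+ 4) 2)) (cong ι (ℕₚ.+-assoc (4 ℕ.* t) 4 2))))))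
  ; half = half }
  where
  open ℝ ε using (seq; cauchy)
  N N′ : ℕ
  N = proj₁ (cauchy 1ℚ 0<1)
  N′ = proj₁ (1≤ε ½ (ℚₚ.positive⁻¹ ½))
  q : ℚ
  q = seq N - 1ℚ
  t : ℕ
  t = proj₁ (quarter-floor q)
  near : ∀ i j → N ℕ.≤ i → N ℕ.≤ j → seq i - seq j ≤ 1ℚ
  near i j N≤i N≤j = ℚₚ.≤-trans (p≤∣p∣ (seq i - seq j)) (proj₂ (cauchy 1ℚ 0<1) i j N≤i N≤j)
  above : ∀ m → N ℕ.≤ m → seq m ≤ q + 2ℚ
  above m N≤m = ≤-by (p≤q⇒0≤q-p (near m N N≤m ℕₚ.≤-refl))
    (solve 2 (λ a b → b :- con 1ℚ :+ con 2ℚ := a :+ (con 1ℚ :- (a :- b))) refl (seq m) (seq N))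
  half : ∀ m → N ℕ.+ N′ ℕ.≤ m → ½ ≤ seq m
  half m N≤m = ≤-by (p≤q⇒0≤q-p (proj₂ (1≤ε ½ (ℚₚ.positive⁻¹ ½)) m (ℕₚ.≤-trans (ℕₚ.m≤n+m N′ N) N≤m)))
    (solve 1 (λ e → e := con ½ :+ (e :+ con ½ :- con 1ℚ)) refl (seq m))
  low : ∀ m → N ℕ.+ N′ ℕ.≤ m → t ≡ 0 ⊎ ι (4 ℕ.* t) ≤ q → ι (4 ℕ.* t) ≤ seq m
  low m N≤m (inj₁ t≡0) = ℚₚ.≤-trans (ℚₚ.≤-reflexive (trans (cong (λ t → ι (4 ℕ.* t)) t≡0) ι-0)) (ℚₚ.≤-trans 0≤½ (half m N≤m))
  low m N≤m (inj₂ 4t≤q) = ℚₚ.≤-trans 4t≤q (≤-by (p≤q⇒0≤q-p (near N m ℕₚ.≤-refl (ℕₚ.≤-trans (ℕₚ.m≤m+n N N′) N≤m)))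
    (solve 2 (λ a b → a := (b :- con 1ℚ) :+ (con 1ℚ :- (b :- a))) refl (seq m) (seq N)))

Det-Always : ∀ {P Q : State → Set} {r} → Det P r → (∀ τ → P τ → Q τ) → Always Q r
Det-Always (τ , refl , p) f = f τ p

exchange-≤ : ∀ a x z y → x ℕ.≤ z → a ℕ.* (x ℕ.* y) ℕ.≤ a ℕ.* y ℕ.* z
exchange-≤ a x z y x≤z = ℕₚ.≤-trans (ℕₚ.*-monoʳ-≤ a (ℕₚ.≤-trans (ℕₚ.*-monoˡ-≤ y x≤z) (ℕₚ.≤-reflexive (ℕₚ.*-comm z y))))
  (ℕₚ.≤-reflexive (sym (ℕₚ.*-assoc a y z)))

-- Turns 2^(khb) into k^(2hk). For k ≥ 2 the power is at most 2k - 1, which is below k²; for k = 1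
-- both sides are 1.
2^lg≤square : ∀ k → 1 ℕ.≤ k → 2 ℕ.^ lg k ℕ.≤ k ℕ.* k
2^lg≤square 1             _ = ℕₚ.≤-refl
2^lg≤square (suc (suc k)) _ = ℕₚ.≤-trans (lg-lower (suc k)) (ℕₚ.≤-trans
  (ℕₚ.≤-trans (ℕₚ.n≤1+n _) (ℕₚ.≤-reflexive (eq k))) (ℕₚ.*-monoˡ-≤ (suc (suc k)) (s≤s (s≤s (z≤n {k})))))
  where
  eq : ∀ k → suc (suc (suc k ℕ.+ suc k)) ≡ 2 ℕ.* suc (suc k)
  eq = ℕ-Ring.solve 1 (λ k → ℕ-Ring.con 2 ℕ-Ring.:+ ((ℕ-Ring.con 1 ℕ-Ring.:+ k) ℕ-Ring.:+ (ℕ-Ring.con 1 ℕ-Ring.:+ k)) ℕ-Ring.:= ℕ-Ring.con 2 ℕ-Ring.:* (ℕ-Ring.con 2 ℕ-Ring.:+ k)) refl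

power-bound : ∀ h k → 1 ℕ.≤ k → k ℕ.^ 3 ℕ.* 2 ℕ.^ (k ℕ.* (h ℕ.* lg k)) ℕ.≤ k ℕ.^ ((2 ℕ.* h ℕ.+ 3) ℕ.* k)
power-bound h k k≥1 = begin
  k ℕ.^ 3 ℕ.* 2 ℕ.^ (k ℕ.* (h ℕ.* lg k))      ≡⟨ cong (λ e → k ℕ.^ 3 ℕ.* 2 ℕ.^ e) (rearrange k h (lg k)) ⟩
  k ℕ.^ 3 ℕ.* 2 ℕ.^ (lg k ℕ.* (h ℕ.* k))      ≡⟨ cong (k ℕ.^ 3 ℕ.*_) (ℕₚ.^-*-assoc 2 (lg k) (h ℕ.* k)) ⟨
  k ℕ.^ 3 ℕ.* (2 ℕ.^ lg k) ℕ.^ (h ℕ.* k)      ≤⟨ ℕₚ.*-monoʳ-≤ (k ℕ.^ 3) (ℕₚ.^-monoˡ-≤ (h ℕ.* k) (2^lg≤square k k≥1)) ⟩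
  k ℕ.^ 3 ℕ.* (k ℕ.* k) ℕ.^ (h ℕ.* k)         ≡⟨ cong (λ x → k ℕ.^ 3 ℕ.* (k ℕ.* x) ℕ.^ (h ℕ.* k)) (ℕₚ.*-identityʳ k) ⟨
  k ℕ.^ 3 ℕ.* (k ℕ.^ 2) ℕ.^ (h ℕ.* k)         ≡⟨ cong (k ℕ.^ 3 ℕ.*_) (ℕₚ.^-*-assoc k 2 (h ℕ.* k)) ⟩
  k ℕ.^ 3 ℕ.* k ℕ.^ (2 ℕ.* (h ℕ.* k))         ≡⟨ ℕₚ.^-distribˡ-+-* k 3 (2 ℕ.* (h ℕ.* k)) ⟨
  k ℕ.^ (3 ℕ.+ 2 ℕ.* (h ℕ.* k))
    ≤⟨ ℕₚ.^-monoʳ-≤ k {{ℕ.>-nonZero k≥1}} (ℕₚ.≤-trans (ℕₚ.+-monoˡ-≤ (2 ℕ.* (h ℕ.* k)) (ℕₚ.m≤m*n 3 k {{ℕ.>-nonZero k≥1}}))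
         (ℕₚ.≤-reflexive (collect h k))) ⟩
  k ℕ.^ ((2 ℕ.* h ℕ.+ 3) ℕ.* k) ∎
  where
  open ℕₚ.≤-Reasoning
  rearrange : ∀ k h b → k ℕ.* (h ℕ.* b) ≡ b ℕ.* (h ℕ.* k)
  rearrange = ℕ-Ring.solve 3 (λ k h b → k ℕ-Ring.:* (h ℕ-Ring.:* b) ℕ-Ring.:= b ℕ-Ring.:* (h ℕ-Ring.:* k)) refl
  collect : ∀ h k → 3 ℕ.* k ℕ.+ 2 ℕ.* (h ℕ.* k) ≡ (2 ℕ.* h ℕ.+ 3) ℕ.* k
  collect = ℕ-Ring.solve 2 (λ h k → ℕ-Ring.con 3 ℕ-Ring.:* k ℕ-Ring.:+ ℕ-Ring.con 2 ℕ-Ring.:* (h ℕ-Ring.:* k) ℕ-Ring.:= (ℕ-Ring.con 2 ℕ-Ring.:* h ℕ-Ring.:+ ℕ-Ring.con 3) ℕ-Ring.:* k) refl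

-- The slack for the convergence of the sequence representing ε.
margin : ∀ c δ → 0ℚ < δ → ∃ λ η → 0ℚ < η × 8ℚ * (8ℚ * η) ≤ 1ℚ × ι c * ((8ℚ + 8ℚ) * η) ≤ δ
margin c δ 0<δ = δ′ * r , 0<η , 64η≤1 , cη≤δ
  where
  r δ′ : ℚ
  -- That is 1 / (64 (1 + c)), so that η = min(δ, 1) / (64 (1 + c)) meets both requirements.
  r = ℤ.+ 1 ℚ./ suc (63 ℕ.+ 64 ℕ.* c)
  δ′ = δ ℚ.⊓ 1ℚ
  normal : 8ℚ * (8ℚ * ((1ℚ + ι c) * r)) ≡ 1ℚ
  normal = trans (solve 2 (λ c r → con 8ℚ :* (con 8ℚ :* ((con 1ℚ :+ c) :* r)) := r :* (con (8ℚ * 8ℚ) :+ con (8ℚ * 8ℚ) :* c)) refl (ι c) r)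
    (trans (cong (r *_) (sym (trans (ι-+ 64 (64 ℕ.* c)) (trans (cong (ι 64 +_) (ι-* 64 c)) (cong (λ x → x + x * ι c) (trans (ι-* 8 8) (cong₂ _*_ ι-8 ι-8)))))))
      (reciprocal (63 ℕ.+ 64 ℕ.* c)))
  0≤r : 0ℚ ≤ r
  0≤r = 0≤reciprocal (63 ℕ.+ 64 ℕ.* c)
  0<r : 0ℚ < r
  0<r = ℚₚ.≰⇒> λ r≤0 → ℚₚ.<-irrefl (trans (cong (λ r → 8ℚ * (8ℚ * ((1ℚ + ι c) * r))) (ℚₚ.≤-antisym 0≤r r≤0)) normal)
    (subst (_< 1ℚ) (solve 1 (λ c → con 0ℚ := con 8ℚ :* (con 8ℚ :* ((con 1ℚ :+ c) :* con 0ℚ))) refl (ι c)) 0<1)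
  0<δ′ : 0ℚ < δ′
  0<δ′ with ℚₚ.≤-total δ 1ℚ
  ... | inj₁ δ≤1 = subst (0ℚ <_) (sym (ℚₚ.p≤q⇒p⊓q≡p δ≤1)) 0<δ
  ... | inj₂ 1≤δ = subst (0ℚ <_) (sym (ℚₚ.p≥q⇒p⊓q≡q 1≤δ)) 0<1
  0<η : 0ℚ < δ′ * r
  0<η = subst (_< δ′ * r) (ℚₚ.*-zeroˡ r) (ℚₚ.*-monoˡ-<-pos r {{ℚ.positive 0<r}} 0<δ′)
  64r≤1 : 8ℚ * (8ℚ * r) ≤ 1ℚ
  64r≤1 = ≤-by (0≤8 ⊛ (0≤8 ⊛ (0≤ι c ⊛ 0≤r))) (trans (sym normal)
    (solve 2 (λ c r → con 8ℚ :* (con 8ℚ :* ((con 1ℚ :+ c) :* r)) := con 8ℚ :* (con 8ℚ :* r) :+ con 8ℚ :* (con 8ℚ :* (c :* r))) refl (ι c) r))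
    where
    0≤8 : 0ℚ ≤ 8ℚ
    0≤8 = ℚₚ.<⇒≤ (ℚₚ.positive⁻¹ 8ℚ)
  64cr≤1 : 8ℚ * (8ℚ * (ι c * r)) ≤ 1ℚ
  64cr≤1 = ≤-by (0≤8 ⊛ (0≤8 ⊛ 0≤r)) (trans (sym normal)
    (solve 2 (λ c r → con 8ℚ :* (con 8ℚ :* ((con 1ℚ :+ c) :* r)) := con 8ℚ :* (con 8ℚ :* (c :* r)) :+ con 8ℚ :* (con 8ℚ :* r)) refl (ι c) r))
    where
    0≤8 : 0ℚ ≤ 8ℚ
    0≤8 = ℚₚ.<⇒≤ (ℚₚ.positive⁻¹ 8ℚ)
  64η≤1 : 8ℚ * (8ℚ * (δ′ * r)) ≤ 1ℚ
  64η≤1 = subst (_≤ 1ℚ) (solve 2 (λ d r → d :* (con 8ℚ :* (con 8ℚ :* r)) := con 8ℚ :* (con 8ℚ :* (d :* r))) refl δ′ r)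
    (*-mono (0≤64 ⊛ 0≤r′) 0≤1 (ℚₚ.p⊓q≤q δ 1ℚ) 64r≤1)
    where
    0≤64 = ℚₚ.<⇒≤ (ℚₚ.positive⁻¹ 8ℚ)
    0≤r′ = 0≤64 ⊛ 0≤r
  cη≤δ : ι c * ((8ℚ + 8ℚ) * (δ′ * r)) ≤ δ
  cη≤δ = ℚₚ.≤-trans (≤-by (ℚₚ.<⇒≤ (ℚₚ.positive⁻¹ (8ℚ * 8ℚ - (8ℚ + 8ℚ))) ⊛ (0≤ι c ⊛ (ℚₚ.<⇒≤ 0<δ′ ⊛ 0≤r)))
      (solve 3 (λ c d r → d :* (con 8ℚ :* (con 8ℚ :* (c :* r))) := c :* (con (8ℚ + 8ℚ) :* (d :* r)) :+ con (8ℚ * 8ℚ - (8ℚ + 8ℚ)) :* (c :* (d :* r))) refl (ι c) δ′ r))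
    (ℚₚ.≤-trans (*-monoʳ (ℚₚ.<⇒≤ 0<δ′) 64cr≤1) (ℚₚ.≤-trans (ℚₚ.≤-reflexive (ℚₚ.*-identityʳ δ′)) (ℚₚ.p⊓q≤p δ 1ℚ)))

-- Assembling the scheme and its guarantees

module Theorem {h : ℕ} (H : Hypergraph h) where

  open Costs H

  -- The sum of all constants and exponents that occur, each depending on `H` alone; in order they
  -- serve the decoder time, the encoder time, the ratio, the exponent of k and the exponent of n.
  c : ℕ
  c = decoderFactor ℕ.+ (8 ℕ.* encoderFactor ℕ.+ (8 ℕ.* (4 ℕ.* h ℕ.+ 18) ℕ.+ ((2 ℕ.* h ℕ.+ 3) ℕ.+ suc h)))

  private
    decoderFactor≤c : decoderFactor ℕ.≤ c
    decoderFactor≤c = ℕₚ.m≤m+n decoderFactor _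

    encoderFactor≤c : 8 ℕ.* encoderFactor ℕ.≤ c
    encoderFactor≤c = ℕₚ.≤-trans (ℕₚ.m≤m+n (8 ℕ.* encoderFactor) _) (ℕₚ.m≤n+m _ decoderFactor)

    ratio≤c : 8 ℕ.* (4 ℕ.* h ℕ.+ 18) ℕ.≤ c
    ratio≤c = ℕₚ.≤-trans (ℕₚ.m≤m+n (8 ℕ.* (4 ℕ.* h ℕ.+ 18)) _) (ℕₚ.≤-trans (ℕₚ.m≤n+m _ (8 ℕ.* encoderFactor)) (ℕₚ.m≤n+m _ decoderFactor))

    last≤c : (2 ℕ.* h ℕ.+ 3) ℕ.+ suc h ℕ.≤ c
    last≤c = ℕₚ.≤-trans (ℕₚ.m≤n+m _ (8 ℕ.* (4 ℕ.* h ℕ.+ 18))) (ℕₚ.≤-trans (ℕₚ.m≤n+m _ (8 ℕ.* encoderFactor)) (ℕₚ.m≤n+m _ decoderFactor))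

    exponent≤c : 2 ℕ.* h ℕ.+ 3 ℕ.≤ c
    exponent≤c = ℕₚ.≤-trans (ℕₚ.m≤m+n (2 ℕ.* h ℕ.+ 3) (suc h)) last≤c

    1+h≤c : suc h ℕ.≤ c
    1+h≤c = ℕₚ.≤-trans (ℕₚ.m≤n+m (suc h) (2 ℕ.* h ℕ.+ 3)) last≤c

  module _ (ε : ℝ) (1≤ε : fromℕ 1 ≤ʳ real ε) where

    open Level (level ε 1≤ε)

    L : ℕ
    L = lg (suc t)

    encoder′ : Cmd
    encoder′ = encoderProgram H t L

    encoded-𝔼 : ∀ {n} (G : Hypergraph n) k → 1 ℕ.≤ k → ∀ f →
      𝔼 f (mapR out (runEncoder encoder′ G k)) ≡ 𝔼 f (Encoder.encoded H k t G)
    encoded-𝔼 G k k≥1 f = trans (𝔼-bind f (runEncoder encoder′ G k) _)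
      (Rel-𝔼 (Rel-weaken (λ τ cs eq → cong f eq) (encoder-sim G k t L k≥1)))

    scheme-DP : ∀ k → 1 ℕ.≤ k → DP ε (λ G → mapR out (runEncoder encoder′ G k))
    -- From this index on ε ≥ 4t, and the partial sum of the exponential contains the term of index
    -- 2t, which is at least 2^(2t).
    scheme-DP k k≥1 G G′ nb S δ 0<δ = from ℕ.+ suc (t ℕ.+ t) , λ m N≤m → begin
      Pr S (mapR out (runEncoder encoder′ G k))   ≡⟨ encoded-𝔼 G k k≥1 ind ⟩
      𝔼 ind (encoded G)                            ≤⟨ private-encoding G G′ nb ind 0≤ind ⟩
      ι (2 ℕ.^ (t ℕ.+ t)) * 𝔼 ind (encoded G′)
        ≤⟨ *-monoˡ (𝔼≥ 0≤ind (encoded G′)) (exp-lower (t ℕ.+ t) m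
             (subst (λ z → ι z ≤ ℝ.seq ε m) (quadruple t) (low m (ℕₚ.≤-trans (ℕₚ.m≤m+n from _) N≤m))) (ℕₚ.≤-trans (ℕₚ.m≤n+m _ from) N≤m)) ⟩
      exp (real ε) m * 𝔼 ind (encoded G′)          ≡⟨ cong (exp (real ε) m *_) (encoded-𝔼 G′ k k≥1 ind) ⟨
      exp (real ε) m * Pr S (mapR out (runEncoder encoder′ G′ k))
        ≤⟨ ≤-by (ℚₚ.<⇒≤ 0<δ) refl ⟩
      exp (real ε) m * Pr S (mapR out (runEncoder encoder′ G′ k)) + δ ∎
      where
      open ℚₚ.≤-Reasoning
      open Encoder H k t
      ind : List ℕ → ℚ
      ind C = if S C then 1ℚ else 0ℚ
      0≤ind : ∀ C → 0ℚ ≤ ind C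
      0≤ind C with S C
      ... | true  = 0≤1
      ... | false = ℚₚ.≤-refl
      quadruple : ∀ t → 4 ℕ.* t ≡ 2 ℕ.* (t ℕ.+ t)
      quadruple = ℕ-Ring.solve 1 (λ t → ℕ-Ring.con 4 ℕ-Ring.:* t ℕ-Ring.:= ℕ-Ring.con 2 ℕ-Ring.:* (t ℕ-Ring.:+ t)) refl

    scheme : Scheme H ε
    scheme = record
      { encoder = encoder′
      ; decoder = decoderProgram H
      ; isDP    = scheme-DP
      ; valid   = λ G C → Det-Always (det (decoder-run H G C)) λ τ (S , o , _) → S , o }

    open Scheme scheme using (valid; decode; expectedVal)

    -- `decode` returns whichever packing the validity proof provides. For h ≥ 1 its size is
    -- determined by the length of the output, hence equals the number of classes with a copy.
    decoded-val : 1 ℕ.≤ h → ∀ {n} (G : Hypergraph n) C →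
      𝔼 (λ S → ℤ.+ val S ℚ./ 1) (decode G C) ≡ ι (tally (Classes.has G (family (edge H)) (colour C)) n 0)
    decoded-val h≥1 {n} G C = trans (𝔼-bind (λ S → ℤ.+ val S ℚ./ 1) (attach (runDecoder (decoderProgram H) G C) (valid G C)) _)
      (𝔼-attach (runDecoder (decoderProgram H) G C) (valid G C) (Det-Always (det (decoder-run H G C))
        λ τ (S₀ , o₀ , number) (S , o) → trans (sym (ι-def (val S))) (cong ι (trans (same-length S S₀ (trans (sym o) o₀)) number))))
      where
      same-length : ∀ (S S₀ : Packing H G) → encoding S ≡ encoding S₀ → val S ≡ val S₀
      same-length S S₀ eq = ℕₚ.*-cancelʳ-≡ (val S) (val S₀) h {{ℕ.>-nonZero h≥1}} (trans (sym (length-encoding (proj₁ S)))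
        (trans (cong length eq) (length-encoding (proj₁ S₀))))

    expected : 1 ℕ.≤ h → ∀ {n} (G : Hypergraph n) k → 1 ℕ.≤ k → expectedVal G k ≡
      𝔼 (λ C → ι (tally (Classes.has G (family (edge H)) (colour C)) n 0)) (Encoder.encoded H k t G)
    expected h≥1 G k k≥1 = trans (𝔼-bind _ (mapR out (runEncoder encoder′ G k)) (decode G)) (trans
      (𝔼-cong (decoded-val h≥1 G) (mapR out (runEncoder encoder′ G k))) (encoded-𝔼 G k k≥1 _))

    polyTimeDecoder : PolyTimeDecoder scheme c
    polyTimeDecoder {n} G C = Always-map (λ τ time≤ → ℕₚ.≤-trans time≤ (ℕₚ.*-mono-≤ decoderFactor≤c
        (ℕₚ.≤-trans (ℕₚ.^-monoˡ-≤ (suc h) (s≤s (ℕₚ.m≤m+n n _))) (ℕₚ.^-monoʳ-≤ (suc (size G)) 1+h≤c))))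
      (runDecoder (decoderProgram H) G C) (decoder-time G C)

    fptEncoder : FPTEncoder scheme
    fptEncoder = (λ k → encoderFactor ℕ.* (k ℕ.^ 3 ℕ.* (suc L ℕ.* 2 ℕ.^ (k ℕ.* (h ℕ.* lg k))) ℕ.^ 1)) , suc h , λ {n} G k k≥1 →
      Always-map (λ τ time≤ → ℕₚ.≤-trans time≤ (exchange-≤ encoderFactor (suc n ℕ.^ suc h) (suc (size G) ℕ.^ suc h) _
          (ℕₚ.^-monoˡ-≤ (suc h) (s≤s (ℕₚ.m≤m+n n _)))))
        (runEncoder encoder′ G k) (encoder-time G k t L k≥1)

    1≤1+ε : ∀ m → from ℕ.≤ m → 1ℚ ≤ 1ℚ + ℝ.seq ε m
    1≤1+ε m N≤m = ≤-by (ℚₚ.≤-trans (0≤ι (4 ℕ.* t)) (low m N≤m)) refl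

    encoderTime : EncoderTime scheme c
    encoderTime {n} G k k≥1 = Always-map (λ τ time≤ → compare-times (clock τ) time≤) (runEncoder encoder′ G k) (encoder-time G k t L k≥1)
      where
      X : ℕ
      X = encoderFactor ℕ.* (k ℕ.^ (c ℕ.* k) ℕ.* suc n ℕ.^ c)
      B₀ : ℕ
      B₀ = k ℕ.* (h ℕ.* lg k)
      X≤ : encoderFactor ℕ.* (suc n ℕ.^ suc h ℕ.* (k ℕ.^ 3 ℕ.* (suc L ℕ.* 2 ℕ.^ B₀) ℕ.^ 1)) ℕ.≤ X ℕ.* suc L
      X≤ = group encoderFactor (suc n ℕ.^ suc h) (suc n ℕ.^ c) (k ℕ.^ 3) (2 ℕ.^ B₀) (suc L) (k ℕ.^ (c ℕ.* k))
        (ℕₚ.^-monoʳ-≤ (suc n) 1+h≤c)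
        (ℕₚ.≤-trans (power-bound h k k≥1) (ℕₚ.^-monoʳ-≤ k {{ℕ.>-nonZero k≥1}} (ℕₚ.*-monoˡ-≤ k exponent≤c)))
        where
        group : ∀ a x x′ y z l w → x ℕ.≤ x′ → y ℕ.* z ℕ.≤ w → a ℕ.* (x ℕ.* (y ℕ.* (l ℕ.* z) ℕ.^ 1)) ℕ.≤ a ℕ.* (w ℕ.* x′) ℕ.* l
        group a x x′ y z l w x≤ yz≤ = ℕₚ.≤-trans (ℕₚ.≤-reflexive (eq a x y z l))
          (ℕₚ.*-monoˡ-≤ l (ℕₚ.*-monoʳ-≤ a (ℕₚ.*-mono-≤ yz≤ x≤)))
          where
          eq : ∀ a x y z l → a ℕ.* (x ℕ.* (y ℕ.* (l ℕ.* z) ℕ.^ 1)) ≡ a ℕ.* (y ℕ.* z ℕ.* x) ℕ.* l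
          eq = ℕ-Ring.solve 5 (λ a x y z l → a ℕ-Ring.:* (x ℕ-Ring.:* (y ℕ-Ring.:* (l ℕ-Ring.:* z ℕ-Ring.:* ℕ-Ring.con 1))) ℕ-Ring.:= a ℕ-Ring.:* (y ℕ-Ring.:* z ℕ-Ring.:* x) ℕ-Ring.:* l) refl
      8X≤ : X ℕ.* 8 ℕ.≤ c ℕ.* k ℕ.^ (c ℕ.* k) ℕ.* suc n ℕ.^ c
      8X≤ = regroup encoderFactor (k ℕ.^ (c ℕ.* k)) (suc n ℕ.^ c) c encoderFactor≤c
        where
        regroup : ∀ a x y c → 8 ℕ.* a ℕ.≤ c → a ℕ.* (x ℕ.* y) ℕ.* 8 ℕ.≤ c ℕ.* x ℕ.* y
        regroup a x y c 8a≤ = ℕₚ.≤-trans (ℕₚ.≤-reflexive (eq a x y)) (ℕₚ.*-monoˡ-≤ y (ℕₚ.*-monoˡ-≤ x 8a≤))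
          where
          eq : ∀ a x y → a ℕ.* (x ℕ.* y) ℕ.* 8 ≡ 8 ℕ.* a ℕ.* x ℕ.* y
          eq = ℕ-Ring.solve 3 (λ a x y → a ℕ-Ring.:* (x ℕ-Ring.:* y) ℕ-Ring.:* ℕ-Ring.con 8 ℕ-Ring.:= ℕ-Ring.con 8 ℕ-Ring.:* a ℕ-Ring.:* x ℕ-Ring.:* y) refl
      compare-times : ∀ τ → τ ℕ.≤ encoderFactor ℕ.* monomial h (suc h) 3 1 (sizes G k t L k≥1) →
        fromℕ τ ≤ʳ fromℕ (c ℕ.* k ℕ.^ (c ℕ.* k) ℕ.* suc n ℕ.^ c) *ʳ ln (fromℕ 1 +ʳ real ε)
      -- 4t + 7 bounds 1 + ε, so from this index on the mesh of the sum for ln(1 + ε) is at most 1.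
      compare-times τ τ≤ δ 0<δ = suc (from ℕ.+ (4 ℕ.* t ℕ.+ 7)) , eventually
        where
        A : ℕ
        A = c ℕ.* k ℕ.^ (c ℕ.* k) ℕ.* suc n ℕ.^ c
        eventually : ∀ m → suc (from ℕ.+ (4 ℕ.* t ℕ.+ 7)) ℕ.≤ m → fromℕ τ m ≤ (fromℕ A *ʳ ln (fromℕ 1 +ʳ real ε)) m + δ
        eventually (suc m) (s≤s N≤m) = subst₂ (λ a b → a ≤ b * l + δ) (ι-def τ) (ι-def A) (ℚₚ.≤-trans
          (ℚₚ.≤-trans (ι-mono (ℕₚ.≤-trans τ≤ X≤)) (ℚₚ.≤-trans (ℚₚ.≤-reflexive (ι-* X (suc L)))
            (ℚₚ.≤-trans (*-monoʳ (0≤ι X) enough) (ℚₚ.≤-trans (ℚₚ.≤-reflexive (trans (sym (ℚₚ.*-assoc (ι X) (ι 8) l)) (cong (_* l) (sym (ι-* X 8)))))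
              (*-monoˡ (Riemann.lnSum-nonneg m y 1≤y) (ι-mono 8X≤))))))
          (≤-by (ℚₚ.<⇒≤ 0<δ) refl))
          where
          e y l : ℚ
          e = ℝ.seq ε (suc m)
          y = 1ℚ + e
          l = lnSum (suc m) y
          N≤ : from ℕ.≤ suc m
          N≤ = ℕₚ.≤-trans (ℕₚ.m≤m+n from _) (ℕₚ.m≤n⇒m≤1+n N≤m)
          1≤y : 1ℚ ≤ y
          1≤y = 1≤1+ε (suc m) N≤
          y≤ : y ≤ ι (suc m)
          y≤ = ℚₚ.≤-trans (ℚₚ.+-monoʳ-≤ 1ℚ (high (suc m) N≤)) (ℚₚ.≤-trans (ℚₚ.≤-reflexive (sym (ι-suc (4 ℕ.* t ℕ.+ 6))))
            (ι-mono (ℕₚ.≤-trans (ℕₚ.≤-reflexive (sym (ℕₚ.+-suc (4 ℕ.* t) 6))) (ℕₚ.≤-trans (ℕₚ.m≤n+m _ from) (ℕₚ.m≤n⇒m≤1+n N≤m)))))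
          enough : ι (suc L) ≤ ι 8 * l
          enough = Riemann.ln-lower m y 1≤y y≤ L
            (subst₂ _≤_ (sym (trans (ι-suc 2) (cong (1ℚ +_) ι-2))) (cong (_* y) (sym ι-2)) (≤-by (p≤q⇒0≤q-p (half (suc m) N≤) ⊕ p≤q⇒0≤q-p (half (suc m) N≤))
              (solve 1 (λ e → con 2ℚ :* (con 1ℚ :+ e) := (con 1ℚ :+ con 2ℚ) :+ ((e :- con ½) :+ (e :- con ½))) refl e)))
            -- 2^L ≤ 2t + 1 < 2 + 8t ≤ 2(1 + ε), using ε ≥ 4t.
            (ℚₚ.≤-<-trans (ι-mono (lg-lower t)) (ℚₚ.<-≤-trans (ι-mono-< {suc (t ℕ.+ t)} {2 ℕ.+ 2 ℕ.* (4 ℕ.* t)} strict)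
              (subst₂ _≤_ (sym (trans (ι-+ 2 (2 ℕ.* (4 ℕ.* t))) (cong (ι 2 +_) (ι-* 2 (4 ℕ.* t))))) refl
                (≤-by (0≤ι 2 ⊛ p≤q⇒0≤q-p (low (suc m) N≤))
                  (solve 3 (λ a e x → a :* (con 1ℚ :+ e) := (a :+ a :* x) :+ a :* (e :- x)) refl (ι 2) e (ι (4 ℕ.* t)))))))
            where
            strict : suc (t ℕ.+ t) ℕ.< 2 ℕ.+ 2 ℕ.* (4 ℕ.* t)
            strict = s≤s (s≤s (ℕₚ.≤-trans (ℕₚ.m≤m+n (t ℕ.+ t) (6 ℕ.* t)) (ℕₚ.≤-reflexive (eight-fold t))))
              where
              eight-fold : ∀ t → t ℕ.+ t ℕ.+ 6 ℕ.* t ≡ 2 ℕ.* (4 ℕ.* t)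
              eight-fold = ℕ-Ring.solve 1 (λ t → t ℕ-Ring.:+ t ℕ-Ring.:+ ℕ-Ring.con 6 ℕ-Ring.:* t ℕ-Ring.:= ℕ-Ring.con 2 ℕ-Ring.:* (ℕ-Ring.con 4 ℕ-Ring.:* t)) refl

    module _ {n : ℕ} (G : Hypergraph n) (k : ℕ) (k≥1 : 1 ℕ.≤ k) (h≥1 : 1 ℕ.≤ h)
      (As : List (Copy H G)) (disjoint : AllPairs Disjoint As) (k≤As : k ℕ.≤ length As) where

      E : ℚ
      E = expectedVal G k

      private
        k≤n : k ℕ.≤ n
        k≤n = ℕₚ.≤-trans k≤As (packing≤n h≥1 As disjoint)

        open Accuracy H k t k≥1 G As disjoint k≤As k≤n

        E≡ : E ≡ 𝔼 value (Encoder.encoded H k t G)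
        E≡ = expected h≥1 G k k≥1

        0≤E : 0ℚ ≤ E
        0≤E = subst (0ℚ ≤_) (sym E≡) (𝔼≥ (λ cs → 0≤ι (decoded cs)) (Encoder.encoded H k t G))

      -- A single class contains a copy whatever is sampled.
      one-class : k ≡ 1 → 1ℚ ≤ E
      one-class refl = subst (1ℚ ≤_) (sym E≡) (SelectionBounds.Single.constant≤mechanism (colouring 0 n)
          (Encoder.accepts H 1 t G) (Encoder.w H 1 t G) (Encoder.accepts-w H 1 t G) (Encoder.0≤w H 1 t G) (Encoder.w≤1 H 1 t G)
          L (Encoder.rounds H 1 t) (λ cs → 0≤ι (decoded cs))
          (Always-map (λ cs zeros → subst (_≤ value cs) ι-1 (ι-mono (present cs zeros k≤n))) (colouring 0 n) (colours-zero n)))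
        where
        someCopy : ∀ (As : List (Copy H G)) → 1 ℕ.≤ length As → Copy H G
        someCopy (A ∷ _) _ = A
        present : ∀ cs → (∀ v → colour cs v ≡ 0) → ∀ {n′} → 1 ℕ.≤ n′ → 1 ℕ.≤ tally (Classes.has G (family (edge H)) (colour cs)) n′ 0
        present cs zeros {suc n′} _ rewrite copy-good {es = family (edge H)} {χ = colour cs} {γ = 0} (someCopy As k≤As) (∈-family⁻ (edge H)) (λ {v} _ → zeros (toℕ v)) = s≤s z≤n

      approximation-at : ratio c ε k *ʳ fromℕ k ≤ʳ fromℚ E
      -- `N₁` ensures ε ≥ 1 - η, and k keeps the mesh of the sum for ln k at most 1; the two
      -- successors leave at least two pieces for ln 2.
      approximation-at δ 0<δ = suc (suc (from ℕ.+ (N₁ ℕ.+ k))) , eventually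
        where
        η : ℚ
        η = proj₁ (margin c δ 0<δ)
        0<η : 0ℚ < η
        0<η = proj₁ (proj₂ (margin c δ 0<δ))
        64η≤1 : 8ℚ * (8ℚ * η) ≤ 1ℚ
        64η≤1 = proj₁ (proj₂ (proj₂ (margin c δ 0<δ)))
        cη≤δ : ι c * ((8ℚ + 8ℚ) * η) ≤ δ
        cη≤δ = proj₂ (proj₂ (proj₂ (margin c δ 0<δ)))
        0≤8 : 0ℚ ≤ 8ℚ
        0≤8 = ℚₚ.<⇒≤ (ℚₚ.positive⁻¹ 8ℚ)
        η≤½ : η ≤ ½
        η≤½ = ≤-by (ℚₚ.<⇒≤ (ℚₚ.positive⁻¹ ½) ⊛ p≤q⇒0≤q-p 64η≤1 ⊕ ℚₚ.<⇒≤ (ℚₚ.positive⁻¹ (½ * (8ℚ * 8ℚ) - 1ℚ)) ⊛ ℚₚ.<⇒≤ 0<η)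
          (solve 1 (λ x → con ½ := x :+ (con ½ :* (con 1ℚ :- con 8ℚ :* (con 8ℚ :* x)) :+ con (½ * (8ℚ * 8ℚ) - 1ℚ) :* x)) refl η)
        N₁ : ℕ
        N₁ = proj₁ (1≤ε η 0<η)
        eventually : ∀ m → suc (suc (from ℕ.+ (N₁ ℕ.+ k))) ℕ.≤ m → (ratio c ε k *ʳ fromℕ k) m ≤ E + δ
        eventually (suc m) (s≤s N≤m) = subst₂ (λ C K → (1ℚ - C * ((lnSum (suc m) K ÷₀ ln2 + μ ÷₀ K) ÷₀ e)) * K ≤ E + δ)
            (ι-def c) (ι-def k) (bound (2 ℕₚ.≤? k))
          where
          open Logarithms m (ℕₚ.≤-trans (s≤s z≤n) N≤m)
          e μ l X : ℚ
          e = ℝ.seq ε (suc m)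
          μ = lnSum (suc m) (lnSum (suc m) (1ℚ + e) ÷₀ ln2) ÷₀ ln2
          l = lnSum (suc m) (ι k)
          X = (l ÷₀ ln2 + μ ÷₀ ι k) ÷₀ e
          N≤ : from ℕ.+ (N₁ ℕ.+ k) ℕ.≤ suc m
          N≤ = ℕₚ.≤-trans (ℕₚ.n≤1+n _) (ℕₚ.m≤n⇒m≤1+n N≤m)
          from≤ : from ℕ.≤ suc m
          from≤ = ℕₚ.≤-trans (ℕₚ.m≤m+n from _) N≤
          ½≤e : ½ ≤ e
          ½≤e = half (suc m) from≤
          0<e : 0ℚ < e
          0<e = ℚₚ.<-≤-trans (ℚₚ.positive⁻¹ ½) ½≤e
          1-η≤e : 1ℚ - η ≤ e
          1-η≤e = ≤-by (p≤q⇒0≤q-p (proj₂ (1≤ε η 0<η) (suc m) (ℕₚ.≤-trans (ℕₚ.m≤m+n N₁ k) (ℕₚ.≤-trans (ℕₚ.m≤n+m _ from) N≤))))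
            (solve 2 (λ e η → e := (con 1ℚ :- η) :+ (e :+ η :- con 1ℚ)) refl e η)
          μ≥ : - (8ℚ * η) ≤ μ
          μ≥ = log-log-lower e (ℚₚ.<⇒≤ 0<η) η≤½ 1-η≤e
          1≤K : 1ℚ ≤ ι k
          1≤K = subst (_≤ ι k) ι-1 (ι-mono k≥1)
          K≤m : ι k ≤ ι (suc m)
          K≤m = ι-mono (ℕₚ.≤-trans (ℕₚ.m≤n+m k N₁) (ℕₚ.≤-trans (ℕₚ.m≤n+m _ from) N≤))
          bound : Dec (2 ℕ.≤ k) → (1ℚ - ι c * X) * ι k ≤ E + δ
          bound (yes k≥2) = ℚₚ.≤-trans
              (ratio-bound {E} {l ÷₀ ln2} {μ} {e} h k (lg k) t k≥1 lg≥1 ½≤e (high (suc m) from≤) b≤ -1≤8μ 0≤E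
                (subst (λ E → ι t * ι k - (ι (k ℕ.* (h ℕ.* lg k)) + 1ℚ + 2ℚ * ι k) ≤ ι t * E) (sym E≡) accuracy) c ratio≤c)
              (≤-by (ℚₚ.<⇒≤ 0<δ) refl)
            where
            lg≥1 : 1 ℕ.≤ lg k
            lg≥1 = ℕₚ.≰⇒> λ lg≤0 → ℕₚ.<⇒≱ k≥2 (subst (λ b → k ℕ.≤ 2 ℕ.^ b) (ℕₚ.n≤0⇒n≡0 lg≤0) (lg-upper k))
            2^lg< : ∀ k → 1 ℕ.≤ k → 2 ℕ.^ lg k ℕ.< 2 ℕ.* k
            2^lg< (suc k) _ = ℕₚ.≤-<-trans (lg-lower k) (ℕₚ.≤-reflexive (trans (cong (λ z → suc (suc z)) (cong (k ℕ.+_) (sym (ℕₚ.+-identityʳ k))))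
              (cong suc (sym (ℕₚ.+-suc k (k ℕ.+ 0))))))
            b≤ : ι (suc (lg k)) ≤ 8ℚ * (l ÷₀ ln2)
            b≤ = ℚₚ.≤-trans (subst (λ x → ι (suc (lg k)) ≤ x * l) ι-8 (Riemann.ln-lower m (ι k) 1≤K K≤m (lg k)
                (ℚₚ.≤-trans (ι-mono (ℕₚ.≤-trans (ℕₚ.n≤1+n 3) (ℕₚ.*-monoʳ-≤ 2 k≥2))) (ℚₚ.≤-reflexive (ι-* 2 k)))
                (subst (ι (2 ℕ.^ lg k) <_) (ι-* 2 k) (ι-mono-< (2^lg< k k≥1)))))
              (*-monoʳ 0≤8 (log₂-dominates (ι k) 1≤K))
            -1≤8μ : - 1ℚ ≤ 8ℚ * μ
            -1≤8μ = ≤-by (0≤8 ⊛ p≤q⇒0≤q-p μ≥ ⊕ p≤q⇒0≤q-p 64η≤1)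
              (solve 2 (λ μ η → con 8ℚ :* μ := :- con 1ℚ :+ (con 8ℚ :* (μ :- :- (con 8ℚ :* η)) :+ (con 1ℚ :- con 8ℚ :* (con 8ℚ :* η)))) refl μ η)
          -- For k = 1 the term log k vanishes and log log (1 + ε) is 0 at ε = 1, so nothing pays
          -- for a loss: E ≥ 1 is needed in full. Only the dip of the approximants of ε below 1
          -- remains, and δ covers it.
          bound (no k≱2) = ≤-by (p≤q⇒0≤q-p (one-class k≡1) ⊕ p≤q⇒0≤q-p cη≤δ ⊕ 0≤ι c ⊛ p≤q⇒0≤q-p X≥)
              (trans (solve 5 (λ E d c X y → E :+ d := (con 1ℚ :- c :* X) :* con 1ℚ :+ ((E :- con 1ℚ) :+ (d :- c :* y) :+ c :* (X :- :- y)))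
                  refl E δ (ι c) X ((8ℚ + 8ℚ) * η))
                (cong (λ K → (1ℚ - ι c * X) * K + ((E - 1ℚ) + (δ - ι c * ((8ℚ + 8ℚ) * η)) + ι c * (X - - ((8ℚ + 8ℚ) * η)))) (sym K≡1)))
            where
            k≡1 : k ≡ 1
            k≡1 = ℕₚ.≤-antisym (ℕ.s≤s⁻¹ (ℕₚ.≰⇒> k≱2)) k≥1
            K≡1 : ι k ≡ 1ℚ
            K≡1 = trans (cong ι k≡1) ι-1
            μ/K : μ ÷₀ ι k ≡ μ
            μ/K = trans (sym (ℚₚ.*-identityʳ _)) (trans (cong (μ ÷₀ ι k *_) (sym K≡1)) (÷₀-* μ (ℚₚ.<-≤-trans 0<1 1≤K)))
            X≥ : - ((8ℚ + 8ℚ) * η) ≤ X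
            X≥ = ÷₀-lower 0<e (subst (λ z → (- ((8ℚ + 8ℚ) * η)) * e ≤ l ÷₀ ln2 + z) (sym μ/K) (≤-by
              (ℚₚ.≤-trans (Riemann.lnSum-nonneg m (ι k) 1≤K) (log₂-dominates (ι k) 1≤K) ⊕ p≤q⇒0≤q-p μ≥
                ⊕ (ℚₚ.<⇒≤ (ℚₚ.positive⁻¹ (8ℚ + 8ℚ)) ⊛ ℚₚ.<⇒≤ 0<η) ⊛ p≤q⇒0≤q-p ½≤e)
              (solve 4 (λ λ′ μ η e → λ′ :+ μ := (:- (con (8ℚ + 8ℚ) :* η)) :* e :+
                  (λ′ :+ (μ :- :- (con 8ℚ :* η)) :+ con (8ℚ + 8ℚ) :* η :* (e :- con ½))) refl (l ÷₀ ln2) μ η e)))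

    approximation : Approximation scheme (ratio c ε)
    approximation {n} G m ((S , val≡m) , optimal) k k≥1 k≤m =
        approximation-at G k k≥1 h≥1 (proj₁ S) (proj₂ S) (subst (k ℕ.≤_) (sym val≡m) k≤m)
      where
      -- Without vertices a copy can be repeated, so there is no optimum.
      repeated : ¬ 1 ℕ.≤ h → ∀ (As : List (Copy H G)) → AllPairs Disjoint As → 1 ℕ.≤ length As →
                 ∃ λ (S′ : Packing H G) → val S′ ≡ suc (length As)
      repeated h≱1 (A ∷ As) disjoint _ = (A ∷ A ∷ As , All.tabulate (λ {C} _ → apart C) ∷ disjoint) , refl
        where
        apart : ∀ C → Disjoint A C
        apart C (v , v∈) = let i , _ = onto-⊆ A (proj₁ (x∈p∩q⁻ (verts (proj₁ A)) (verts (proj₁ C)) v∈)) in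
          h≱1 (ℕₚ.≤-trans (s≤s z≤n) (Finₚ.toℕ<n i))
      h≥1 : 1 ℕ.≤ h
      h≥1 = decidable-stable (1 ℕₚ.≤? h) λ h≱1 →
        let S′ , more = repeated h≱1 (proj₁ S) (proj₂ S) (subst (1 ℕ.≤_) (sym val≡m) (ℕₚ.≤-trans k≥1 k≤m)) in
        ℕₚ.<⇒≱ (subst₂ ℕ._<_ val≡m (sym more) ℕₚ.≤-refl) (optimal S′)

theorem17 : ∀ {h} (H : Hypergraph h) → Σ ℕ λ c →
    ∀ (ε : ℝ) → fromℕ 1 ≤ʳ real ε →
    Σ (Scheme H ε) λ M →
    PolyTimeDecoder M c × FPTApproximation M (ratio c ε) × EncoderTime M c
theorem17 H = c , λ ε 1≤ε → scheme ε 1≤ε , polyTimeDecoder ε 1≤ε , (approximation ε 1≤ε , fptEncoder ε 1≤ε) , encoderTime ε 1≤ε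
  where open Theorem H
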